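{- Consider the online AdCell problem with both budget and capacity constraints, with budgets $b_i$, bids $u_{ij}$, customer capacities $c_k$ and arrival probabilities $p_j$. Let $\overline{OPT}_{BC}$ be the optimal value of the linear program $\overline{LP}_{BC}$. Then the expected revenue of Algorithm C (defined in the context) is at least $\left(\frac12-\frac1e\right)\overline{OPT}_{BC}$. This implies that the expected revenue of Algorithm C is also at least $\frac12-\frac1e$ of the expected revenue of the optimal offline allocation.
   Context: Problem. There are advertisers $i\in[m]$ with budgets $b_i$, queries $j\in[n]$, customers $k\in[s]$, and bids $u_{ij}\ge0$ of advertiser $i$ for query $j$. The queries are partitioned into sets $S_1,\dots,S_s$, where $S_k$ is the set of queries of customer $k$; customer $k$ has an integer capacity $c_k$, the maximum number of ads that can be sent to customer $k$. Each query $j$ has an arrival time and arrives with probability $p_j$; $I_j\in\{0,1\}$ is its arrival indicator. Arrivals of queries with different arrival times or from different customers are independent; queries of the same customer with the same arrival time are mutually exclusive (at most one of them arrives). All parameters are known in advance. Queries arrive online in order of arrival time and, upon arrival, each must immediately be allocated to one advertiser or discarded. An allocation is $X_{ij}\in\{0,1\}$ with $\sum_i X_{ij}\le I_j$ for all $j$ and $\sum_{j\in S_k}\sum_i X_{ij}\le c_k$ for all $k$. Its revenue is $\sum_i\min\left(\sum_j X_{ij}u_{ij},\,b_i\right)$. The optimal offline allocation is an allocation maximizing the revenue with full knowledge of the realized $I_1,\dots,I_n$. Linear program $\overline{LP}_{BC}$: maximize $\sum_i\sum_j x_{ij}u_{ij}$ subject to $\sum_i x_{ij}\le p_j$ for all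 $j\in[n]$, $\sum_{j\in S_k}\sum_i x_{ij}\le c_k$ for all $k\in[s]$, $\sum_j x_{ij}u_{ij}\le b_i$ for all $i\in[m]$, and $x_{ij}\in[0,1]$. Algorithm C. Compute an optimal (possibly fractional) solution $x^*$ of $\overline{LP}_{BC}$. Partition the queries into $T_1,\dots,T_u$ in increasing order of arrival time, all queries in one $T_t$ having the same arrival time. For $k\in[s]$, $t\in[u]$, $r\in[c_k]$ define recursively $$E_{k,t}^r=\sum_{j\in T_t\cap S_k}\sum_{i\in[m]}x^*_{ij}\max\left(u_{ij}+E_{k,t+1}^{r-1},\,E_{k,t+1}^{r}\right)+\Big(1-\sum_{j\in T_t\cap S_k}\sum_{i\in[m]}x^*_{ij}\Big)E_{k,t+1}^{r},$$ with $E_{k,t}^0=0$ and $E_{k,u+1}^r=0$. When query $j\in S_k\cap T_t$ arrives, choose one advertiser at random, advertiser $i$ being chosen with probability $x^*_{ij}/p_j$ (no advertiser is chosen, and the query is discarded, with the remaining probability), using fresh independent randomness for each query. Let $r$ be the current remaining capacity of customer $k$, i.e. $c_k$ minus the number of queries of customer $k$ allocated so far. If $r\ge1$ and $u_{ij}+E_{k,t+1}^{r-1}\ge E_{k,t+1}^{r}$, allocate query $j$ to advertiser $i$; otherwise discard it.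
   Formalization: The formal theorem additionally assumes that no bid exceeds its advertiser's budget (u_ij ≤ b_i); without this the claim is false, e.g. one advertiser with budget 1 and one query with bid 100 and arrival probability 1/100 gives LP value 1 but expected revenue 1/100. -}

module Defs where

open import Level using (_⊔_) renaming (suc to lsuc)
open import Algebra.Bundles using (CommutativeRing)
open import Data.Bool.Base using (Bool; true; false; if_then_else_; _∧_)
open import Data.Fin.Base using (Fin; toℕ)
open import Data.Fin.Properties using () renaming (_≟_ to _≟ᶠ_)
open import Data.List.Base using (List; []; _∷_; foldl; allFin)
open import Data.Maybe.Base using (Maybe; just; nothing)
open import Data.Nat.Base as ℕ using (ℕ; zero; suc; _!; _∸_)
open import Data.Product.Base using (_×_; ∃-syntax)
open import Data.Vec.Functional as Vector using (updateAt)
open import Function.Base using (const)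
open import Relation.Binary.Bundles using (DecTotalOrder)
open import Relation.Binary.Core using (Rel)
open import Relation.Binary.Structures using (IsDecTotalOrder)
open import Relation.Nullary using (¬_; does)
import Algebra.Construct.NaturalChoice.Max as NaturalMax
import Algebra.Construct.NaturalChoice.Min as NaturalMin
import Algebra.Definitions.RawMonoid as RawMonoidDefs
import Data.List.Base as List
import Relation.Binary.Construct.NonStrictToStrict as ToStrict

-- The intended instance is ℝ, read classically (its order is decidable).
-- The inverse is total, with 0⁻¹ = 0.
record OrderedField c ℓ₁ ℓ₂ : Set (lsuc (c ⊔ ℓ₁ ⊔ ℓ₂)) where
  infix 4 _≤_
  infix 9 _⁻¹
  field
    commutativeRing : CommutativeRing c ℓ₁
  open CommutativeRing commutativeRing public
    using (Carrier; _≈_; _+_; _*_; -_; _-_; 0#; 1#; +-rawMonoid; *-rawMonoid)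
  field
    _≤_             : Rel Carrier ℓ₂
    isDecTotalOrder : IsDecTotalOrder _≈_ _≤_
    +-monoˡ-≤       : ∀ z {x y} → x ≤ y → x + z ≤ y + z
    *-nonNegative   : ∀ {x y} → 0# ≤ x → 0# ≤ y → 0# ≤ x * y
    0≉1             : ¬ (0# ≈ 1#)
    _⁻¹             : Carrier → Carrier
    ⁻¹-cong         : ∀ {x y} → x ≈ y → x ⁻¹ ≈ y ⁻¹
    ⁻¹-inverseʳ     : ∀ {x} → ¬ (x ≈ 0#) → x * x ⁻¹ ≈ 1#
    0⁻¹≈0           : 0# ⁻¹ ≈ 0#

  decTotalOrder : DecTotalOrder c ℓ₁ ℓ₂
  decTotalOrder = record { isDecTotalOrder = isDecTotalOrder }

  open DecTotalOrder decTotalOrder public using (_≤?_; totalOrder)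
  open ToStrict _≈_ _≤_ public using (_<_)
  open NaturalMax totalOrder public using () renaming (_⊔_ to max)
  open NaturalMin totalOrder public using () renaming (_⊓_ to min)
  open RawMonoidDefs +-rawMonoid public using (sum) renaming (_×_ to _·_)
  open RawMonoidDefs *-rawMonoid public using () renaming (sum to product)

  infixl 7 _÷_
  _÷_ : Carrier → Carrier → Carrier
  x ÷ y = x * y ⁻¹

  fromℕ : ℕ → Carrier
  fromℕ n = n · 1#

  ½ : Carrier
  ½ = fromℕ 2 ⁻¹

  ∣_∣ : Carrier → Carrier
  ∣ x ∣ = max x (- x)

  sumWhen : ∀ {n} → (Fin n → Bool) → (Fin n → Carrier) → Carrier
  sumWhen p f = sum (λ j → if p j then f j else 0#)

  _⟶_ : (ℕ → Carrier) → Carrier → Set _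
  a ⟶ l = ∀ ε → 0# < ε → ∃[ N ] (∀ n → N ℕ.≤ n → ∣ a n - l ∣ ≤ ε)

  -- e = ∑ₖ 1/k!
  IsEuler : Carrier → Set _
  IsEuler e = (λ N → sum {N} (λ k → fromℕ (toℕ k !) ⁻¹)) ⟶ e

  sumBool : (Bool → Carrier) → Carrier
  sumBool f = f false + f true

  sumMaybe : ∀ {m} → (Maybe (Fin m) → Carrier) → Carrier
  sumMaybe f = f nothing + sum (λ i → f (just i))

  -- Sum over all functions Fin n → B, given summation over B.
  sumFunctions : ∀ {B : Set} n → ((B → Carrier) → Carrier) →
                 ((Fin n → B) → Carrier) → Carrier
  sumFunctions zero    sumB f = f Vector.[]
  sumFunctions (suc n) sumB f =
    sumB (λ b → sumFunctions n sumB (λ g → f (b Vector.∷ g)))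

open RawMonoidDefs ℕ.+-0-rawMonoid using () renaming (sum to sumℕ)

⟦_⟧ : Bool → ℕ
⟦ b ⟧ = if b then 1 else 0

module AdCell {c ℓ₁ ℓ₂} (F : OrderedField c ℓ₁ ℓ₂) where
  open OrderedField F

  record Market : Set (c ⊔ ℓ₂) where
    field
      m n s u  : ℕ                          -- advertisers, queries, customers, arrival times
      budget   : Fin m → Carrier
      bid      : Fin m → Fin n → Carrier
      customer : Fin n → Fin s              -- S_k = { j | customer j ≡ k }
      slot     : Fin n → Fin u              -- T_t = { j | slot j ≡ t }
      capacity : Fin s → ℕ
      prob     : Fin n → Carrier

    inCustomer : Fin s → Fin n → Bool
    inCustomer k j = does (customer j ≟ᶠ k)

    inBlock : Fin s → Fin u → Fin n → Bool
    inBlock k t j = inCustomer k j ∧ does (slot j ≟ᶠ t)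

    field
      budget≥0 : ∀ i → 0# ≤ budget i
      bid≥0    : ∀ i j → 0# ≤ bid i j
      -- Truncating a bid at the budget changes no revenue, but without this
      -- normalisation the guarantee against the LP fails: a single query with
      -- p = 1/v and bid v, against budget 1, has LP value 1 and revenue 1/v.
      bid≤budget : ∀ i j → bid i j ≤ budget i
      prob≥0   : ∀ j → 0# ≤ prob j
      -- Necessary for queries of one block to be mutually exclusive; also
      -- gives prob j ≤ 1.
      blockProb≤1 : ∀ k t → sumWhen (inBlock k t) prob ≤ 1#

  module _ (M : Market) where
    open Market M

    Arrivals : Set
    Arrivals = Fin n → Bool

    -- The 0/1 matrix X.
    Allocation : Set
    Allocation = Fin m → Fin n → Bool

    load : Allocation → Fin s → ℕ
    load X k = sumℕ (λ j → if inCustomer k j then sumℕ (λ i → ⟦ X i j ⟧) else 0)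

    record Feasible (I : Arrivals) (X : Allocation) : Set where
      field
        perQuery    : ∀ j → sumℕ (λ i → ⟦ X i j ⟧) ℕ.≤ ⟦ I j ⟧
        perCustomer : ∀ k → load X k ℕ.≤ capacity k

    revenue : Allocation → Carrier
    revenue X =
      sum (λ i → min (sum (λ j → if X i j then bid i j else 0#)) (budget i))

    record OfflineOptimal (I : Arrivals) (X : Allocation) : Set ℓ₂ where
      field
        feasible : Feasible I X
        optimal  : ∀ Y → Feasible I Y → revenue Y ≤ revenue X

    FractionalAllocation : Set c
    FractionalAllocation = Fin m → Fin n → Carrier

    record LPFeasible (x : FractionalAllocation) : Set ℓ₂ where
      field
        perQuery      : ∀ j → sum (λ i → x i j) ≤ prob j
        perCustomer   : ∀ k → sumWhen (inCustomer k) (λ j → sum (λ i → x i j))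
                              ≤ fromℕ (capacity k)
        perAdvertiser : ∀ i → sum (λ j → x i j * bid i j) ≤ budget i
        lower         : ∀ i j → 0# ≤ x i j
        upper         : ∀ i j → x i j ≤ 1#

    lpObjective : FractionalAllocation → Carrier
    lpObjective x = sum (λ i → sum (λ j → x i j * bid i j))

    record LPOptimal (x : FractionalAllocation) : Set (c ⊔ ℓ₂) where
      field
        feasible : LPFeasible x
        optimal  : ∀ y → LPFeasible y → lpObjective y ≤ lpObjective x

    -- OPT is the optimal value of the linear program.
    IsLPValue : Carrier → Set (c ⊔ ℓ₁ ⊔ ℓ₂)
    IsLPValue OPT = ∃[ x ] (LPOptimal x × OPT ≈ lpObjective x)

    -- Joint law of the arrivals: blocks S_k ∩ T_t are independent, and in
    -- each block either exactly one query j arrives (probability p_j) or none.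
    blockWeight : Fin s → Fin u → List (Fin n) → Carrier
    blockWeight k t []          = 1# - sumWhen (inBlock k t) prob
    blockWeight k t (j ∷ [])    = prob j
    blockWeight k t (_ ∷ _ ∷ _) = 0#

    blockProb : Fin s → Fin u → Arrivals → Carrier
    blockProb k t I =
      blockWeight k t (List.filterᵇ (λ j → inBlock k t j ∧ I j) (allFin n))

    arrivalProb : Arrivals → Carrier
    arrivalProb I = product (λ k → product (λ t → blockProb k t I))

    𝔼-arrivals : (Arrivals → Carrier) → Carrier
    𝔼-arrivals f = sumFunctions n sumBool (λ I → arrivalProb I * f I)

    expectedOffline : (Arrivals → Allocation) → Carrier
    expectedOffline off = 𝔼-arrivals (λ I → revenue (off I))

    module AlgorithmC (x* : FractionalAllocation) where

      -- For ts the list of slots T_t, …, T_u, this is E_{k,t}^r.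
      E : Fin s → List (Fin u) → ℕ → Carrier
      E k []       r       = 0#
      E k (t ∷ ts) zero    = 0#
      E k (t ∷ ts) (suc r) =
        sumWhen (inBlock k t) (λ j → sum (λ i →
          x* i j * max (bid i j + E k ts r) (E k ts (suc r))))
        + (1# - sumWhen (inBlock k t) (λ j → sum (λ i → x* i j)))
          * E k ts (suc r)

      -- The random choices, drawn for all queries up front; the choice for a
      -- query that does not arrive is never used.
      Choices : Set
      Choices = Fin n → Maybe (Fin m)

      choiceProb : Fin n → Maybe (Fin m) → Carrier
      choiceProb j (just i) = x* i j ÷ prob j
      choiceProb j nothing  = 1# - sum (λ i → x* i j ÷ prob j)

      𝔼-choices : (Choices → Carrier) → Carrier
      𝔼-choices f =
        sumFunctions n sumMaybe (λ A → product (λ j → choiceProb j (A j)) * f A)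

      -- The test at remaining capacity r, with ts the slots after the current one.
      accepts : List (Fin u) → Fin m → Fin n → ℕ → Bool
      accepts ts i j zero    = false
      accepts ts i j (suc r) =
        does (E (customer j) ts (suc r) ≤? (bid i j + E (customer j) ts r))

      allocate : Fin m → Fin n → Allocation → Allocation
      allocate i j X = updateAt X i (λ row → updateAt row j (const true))

      remaining : Allocation → Fin s → ℕ
      remaining X k = capacity k ∸ load X k

      offer : List (Fin u) → Fin n → Maybe (Fin m) → Allocation → Allocation
      offer ts j nothing  X = X
      offer ts j (just i) X =
        if accepts ts i j (remaining X (customer j)) then allocate i j X else X

      -- Within a slot the order is immaterial: almost surely the arriving
      -- queries belong to different customers.
      runFrom : List (Fin u) → Arrivals → Choices → Allocation → Allocation
      runFrom []       I A X = X
      runFrom (t ∷ ts) I A X = runFrom ts I A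
        (foldl (λ Y j → offer ts j (A j) Y) X
          (List.filterᵇ (λ j → does (slot j ≟ᶠ t) ∧ I j) (allFin n)))

      run : Arrivals → Choices → Allocation
      run I A = runFrom (allFin u) I A (λ _ _ → false)

      expectedRevenue : Carrier
      expectedRevenue = 𝔼-arrivals (λ I → 𝔼-choices (λ A → revenue (run I A)))

-- Only the offers matter: query j arrives and draws advertiser i with probability x*ᵢⱼ,
-- independently across the blocks S_k ∩ T_t and exclusively within a block.
--
-- Ignoring budgets, customer k is worth E_{k,1}^{c_k} in expectation. The marginal values
-- E^{r+1} − E^r decrease in r and increase with the number of remaining slots, so
-- ∑ x*ᵢⱼ uᵢⱼ over S_k is at most E^{c_k} plus the marginal value at c_k times the expected number
-- of offers, which is at most c_k; hence it is at most 2 E^{c_k}.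
--
-- The budget of advertiser i costs at most the excess of W = ∑ (bids of i on queries offered
-- to it) over bᵢ. With a_B the expected share of bᵢ demanded in block B,
-- 𝔼 min(W, bᵢ) ≥ bᵢ (1 − ∏ (1 − a_B)) and ∏ (1 − a_B) ≤ 1 − (1 − 1/e) ∑ a_B, so the expected
-- excess is at most 1/e times the expectation of W. Summing, the revenue is at least
-- (1/2 − 1/e) ∑ x*ᵢⱼ uᵢⱼ.
--
-- The offline optimum, with each advertiser scaled down to its budget and averaged over the
-- arrivals, is feasible for the linear program.
module Submission where

open import Defs
open import Algebra.Bundles using (CommutativeMonoid; CommutativeRing; Semiring)
open import Data.Bool.Base using (Bool; true; false; if_then_else_; _∧_; _∨_)
open import Data.Bool.Properties using (T?; T-≡)
open import Data.Fin.Base using (Fin; zero; suc; toℕ)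
open import Data.Fin.Properties using () renaming (_≟_ to _≟ᶠ_)
open import Data.Integer.Base as ℤ using (ℤ; +_; -[1+_])
open import Data.List.Base as List using (List; []; _∷_; _++_; allFin; foldl; tabulate)
open import Data.List.Membership.Propositional using (_∈_; _∉_)
open import Data.List.Membership.Propositional.Properties using (∈-allFin; ∈-cartesianProduct⁺; ∈-filter⁺; ∈-filter⁻)
open import Data.List.Relation.Unary.All as All using (All)
open import Data.List.Relation.Unary.AllPairs using ([]; _∷_)
open import Data.List.Relation.Unary.Any using (here; there)
open import Data.List.Relation.Unary.Unique.Propositional using (Unique)
open import Data.List.Relation.Unary.Unique.Propositional.Properties using (allFin⁺; cartesianProduct⁺; filter⁺)
open import Data.Maybe.Base using (Maybe; just; nothing)
open import Data.Nat.Base as ℕ using (ℕ; zero; suc; _!; _∸_)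
open import Data.Product.Base using (_×_; _,_; proj₁; proj₂)
open import Data.Sum.Base using (inj₁; inj₂; [_,_]′)
open import Data.Vec.Functional as Vector using (updateAt)
open import Function.Base using (_∘_; id; const)
open import Function.Bundles using (Equivalence)
open import Level using (Level)
open import Relation.Binary.Bundles using (DecTotalOrder)
open import Relation.Binary.PropositionalEquality.Core as ≡ using (_≡_; _≢_)
open import Relation.Nullary using (¬_; yes; no; does)
open import Relation.Nullary.Decidable using (dec-true; dec-false)
open import Relation.Nullary.Negation using (contradiction)
import Algebra.Construct.NaturalChoice.Max as NaturalMax
import Algebra.Construct.NaturalChoice.Min as NaturalMin
import Algebra.Properties.CommutativeMonoid.Sum as MonoidSum
import Algebra.Properties.CommutativeSemigroup as SemigroupProperties
import Algebra.Properties.Ring as RingProperties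
import Algebra.Properties.Semiring.Exp as Powers
import Algebra.Properties.Semiring.Mult as Multiples
import Algebra.Properties.Semiring.Mult.TCOptimised as Multiples′
import Algebra.Properties.Semiring.Sum as Sums
import Algebra.Solver.Ring as RingSolver
import Algebra.Solver.Ring.AlmostCommutativeRing as ACR
import Data.Integer.Properties as ℤₚ
import Data.Nat.Properties as ℕₚ
import Data.Vec.Functional.Properties as Vectorₚ
import Relation.Binary.Reasoning.PartialOrder as ≤-Reasoning
import Relation.Binary.Reasoning.Setoid as ≈-Reasoning

-- Capacities and budgets interact during the run, yet the two losses are estimated separately. This
-- works because the excess of an advertiser over its budget grows with the amount charged to it,
-- and that amount never exceeds the sum of the bids offered to it, a quantity on which the
-- acceptance decisions have no influence. The comparison holds outcome by outcome, so linearity of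
-- expectation alone joins the two analyses.
--
-- Each expectation is bounded by induction along a list of blocks, from an arbitrary outcome that
-- is still blank on the blocks ahead; `outcomeStep-≥` is the common inductive step.
--
-- `e` is given only as the limit of its series, and an ordered field need not carry an exponential
-- function. The estimate 1 - b ≤ exp(-b) is therefore replaced by (1 - b) exp(x + b) ≤ exp(x) for
-- truncated series, where nonnegativity of the terms gives the truncation error the right sign.

-- A ring solver with integer coefficients

module IntegerSolver {c ℓ : Level} (R : CommutativeRing c ℓ) where
  open CommutativeRing R
  open RingProperties ring
  open Multiples′ semiring using (1+×; ×-homo-+; ×1-homo-*) renaming (_×_ to _·′_)
  open ≈-Reasoning setoid

  -- The optimised multiples make `⟦ + 1 ⟧ℤ` reduce to `1#` itself, so that `con (+ 1)` in solver
  -- equations matches the `1#` of the goals.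
  ⟦_⟧ℤ : ℤ → Carrier
  ⟦ + n      ⟧ℤ = n ·′ 1#
  ⟦ -[1+ n ] ⟧ℤ = - (suc n ·′ 1#)

  private
    cancel : ∀ x y z → (x + y) - (x + z) ≈ y - z
    cancel x y z = begin
      (x + y) - (x + z)       ≈⟨ +-cong (+-comm x y) (sym (-‿+-comm x z)) ⟩
      (y + x) + (- x + - z)   ≈⟨ +-assoc y x _ ⟩
      y + (x + (- x + - z))   ≈⟨ +-congˡ (sym (+-assoc x (- x) (- z))) ⟩
      y + ((x - x) + - z)     ≈⟨ +-congˡ (+-congʳ (-‿inverseʳ x)) ⟩
      y + (0# + - z)          ≈⟨ +-congˡ (+-identityˡ (- z)) ⟩
      y - z                   ∎

    -- The values of _⊖_ only unfold along its Boolean test, hence the rewriting with ℤₚ.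
    ⊖-homo : ∀ m n → ⟦ m ℤ.⊖ n ⟧ℤ ≈ m ·′ 1# - n ·′ 1#
    ⊖-homo zero zero = sym (-‿inverseʳ 0#)
    ⊖-homo (suc m) zero = sym (trans (+-congˡ -0#≈0#) (+-identityʳ _))
    ⊖-homo zero (suc n) = sym (+-identityˡ _)
    ⊖-homo (suc m) (suc n) rewrite ℤₚ.[1+m]⊖[1+n]≡m⊖n m n = begin
      ⟦ m ℤ.⊖ n ⟧ℤ                         ≈⟨ ⊖-homo m n ⟩
      m ·′ 1# - n ·′ 1#                    ≈⟨ sym (cancel 1# _ _) ⟩
      (1# + m ·′ 1#) - (1# + n ·′ 1#)      ≈⟨ +-cong (sym (1+× m 1#)) (-‿cong (sym (1+× n 1#))) ⟩
      suc m ·′ 1# - suc n ·′ 1#            ∎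

    +-homo : ∀ i j → ⟦ i ℤ.+ j ⟧ℤ ≈ ⟦ i ⟧ℤ + ⟦ j ⟧ℤ
    +-homo (+ m) (+ n) = ×-homo-+ 1# m n
    +-homo (+ m) -[1+ n ] = ⊖-homo m (suc n)
    +-homo -[1+ m ] (+ n) = trans (⊖-homo n (suc m)) (+-comm _ _)
    +-homo -[1+ m ] -[1+ n ] = begin
      - (suc (suc (m ℕ.+ n)) ·′ 1#)          ≡⟨ ≡.cong (λ k → - (k ·′ 1#)) (≡.sym (ℕₚ.+-suc (suc m) n)) ⟩
      - ((suc m ℕ.+ suc n) ·′ 1#)            ≈⟨ -‿cong (×-homo-+ 1# (suc m) (suc n)) ⟩
      - (suc m ·′ 1# + suc n ·′ 1#)          ≈⟨ sym (-‿+-comm _ _) ⟩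
      - (suc m ·′ 1#) + - (suc n ·′ 1#)      ∎

    -‿homo : ∀ i → ⟦ ℤ.- i ⟧ℤ ≈ - ⟦ i ⟧ℤ
    -‿homo (+ zero)  = sym -0#≈0#
    -‿homo (+ suc n) = refl
    -‿homo -[1+ n ]  = sym (-‿involutive _)

    +*+-homo : ∀ m n → ⟦ + m ℤ.* + n ⟧ℤ ≈ ⟦ + m ⟧ℤ * ⟦ + n ⟧ℤ
    +*+-homo m n rewrite ≡.sym (ℤₚ.pos-* m n) = ×1-homo-* m n

    *-homo : ∀ i j → ⟦ i ℤ.* j ⟧ℤ ≈ ⟦ i ⟧ℤ * ⟦ j ⟧ℤ
    *-homo (+ m) (+ n) = +*+-homo m n
    *-homo (+ m) -[1+ n ] rewrite ≡.sym (ℤₚ.neg-distribʳ-* (+ m) (+ suc n)) = begin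
      ⟦ ℤ.- (+ m ℤ.* + suc n) ⟧ℤ    ≈⟨ -‿homo (+ m ℤ.* + suc n) ⟩
      - ⟦ + m ℤ.* + suc n ⟧ℤ        ≈⟨ -‿cong (+*+-homo m (suc n)) ⟩
      - (m ·′ 1# * suc n ·′ 1#)     ≈⟨ -‿distribʳ-* _ _ ⟩
      m ·′ 1# * - (suc n ·′ 1#)     ∎
    *-homo -[1+ m ] (+ n) rewrite ≡.sym (ℤₚ.neg-distribˡ-* (+ suc m) (+ n)) = begin
      ⟦ ℤ.- (+ suc m ℤ.* + n) ⟧ℤ    ≈⟨ -‿homo (+ suc m ℤ.* + n) ⟩
      - ⟦ + suc m ℤ.* + n ⟧ℤ        ≈⟨ -‿cong (+*+-homo (suc m) n) ⟩
      - (suc m ·′ 1# * n ·′ 1#)     ≈⟨ -‿distribˡ-* _ _ ⟩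
      - (suc m ·′ 1#) * n ·′ 1#     ∎
    *-homo -[1+ m ] -[1+ n ] = begin
      (suc m ℕ.* suc n) ·′ 1#                ≈⟨ ×1-homo-* (suc m) (suc n) ⟩
      suc m ·′ 1# * suc n ·′ 1#              ≈⟨ sym (-‿involutive _) ⟩
      - - (suc m ·′ 1# * suc n ·′ 1#)        ≈⟨ -‿cong (-‿distribˡ-* _ _) ⟩
      - (- (suc m ·′ 1#) * suc n ·′ 1#)      ≈⟨ -‿distribʳ-* _ _ ⟩
      - (suc m ·′ 1#) * - (suc n ·′ 1#)      ∎

  private
    almostCommutativeRing = ACR.fromCommutativeRing R

    morphism : ℤ.+-*-rawRing ACR.-Raw-AlmostCommutative⟶ almostCommutativeRing
    morphism = record
      { ⟦_⟧    = ⟦_⟧ℤ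
      ; +-homo = +-homo
      ; *-homo = *-homo
      ; -‿homo = -‿homo
      ; 0-homo = refl
      ; 1-homo = refl
      }

    coefficient? : ∀ i j → Maybe (⟦ i ⟧ℤ ≈ ⟦ j ⟧ℤ)
    coefficient? i j with i ℤₚ.≟ j
    ... | yes ≡.refl = just refl
    ... | no _       = nothing

  open RingSolver ℤ.+-*-rawRing almostCommutativeRing morphism coefficient? public
    using (solve; _:=_; _:+_; _:*_; _:-_; :-_; con)

-- Arithmetic of ordered fields and finite sums

module FieldProperties {c ℓ₁ ℓ₂ : Level} (F : OrderedField c ℓ₁ ℓ₂) where
  open OrderedField F public
  open CommutativeRing commutativeRing public
    using (refl; sym; trans; reflexive; setoid; semiring;
           +-cong; +-congˡ; +-congʳ; +-assoc; +-comm; +-identityˡ; +-identityʳ;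
           *-cong; *-congˡ; *-congʳ; *-assoc; *-comm; *-identityˡ; *-identityʳ;
           zeroˡ; zeroʳ; distribˡ; distribʳ; -‿cong; -‿inverseʳ)
  open IntegerSolver commutativeRing public
  open Sums semiring public
    using (sum-cong-≋; sum-cong-≗; ∑-distrib-+; ∑-comm; *-distribˡ-sum; *-distribʳ-sum; sum-replicate-zero)
  open NaturalMax totalOrder public
    using () renaming (x≤x⊔y to x≤max; x≤y⊔x to y≤max; ⊔-lub to max-lub;
                       ⊔-mono-≤ to max-mono)
  open NaturalMin totalOrder public
    using () renaming (x⊓y≤x to min≤x; x⊓y≤y to min≤y; ⊓-glb to min-glb; ⊓-cong to min-cong;
                       x≤y⇒x⊓y≈x to x≤y⇒min≈x; x≤y⇒y⊓x≈x to y≤x⇒min≈y)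
  open DecTotalOrder decTotalOrder public
    using (poset) renaming
      (refl to ≤-refl; reflexive to ≤-reflexive; trans to ≤-trans; antisym to ≤-antisym;
       total to ≤-total; _≟_ to _≈?_)

  open ≤-Reasoning poset

  ≥-reflexive : ∀ {x y} → x ≈ y → y ≤ x
  ≥-reflexive x≈y = ≤-reflexive (sym x≈y)

  +-monoʳ-≤ : ∀ z {x y} → x ≤ y → z + x ≤ z + y
  +-monoʳ-≤ z {x} {y} x≤y = begin
    z + x  ≈⟨ +-comm z x ⟩
    x + z  ≤⟨ +-monoˡ-≤ z x≤y ⟩
    y + z  ≈⟨ +-comm y z ⟩
    z + y  ∎

  +-mono-≤ : ∀ {x y u v} → x ≤ y → u ≤ v → x + u ≤ y + v
  +-mono-≤ {y = y} {u = u} x≤y u≤v = ≤-trans (+-monoˡ-≤ u x≤y) (+-monoʳ-≤ y u≤v)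

  x≤y⇒0≤y-x : ∀ {x y} → x ≤ y → 0# ≤ y - x
  x≤y⇒0≤y-x {x} {y} x≤y = begin
    0#     ≈⟨ sym (-‿inverseʳ x) ⟩
    x - x  ≤⟨ +-monoˡ-≤ (- x) x≤y ⟩
    y - x  ∎

  -- Turns an inequality into a nonnegative gap `d` and an equation; for polynomial inequalities the
  -- equation is left to the ring solver.
  ≤-by : ∀ {x y} d → 0# ≤ d → x + d ≈ y → x ≤ y
  ≤-by {x} {y} d 0≤d x+d≈y = begin
    x       ≈⟨ sym (+-identityʳ x) ⟩
    x + 0#  ≤⟨ +-monoʳ-≤ x 0≤d ⟩
    x + d   ≈⟨ x+d≈y ⟩
    y       ∎

  0≤y-x⇒x≤y : ∀ {x y} → 0# ≤ y - x → x ≤ y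
  0≤y-x⇒x≤y {x} {y} 0≤ = ≤-by (y - x) 0≤ (solve 2 (λ x y → x :+ (y :- x) := y) refl x y)

  +-nonNeg : ∀ {x y} → 0# ≤ x → 0# ≤ y → 0# ≤ x + y
  +-nonNeg 0≤x 0≤y = ≤-trans (≥-reflexive (+-identityʳ 0#)) (+-mono-≤ 0≤x 0≤y)

  neg-mono-≤ : ∀ {x y} → x ≤ y → - y ≤ - x
  neg-mono-≤ {x} {y} x≤y = ≤-by (y - x) (x≤y⇒0≤y-x x≤y)
    (solve 2 (λ x y → :- y :+ (y :- x) := :- x) refl x y)

  -‿mono-≤ : ∀ {x y u v} → x ≤ y → v ≤ u → x - u ≤ y - v
  -‿mono-≤ x≤y v≤u = +-mono-≤ x≤y (neg-mono-≤ v≤u)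

  +-cancelʳ-≤ : ∀ z {x y} → x + z ≤ y + z → x ≤ y
  +-cancelʳ-≤ z {x} {y} le = ≤-by (y + z - (x + z)) (x≤y⇒0≤y-x le)
    (solve 3 (λ x y z → x :+ (y :+ z :- (x :+ z)) := y) refl x y z)

  *-monoʳ-≤ : ∀ {z x y} → 0# ≤ z → x ≤ y → z * x ≤ z * y
  *-monoʳ-≤ {z} {x} {y} 0≤z x≤y = ≤-by (z * (y - x)) (*-nonNegative 0≤z (x≤y⇒0≤y-x x≤y))
    (solve 3 (λ x y z → z :* x :+ z :* (y :- x) := z :* y) refl x y z)

  *-monoˡ-≤ : ∀ {z x y} → 0# ≤ z → x ≤ y → x * z ≤ y * z
  *-monoˡ-≤ {z} {x} {y} 0≤z x≤y = begin
    x * z  ≈⟨ *-comm x z ⟩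
    z * x  ≤⟨ *-monoʳ-≤ 0≤z x≤y ⟩
    z * y  ≈⟨ *-comm z y ⟩
    y * z  ∎

  0≤1 : 0# ≤ 1#
  0≤1 with ≤-total 0# 1#
  ... | inj₁ 0≤1 = 0≤1
  ... | inj₂ 1≤0 = begin
    0#                     ≤⟨ *-nonNegative (x≤y⇒0≤y-x 1≤0) (x≤y⇒0≤y-x 1≤0) ⟩
    (0# - 1#) * (0# - 1#)  ≈⟨ solve 0 ((con (+ 0) :- con (+ 1)) :* (con (+ 0) :- con (+ 1)) := con (+ 1)) refl ⟩
    1#                     ∎

  1≰0 : ¬ (1# ≤ 0#)
  1≰0 1≤0 = 0≉1 (≤-antisym 0≤1 1≤0)

  ≰⇒≥ : ∀ {x y} → ¬ (x ≤ y) → y ≤ x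
  ≰⇒≥ {x} {y} x≰y with ≤-total x y
  ... | inj₁ x≤y = contradiction x≤y x≰y
  ... | inj₂ y≤x = y≤x

  ⁻¹-nonNeg : ∀ {x} → 0# ≤ x → 0# ≤ x ⁻¹
  ⁻¹-nonNeg {x} 0≤x with x ≈? 0# | ≤-total 0# (x ⁻¹)
  ... | _       | inj₁ 0≤x⁻¹ = 0≤x⁻¹
  ... | yes x≈0 | inj₂ _     = ≥-reflexive (trans (⁻¹-cong x≈0) 0⁻¹≈0)
  ... | no  x≉0 | inj₂ x⁻¹≤0 = contradiction
    (begin
      1#                ≈⟨ sym (⁻¹-inverseʳ x≉0) ⟩
      x * x ⁻¹          ≤⟨ *-monoʳ-≤ 0≤x x⁻¹≤0 ⟩
      x * 0#            ≈⟨ zeroʳ x ⟩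
      0#                ∎) 1≰0

  ⁻¹-unique : ∀ {x y} → x * y ≈ 1# → y ≈ x ⁻¹
  ⁻¹-unique {x} {y} xy≈1 = begin-equality
    y               ≈⟨ sym (*-identityˡ y) ⟩
    1# * y          ≈⟨ *-congʳ (sym (⁻¹-inverseʳ x≉0)) ⟩
    x * x ⁻¹ * y    ≈⟨ solve 3 (λ x y z → x :* z :* y := x :* y :* z) refl x y (x ⁻¹) ⟩
    x * y * x ⁻¹    ≈⟨ *-congʳ xy≈1 ⟩
    1# * x ⁻¹       ≈⟨ *-identityˡ (x ⁻¹) ⟩
    x ⁻¹            ∎
    where
    x≉0 : ¬ (x ≈ 0#)
    x≉0 x≈0 = 0≉1 (trans (sym (zeroˡ y)) (trans (*-congʳ (sym x≈0)) xy≈1))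

  -- The bounds force y ≈ 0 when x ≈ 0, where y ÷ x is the junk value 0.
  x*[y÷x]≈y : ∀ {x y} → 0# ≤ y → y ≤ x → x * (y ÷ x) ≈ y
  x*[y÷x]≈y {x} {y} 0≤y y≤x with x ≈? 0#
  ... | yes x≈0 = trans (trans (*-congʳ x≈0) (zeroˡ _)) (≤-antisym 0≤y (≤-trans y≤x (≤-reflexive x≈0)))
  ... | no  x≉0 = begin-equality
    x * (y * x ⁻¹)  ≈⟨ solve 3 (λ x y z → x :* (y :* z) := y :* (x :* z)) refl x y (x ⁻¹) ⟩
    y * (x * x ⁻¹)  ≈⟨ *-congˡ (⁻¹-inverseʳ x≉0) ⟩
    y * 1#          ≈⟨ *-identityʳ y ⟩
    y               ∎

  y÷x≤1 : ∀ {x y} → 0# ≤ y → y ≤ x → y ÷ x ≤ 1#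
  y÷x≤1 {x} {y} 0≤y y≤x with x ≈? 0#
  ... | yes x≈0 = ≤-trans (≤-reflexive (trans (*-congˡ (trans (⁻¹-cong x≈0) 0⁻¹≈0)) (zeroʳ y))) 0≤1
  ... | no  x≉0 = begin
    y * x ⁻¹  ≤⟨ *-monoˡ-≤ (⁻¹-nonNeg (≤-trans 0≤y y≤x)) y≤x ⟩
    x * x ⁻¹  ≈⟨ ⁻¹-inverseʳ x≉0 ⟩
    1#        ∎

  fromℕ-nonNeg : ∀ n → 0# ≤ fromℕ n
  fromℕ-nonNeg zero    = ≤-refl
  fromℕ-nonNeg (suc n) = +-nonNeg 0≤1 (fromℕ-nonNeg n)

  1≤fromℕ-suc : ∀ n → 1# ≤ fromℕ (suc n)
  1≤fromℕ-suc n = ≤-by (fromℕ n) (fromℕ-nonNeg n) refl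

  fromℕ-suc≉0 : ∀ n → ¬ (fromℕ (suc n) ≈ 0#)
  fromℕ-suc≉0 n eq = 1≰0 (≤-trans (1≤fromℕ-suc n) (≤-reflexive eq))

  fromℕ-* : ∀ m n → fromℕ (m ℕ.* n) ≈ fromℕ m * fromℕ n
  fromℕ-* = Multiples.×1-homo-* semiring

  fromℕ-+ : ∀ m n → fromℕ (m ℕ.+ n) ≈ fromℕ m + fromℕ n
  fromℕ-+ = Multiples.×-homo-+ semiring 1#

  fromℕ-mono : ∀ {m n} → m ℕ.≤ n → fromℕ m ≤ fromℕ n
  fromℕ-mono {n = n} ℕ.z≤n       = fromℕ-nonNeg n
  fromℕ-mono (ℕ.s≤s m≤n) = +-monoʳ-≤ 1# (fromℕ-mono m≤n)

  ∑-cong : ∀ {n} {f g : Fin n → Carrier} → (∀ i → f i ≈ g i) → sum f ≈ sum g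
  ∑-cong = sum-cong-≋

  ∑-mono : ∀ {n} {f g : Fin n → Carrier} → (∀ i → f i ≤ g i) → sum f ≤ sum g
  ∑-mono {zero}  f≤g = ≤-refl
  ∑-mono {suc n} f≤g = +-mono-≤ (f≤g zero) (∑-mono (f≤g ∘ suc))

  ∑-zero : ∀ {n} {f : Fin n → Carrier} → (∀ i → f i ≈ 0#) → sum f ≈ 0#
  ∑-zero {n} f≈0 = trans (∑-cong f≈0) (sum-replicate-zero n)

  ∑-nonNeg : ∀ {n} {f : Fin n → Carrier} → (∀ i → 0# ≤ f i) → 0# ≤ sum f
  ∑-nonNeg {n} 0≤f = ≤-trans (≥-reflexive (sum-replicate-zero n)) (∑-mono 0≤f)

  ∑-distrib-- : ∀ {n} (f g : Fin n → Carrier) → sum (λ i → f i - g i) ≈ sum f - sum g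
  ∑-distrib-- {zero}  f g = sym (-‿inverseʳ 0#)
  ∑-distrib-- {suc n} f g = trans (+-congˡ (∑-distrib-- (f ∘ suc) (g ∘ suc)))
    (solve 4 (λ a b x y → (a :- b) :+ (x :- y) := (a :+ x) :- (b :+ y)) refl _ _ _ _)

  ∑-single : ∀ {n} {f : Fin n → Carrier} i → (∀ j → j ≢ i → f j ≈ 0#) → sum f ≈ f i
  ∑-single {f = f} zero    f≈0 = trans (+-congˡ (∑-zero (λ j → f≈0 (suc j) λ ()))) (+-identityʳ _)
  ∑-single {f = f} (suc i) f≈0 = trans
    (+-cong (f≈0 zero λ ()) (∑-single i λ j j≢i → f≈0 (suc j) λ { ≡.refl → j≢i ≡.refl }))
    (+-identityˡ _)

  term≤∑ : ∀ {n} {f : Fin n → Carrier} → (∀ i → 0# ≤ f i) → ∀ i → f i ≤ sum f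
  term≤∑ {f = f} 0≤f zero    = ≤-by _ (∑-nonNeg (0≤f ∘ suc)) refl
  term≤∑ {f = f} 0≤f (suc i) = ≤-trans (term≤∑ (0≤f ∘ suc) i) (≤-by (f zero) (0≤f zero) (+-comm _ _))

  if-cong : ∀ b {x y} → (b ≡ true → x ≈ y) → (if b then x else 0#) ≈ (if b then y else 0#)
  if-cong true  x≈y = x≈y ≡.refl
  if-cong false _   = refl

  if-0 : ∀ b → (if b then 0# else 0#) ≈ 0#
  if-0 true  = refl
  if-0 false = refl

  if-mono : ∀ b {x y} → (b ≡ true → x ≤ y) → (if b then x else 0#) ≤ (if b then y else 0#)
  if-mono true  x≤y = x≤y ≡.refl
  if-mono false _   = ≤-refl

  if-nonNeg : ∀ b {x} → 0# ≤ x → 0# ≤ (if b then x else 0#)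
  if-nonNeg true  0≤x = 0≤x
  if-nonNeg false _   = ≤-refl

  *-if : ∀ b {x y} → x * (if b then y else 0#) ≈ (if b then x * y else 0#)
  *-if true  = refl
  *-if false = zeroʳ _

  if-+ : ∀ b {x y} → (if b then x else 0#) + (if b then y else 0#) ≈ (if b then x + y else 0#)
  if-+ true  = refl
  if-+ false = +-identityˡ 0#

  if-- : ∀ b {x y} → (if b then x else 0#) - (if b then y else 0#) ≈ (if b then x - y else 0#)
  if-- true  = refl
  if-- false = -‿inverseʳ 0#

  module _ {n : ℕ} (p : Fin n → Bool) where

    sumWhen-cong : ∀ {f g} → (∀ j → p j ≡ true → f j ≈ g j) → sumWhen p f ≈ sumWhen p g
    sumWhen-cong f≈g = ∑-cong (λ j → if-cong (p j) (f≈g j))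

    sumWhen-mono : ∀ {f g} → (∀ j → p j ≡ true → f j ≤ g j) → sumWhen p f ≤ sumWhen p g
    sumWhen-mono f≤g = ∑-mono (λ j → if-mono (p j) (f≤g j))

    sumWhen-nonNeg : ∀ {f} → (∀ j → 0# ≤ f j) → 0# ≤ sumWhen p f
    sumWhen-nonNeg 0≤f = ∑-nonNeg (λ j → if-nonNeg (p j) (0≤f j))

    sumWhen-+ : ∀ f g → sumWhen p (λ j → f j + g j) ≈ sumWhen p f + sumWhen p g
    sumWhen-+ f g = trans (∑-cong (λ j → sym (if-+ (p j)))) (∑-distrib-+ {n} _ _)

    sumWhen-- : ∀ f g → sumWhen p (λ j → f j - g j) ≈ sumWhen p f - sumWhen p g
    sumWhen-- f g = trans (∑-cong (λ j → sym (if-- (p j)))) (∑-distrib-- {n} _ _)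

    *-sumWhen : ∀ x f → x * sumWhen p f ≈ sumWhen p (λ j → x * f j)
    *-sumWhen x f = trans (*-distribˡ-sum {n} x _) (∑-cong (λ j → *-if (p j)))

  -- Lists are used beside `Fin n` because the inductions consume blocks and slots one at a time.
  sumOver : ∀ {a} {A : Set a} → List A → (A → Carrier) → Carrier
  sumOver []       f = 0#
  sumOver (x ∷ xs) f = f x + sumOver xs f

  productOver : ∀ {a} {A : Set a} → List A → (A → Carrier) → Carrier
  productOver []       f = 1#
  productOver (x ∷ xs) f = f x * productOver xs f

  sumOver-cong : ∀ {a} {A : Set a} (xs : List A) {f g : A → Carrier} →
                 (∀ x → f x ≈ g x) → sumOver xs f ≈ sumOver xs g
  sumOver-cong []       f≈g = refl
  sumOver-cong (x ∷ xs) f≈g = +-cong (f≈g x) (sumOver-cong xs f≈g)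

  productOver-cong : ∀ {a} {A : Set a} (xs : List A) {f g : A → Carrier} →
                     (∀ x → f x ≈ g x) → productOver xs f ≈ productOver xs g
  productOver-cong []       f≈g = refl
  productOver-cong (x ∷ xs) f≈g = *-cong (f≈g x) (productOver-cong xs f≈g)

  sumOver-++ : ∀ {a} {A : Set a} (xs ys : List A) (f : A → Carrier) →
               sumOver (xs ++ ys) f ≈ sumOver xs f + sumOver ys f
  sumOver-++ []       ys f = sym (+-identityˡ _)
  sumOver-++ (x ∷ xs) ys f = trans (+-congˡ (sumOver-++ xs ys f)) (sym (+-assoc _ _ _))

  sumOver-map : ∀ {a b} {A : Set a} {B : Set b} (xs : List A) (g : A → B) (f : B → Carrier) →
                sumOver (List.map g xs) f ≡ sumOver xs (f ∘ g)
  sumOver-map []       g f = ≡.refl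
  sumOver-map (x ∷ xs) g f = ≡.cong (λ s → f (g x) + s) (sumOver-map xs g f)

  productOver-++ : ∀ {a} {A : Set a} (xs ys : List A) (f : A → Carrier) →
                   productOver (xs ++ ys) f ≈ productOver xs f * productOver ys f
  productOver-++ []       ys f = sym (*-identityˡ _)
  productOver-++ (x ∷ xs) ys f = trans (*-congˡ (productOver-++ xs ys f)) (sym (*-assoc _ _ _))

  productOver-map : ∀ {a b} {A : Set a} {B : Set b} (xs : List A) (g : A → B) (f : B → Carrier) →
                    productOver (List.map g xs) f ≡ productOver xs (f ∘ g)
  productOver-map []       g f = ≡.refl
  productOver-map (x ∷ xs) g f = ≡.cong (λ s → f (g x) * s) (productOver-map xs g f)

  sumOver-tabulate : ∀ {a} {A : Set a} {n} (g : Fin n → A) (f : A → Carrier) →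
                     sumOver (tabulate g) f ≡ sum (f ∘ g)
  sumOver-tabulate {n = zero}  g f = ≡.refl
  sumOver-tabulate {n = suc n} g f = ≡.cong (λ s → f (g zero) + s) (sumOver-tabulate (g ∘ suc) f)

  productOver-tabulate : ∀ {a} {A : Set a} {n} (g : Fin n → A) (f : A → Carrier) →
                         productOver (tabulate g) f ≡ product (f ∘ g)
  productOver-tabulate {n = zero}  g f = ≡.refl
  productOver-tabulate {n = suc n} g f = ≡.cong (λ s → f (g zero) * s) (productOver-tabulate (g ∘ suc) f)

  sumOver-∑ : ∀ {a} {A : Set a} (xs : List A) {n} (f : A → Fin n → Carrier) →
              sumOver xs (λ x → sum (f x)) ≈ sum (λ i → sumOver xs (λ x → f x i))
  sumOver-∑ []       {n} f = sym (∑-zero {n} (λ _ → refl))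
  sumOver-∑ (x ∷ xs) {n} f = trans (+-congˡ (sumOver-∑ xs f)) (sym (∑-distrib-+ {n} _ _))

-- Truncated exponentials and the product bound with 1/e

module Exponential {c ℓ₁ ℓ₂ : Level} (F : OrderedField c ℓ₁ ℓ₂) where
  open FieldProperties F
  open ≤-Reasoning poset
  open Powers semiring using (_^_)

  1/[_!] : ℕ → Carrier
  1/[ k !] = fromℕ (k !) ⁻¹

  exponentialTerm : Carrier → ℕ → Carrier
  exponentialTerm x k = x ^ k * 1/[ k !]

  -- The exponential series cut after `N` terms. At `1#` these are the partial sums that define `e`;
  -- at other arguments no limit has to exist.
  truncatedExp : ℕ → Carrier → Carrier
  truncatedExp N x = sum {N} (λ k → exponentialTerm x (toℕ k))

  fromℕ-1 : fromℕ 1 ≈ 1#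
  fromℕ-1 = +-identityʳ 1#

  1/0!≈1 : 1/[ 0 !] ≈ 1#
  1/0!≈1 = sym (⁻¹-unique (trans (*-identityʳ _) fromℕ-1))

  k!≉0 : ∀ k → ¬ (fromℕ (k !) ≈ 0#)
  k!≉0 k with k ! | ℕₚ.1≤n! k
  ... | suc n | _ = fromℕ-suc≉0 n

  1/[1+k]! : ∀ k → fromℕ (suc k) * 1/[ suc k !] ≈ 1/[ k !]
  1/[1+k]! k = ⁻¹-unique (begin-equality
    fromℕ (k !) * (fromℕ (suc k) * 1/[ suc k !])
      ≈⟨ solve 3 (λ a b c → a :* (b :* c) := (b :* a) :* c) refl _ _ _ ⟩
    fromℕ (suc k) * fromℕ (k !) * 1/[ suc k !]
      ≈⟨ *-congʳ (sym (fromℕ-* (suc k) (k !))) ⟩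
    fromℕ (suc k !) * 1/[ suc k !]
      ≈⟨ ⁻¹-inverseʳ (k!≉0 (suc k)) ⟩
    1# ∎)

  1/k!-nonNeg : ∀ k → 0# ≤ 1/[ k !]
  1/k!-nonNeg k = ⁻¹-nonNeg (fromℕ-nonNeg (k !))

  ^-nonNeg : ∀ {x} k → 0# ≤ x → 0# ≤ x ^ k
  ^-nonNeg zero    0≤x = 0≤1
  ^-nonNeg (suc k) 0≤x = *-nonNegative 0≤x (^-nonNeg k 0≤x)

  1^k≈1 : ∀ k → 1# ^ k ≈ 1#
  1^k≈1 zero    = refl
  1^k≈1 (suc k) = trans (*-identityˡ _) (1^k≈1 k)

  -- By convexity of the power, its slope between `x` and `x + b` is at most the derivative at
  -- `x + b`.
  ^-increment : ∀ {x b} k → 0# ≤ x → 0# ≤ b →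
                (x + b) ^ suc k ≤ x ^ suc k + fromℕ (suc k) * (b * (x + b) ^ k)
  ^-increment {x} {b} zero 0≤x 0≤b = ≤-reflexive
    (solve 2 (λ x b → (x :+ b) :* con (+ 1) :=
                      x :* con (+ 1) :+ (con (+ 1) :+ con (+ 0)) :* (b :* con (+ 1))) refl x b)
  ^-increment {x} {b} (suc k) 0≤x 0≤b = begin
    y * y ^ suc k
      ≈⟨ solve 3 (λ x b Y → (x :+ b) :* Y := x :* Y :+ b :* Y) refl x b (y ^ suc k) ⟩
    x * y ^ suc k + b * y ^ suc k
      ≤⟨ +-monoˡ-≤ _ (*-monoʳ-≤ 0≤x (^-increment k 0≤x 0≤b)) ⟩
    x * (x ^ suc k + K * (b * y ^ k)) + b * y ^ suc k
      ≤⟨ ≤-by (b * (K * (b * y ^ k)))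
           (*-nonNegative 0≤b (*-nonNegative (fromℕ-nonNeg (suc k))
             (*-nonNegative 0≤b (^-nonNeg k (+-nonNeg 0≤x 0≤b)))))
           (solve 5 (λ x b X Y K →
             x :* (X :+ K :* (b :* Y)) :+ b :* ((x :+ b) :* Y) :+ b :* (K :* (b :* Y)) :=
             x :* X :+ (con (+ 1) :+ K) :* (b :* ((x :+ b) :* Y))) refl x b (x ^ suc k) (y ^ k) K) ⟩
    x ^ suc (suc k) + fromℕ (suc (suc k)) * (b * y ^ suc k) ∎
    where
    y = x + b
    K = fromℕ (suc k)

  -- The factor k + 1 of the derivative cancels against (k + 1)!, so the increment of one term is
  -- bounded through the term one degree below.
  exponentialTerm-increment : ∀ {x b} k → 0# ≤ x → 0# ≤ b →
    exponentialTerm (x + b) (suc k) ≤ exponentialTerm x (suc k) + b * exponentialTerm (x + b) k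
  exponentialTerm-increment {x} {b} k 0≤x 0≤b = begin
    (x + b) ^ suc k * 1/[ suc k !]
      ≤⟨ *-monoˡ-≤ (1/k!-nonNeg (suc k)) (^-increment k 0≤x 0≤b) ⟩
    (x ^ suc k + fromℕ (suc k) * (b * (x + b) ^ k)) * 1/[ suc k !]
      ≈⟨ solve 5 (λ X b Y K f → (X :+ K :* (b :* Y)) :* f := X :* f :+ b :* (Y :* (K :* f)))
           refl (x ^ suc k) b ((x + b) ^ k) (fromℕ (suc k)) 1/[ suc k !] ⟩
    x ^ suc k * 1/[ suc k !] + b * ((x + b) ^ k * (fromℕ (suc k) * 1/[ suc k !]))
      ≈⟨ +-congˡ (*-congˡ (*-congˡ (1/[1+k]! k))) ⟩
    exponentialTerm x (suc k) + b * exponentialTerm (x + b) k ∎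

  exponentialTerm-nonNeg : ∀ {x} k → 0# ≤ x → 0# ≤ exponentialTerm x k
  exponentialTerm-nonNeg k 0≤x = *-nonNegative (^-nonNeg k 0≤x) (1/k!-nonNeg k)

  ∑-extend : ∀ (f : ℕ → Carrier) → (∀ k → 0# ≤ f k) → ∀ N →
             sum {N} (f ∘ toℕ) ≤ sum {suc N} (f ∘ toℕ)
  ∑-extend f 0≤f zero    = ≤-by (f 0 + 0#) (+-nonNeg (0≤f 0) ≤-refl) (+-identityˡ _)
  ∑-extend f 0≤f (suc N) = +-monoʳ-≤ (f 0) (∑-extend (f ∘ suc) (0≤f ∘ suc) N)

  -- The derivative of a truncation is the truncation with one term fewer. Restoring the missing
  -- term only enlarges the bound on the increment, because terms are nonnegative; so the inequality
  -- is exact at every finite order.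
  truncatedExp-increment : ∀ {x b} N → 0# ≤ x → 0# ≤ b →
    (1# - b) * truncatedExp (suc N) (x + b) ≤ truncatedExp (suc N) x
  truncatedExp-increment {x} {b} N 0≤x 0≤b = begin
    (1# - b) * E′
      ≈⟨ solve 2 (λ b E′ → (con (+ 1) :- b) :* E′ := E′ :- b :* E′) refl b E′ ⟩
    E′ - b * E′
      ≤⟨ -‿mono-≤ (+-monoʳ-≤ _ (∑-mono {N} (λ k → exponentialTerm-increment (toℕ k) 0≤x 0≤b)))
                  (*-monoʳ-≤ 0≤b (∑-extend (exponentialTerm (x + b)) (λ k → exponentialTerm-nonNeg k 0≤y) N)) ⟩
    exponentialTerm x 0 + sum {N} (λ k → exponentialTerm x (suc (toℕ k)) + b * exponentialTerm (x + b) (toℕ k))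
      - b * truncatedExp N (x + b)
      ≈⟨ +-congʳ (+-congˡ (trans (∑-distrib-+ {N} _ _) (+-congˡ (sym (*-distribˡ-sum {N} b _))))) ⟩
    exponentialTerm x 0 + (sum {N} (λ k → exponentialTerm x (suc (toℕ k))) + b * truncatedExp N (x + b))
      - b * truncatedExp N (x + b)
      ≈⟨ solve 3 (λ a s t → a :+ (s :+ t) :- t := a :+ s) refl _ _ _ ⟩
    truncatedExp (suc N) x ∎
    where
    E′ = truncatedExp (suc N) (x + b)
    0≤y = +-nonNeg 0≤x 0≤b

  truncatedExp-cong : ∀ N {x y} → x ≈ y → truncatedExp N x ≈ truncatedExp N y
  truncatedExp-cong N x≈y = ∑-cong {N} (λ k → *-congʳ (Powers.^-congˡ semiring (toℕ k) x≈y))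

  truncatedExp-1 : ∀ N → truncatedExp N 1# ≈ sum {N} (λ k → 1/[ toℕ k !])
  truncatedExp-1 N = ∑-cong {N} (λ k → trans (*-congʳ (1^k≈1 (toℕ k))) (*-identityˡ _))

  truncatedExp-0 : ∀ N → truncatedExp (suc N) 0# ≈ 1#
  truncatedExp-0 N = begin-equality
    1# * 1/[ 0 !] + sum {N} (λ k → 0# * 0# ^ toℕ k * 1/[ suc (toℕ k) !])
      ≈⟨ +-cong (trans (*-identityˡ _) 1/0!≈1)
                (∑-zero {N} (λ k → trans (*-congʳ (zeroˡ _)) (zeroˡ _))) ⟩
    1# + 0#  ≈⟨ +-identityʳ 1# ⟩
    1#       ∎

  module _ {a : Level} {A : Set a} where

    sumOver-nonNeg : (xs : List A) {v : A → Carrier} → (∀ x → 0# ≤ v x) → 0# ≤ sumOver xs v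
    sumOver-nonNeg []       0≤v = ≤-refl
    sumOver-nonNeg (x ∷ xs) 0≤v = +-nonNeg (0≤v x) (sumOver-nonNeg xs 0≤v)

    module _ {x : A} (xs : List A) {v : A → Carrier}
             (0≤v : ∀ x → 0# ≤ v x) (∑≤1 : sumOver (x ∷ xs) v ≤ 1#) where

      head≤1 : v x ≤ 1#
      head≤1 = ≤-trans (≤-by _ (sumOver-nonNeg xs 0≤v) refl) ∑≤1

      tail≤1 : sumOver xs v ≤ 1#
      tail≤1 = ≤-trans (≤-by _ (0≤v x) (+-comm _ _)) ∑≤1

    module _ {v : A → Carrier} (0≤v : ∀ x → 0# ≤ v x) where

      ∏[1-v]-nonNeg : ∀ xs → sumOver xs v ≤ 1# → 0# ≤ productOver xs (λ x → 1# - v x)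
      ∏[1-v]-nonNeg []       _   = 0≤1
      ∏[1-v]-nonNeg (x ∷ xs) ∑≤1 = *-nonNegative (x≤y⇒0≤y-x (head≤1 xs 0≤v ∑≤1))
                                                 (∏[1-v]-nonNeg xs (tail≤1 xs 0≤v ∑≤1))

      ∏[1-v]≤1 : ∀ xs → sumOver xs v ≤ 1# → productOver xs (λ x → 1# - v x) ≤ 1#
      ∏[1-v]≤1 []       _   = ≤-refl
      ∏[1-v]≤1 (x ∷ xs) ∑≤1 = ≤-trans
        (≤-by (v x * P) (*-nonNegative (0≤v x) (∏[1-v]-nonNeg xs (tail≤1 xs 0≤v ∑≤1)))
          (solve 2 (λ v P → (con (+ 1) :- v) :* P :+ v :* P := P) refl (v x) P))
        (∏[1-v]≤1 xs (tail≤1 xs 0≤v ∑≤1))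
        where P = productOver xs (λ x → 1# - v x)

      -- Each factor `1# - v x` is absorbed by lowering the argument of the exponential by `v x`,
      -- until the argument is 0 and the exponential is 1.
      ∏[1-v]*exp≤1 : ∀ N xs → sumOver xs v ≤ 1# →
        productOver xs (λ x → 1# - v x) * truncatedExp (suc N) (sumOver xs v) ≤ 1#
      ∏[1-v]*exp≤1 N []       _   = ≤-reflexive (trans (*-identityˡ _) (truncatedExp-0 N))
      ∏[1-v]*exp≤1 N (x ∷ xs) ∑≤1 = begin
        (1# - v x) * P * truncatedExp (suc N) (v x + s)
          ≈⟨ *-congˡ (truncatedExp-cong (suc N) (+-comm (v x) s)) ⟩
        (1# - v x) * P * truncatedExp (suc N) (s + v x)
          ≈⟨ solve 3 (λ a b c → a :* b :* c := b :* (a :* c)) refl _ _ _ ⟩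
        P * ((1# - v x) * truncatedExp (suc N) (s + v x))
          ≤⟨ *-monoʳ-≤ (∏[1-v]-nonNeg xs ∑≤1′) (truncatedExp-increment N (sumOver-nonNeg xs 0≤v) (0≤v x)) ⟩
        P * truncatedExp (suc N) s
          ≤⟨ ∏[1-v]*exp≤1 N xs ∑≤1′ ⟩
        1# ∎
        where
        P = productOver xs (λ x → 1# - v x)
        s = sumOver xs v
        ∑≤1′ = tail≤1 xs 0≤v ∑≤1

      -- The left-hand side is a convex function of q.
      ∏[1-q*v]-convex : ∀ {q} → 0# ≤ q → q ≤ 1# → ∀ xs → sumOver xs v ≤ 1# →
        productOver xs (λ x → 1# - q * v x) ≤ (1# - q) + q * productOver xs (λ x → 1# - v x)
      ∏[1-q*v]-convex {q} 0≤q q≤1 [] _ = ≤-reflexive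
        (solve 1 (λ q → con (+ 1) := (con (+ 1) :- q) :+ q :* con (+ 1)) refl q)
      ∏[1-q*v]-convex {q} 0≤q q≤1 (x ∷ xs) ∑≤1 = begin
        (1# - q * v x) * productOver xs (λ x → 1# - q * v x)
          ≤⟨ *-monoʳ-≤ (x≤y⇒0≤y-x qv≤1) (∏[1-q*v]-convex 0≤q q≤1 xs ∑≤1′) ⟩
        (1# - q * v x) * ((1# - q) + q * P)
          ≤⟨ ≤-by (q * (v x * ((1# - q) * (1# - P))))
               (*-nonNegative 0≤q (*-nonNegative (0≤v x) (*-nonNegative (x≤y⇒0≤y-x q≤1)
                 (x≤y⇒0≤y-x (∏[1-v]≤1 xs ∑≤1′)))))
               (solve 3 (λ q v P →
                 (con (+ 1) :- q :* v) :* ((con (+ 1) :- q) :+ q :* P)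
                   :+ q :* (v :* ((con (+ 1) :- q) :* (con (+ 1) :- P))) :=
                 (con (+ 1) :- q) :+ q :* ((con (+ 1) :- v) :* P)) refl q (v x) P) ⟩
        (1# - q) + q * ((1# - v x) * P) ∎
        where
        P = productOver xs (λ x → 1# - v x)
        ∑≤1′ = tail≤1 xs 0≤v ∑≤1
        qv≤1 : q * v x ≤ 1#
        qv≤1 = begin
          q * v x  ≤⟨ *-monoʳ-≤ 0≤q (head≤1 xs 0≤v ∑≤1) ⟩
          q * 1#   ≈⟨ *-identityʳ q ⟩
          q        ≤⟨ q≤1 ⟩
          1#       ∎

  ½-inverse : fromℕ 2 * ½ ≈ 1#
  ½-inverse = ⁻¹-inverseʳ (fromℕ-suc≉0 1)

  x≈½x+½x : ∀ x → x ≈ x * ½ + x * ½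
  x≈½x+½x x = begin-equality
    x                    ≈⟨ sym (*-identityʳ x) ⟩
    x * 1#               ≈⟨ *-congˡ (sym ½-inverse) ⟩
    x * (fromℕ 2 * ½)    ≈⟨ solve 2 (λ x h → x :* ((con (+ 1) :+ (con (+ 1) :+ con (+ 0))) :* h) := x :* h :+ x :* h) refl x ½ ⟩
    x * ½ + x * ½        ∎

  ½-nonNeg : 0# ≤ ½
  ½-nonNeg = ⁻¹-nonNeg (fromℕ-nonNeg 2)

  -- Half of the gap `x - y` is itself an admissible `ε`, so no Archimedean property is involved.
  ≤-approx : ∀ {x y} → (∀ ε → 0# < ε → x ≤ y + ε) → x ≤ y
  ≤-approx {x} {y} x≤y+ε with x ≤? y
  ... | yes x≤y = x≤y
  ... | no  x≰y = contradiction x≤y x≰y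
    where
    ε = (x - y) * ½
    0≤ε : 0# ≤ ε
    0≤ε = *-nonNegative (x≤y⇒0≤y-x (≰⇒≥ x≰y)) ½-nonNeg
    0≉ε : ¬ (0# ≈ ε)
    0≉ε 0≈ε = x≰y (0≤y-x⇒x≤y (≥-reflexive (begin-equality
      y - x      ≈⟨ solve 2 (λ x y → y :- x := :- (x :- y)) refl x y ⟩
      - (x - y)  ≈⟨ -‿cong (trans (x≈½x+½x (x - y)) (+-cong (sym 0≈ε) (sym 0≈ε))) ⟩
      - (0# + 0#) ≈⟨ solve 0 (:- (con (+ 0) :+ con (+ 0)) := con (+ 0)) refl ⟩
      0# ∎)))
    x≤y : x ≤ y
    -- The hypothesis is applied twice, since two copies of `ε` make up `x - y`; what is added on
    -- both sides cancels at the end.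
    x≤y = +-cancelʳ-≤ (ε + (x - y)) (begin
      x + (ε + (x - y))        ≤⟨ +-monoˡ-≤ _ (x≤y+ε ε (0≤ε , 0≉ε)) ⟩
      y + ε + (ε + (x - y))    ≈⟨ solve 3 (λ x y e → y :+ e :+ (e :+ (x :- y)) := x :+ (e :+ e)) refl x y ε ⟩
      x + (ε + ε)              ≈⟨ +-congˡ (sym (x≈½x+½x (x - y))) ⟩
      x + (x - y)              ≤⟨ +-monoˡ-≤ _ (x≤y+ε ε (0≤ε , 0≉ε)) ⟩
      y + ε + (x - y)          ≈⟨ +-assoc y ε (x - y) ⟩
      y + (ε + (x - y))        ∎)

  module _ {a : ℕ → Carrier} {l : Carrier} (a⟶l : a ⟶ l) where

    -- The offset `N` leaves out the first partial sums, for which the bound may fail: below two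
    -- terms, the series of `e` has not reached 2.
    ≤-limit : ∀ {x} N → (∀ n → x ≤ a (n ℕ.+ N)) → x ≤ l
    ≤-limit {x} N x≤a = ≤-approx λ ε 0<ε → let M , close = a⟶l ε 0<ε in begin
      x                                ≤⟨ x≤a M ⟩
      a (M ℕ.+ N)                      ≈⟨ solve 2 (λ a l → a := l :+ (a :- l)) refl _ l ⟩
      l + (a (M ℕ.+ N) - l)            ≤⟨ +-monoʳ-≤ l (≤-trans (x≤max _ _) (close _ (ℕₚ.m≤m+n M N))) ⟩
      l + ε                            ∎

    -- The approximation error is multiplied by `x`, and `x ≤ 1#` keeps it below `ε`.
    limit-≤ : ∀ {x y} N → 0# ≤ x → x ≤ 1# → (∀ n → x * a (n ℕ.+ N) ≤ y) → x * l ≤ y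
    limit-≤ {x} {y} N 0≤x x≤1 xa≤y = ≤-approx λ ε 0<ε → let M , close = a⟶l ε 0<ε in begin
      x * l
        ≈⟨ solve 3 (λ x a l → x :* l := x :* a :+ x :* (:- (a :- l))) refl x (a (M ℕ.+ N)) l ⟩
      x * a (M ℕ.+ N) + x * (- (a (M ℕ.+ N) - l))
        ≤⟨ +-mono-≤ (xa≤y M) (*-monoʳ-≤ 0≤x (≤-trans (y≤max _ _) (close _ (ℕₚ.m≤m+n M N)))) ⟩
      y + x * ε
        ≤⟨ +-monoʳ-≤ y (*-monoˡ-≤ (proj₁ 0<ε) x≤1) ⟩
      y + 1# * ε
        ≈⟨ +-congˡ (*-identityˡ ε) ⟩
      y + ε ∎

  module _ {e : Carrier} (e-Euler : IsEuler e) where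

    -- The terms for k = 0 and k = 1 already give 2. This makes `e` invertible and yields
    -- `e ⁻¹ ≤ ½`, hence a nonnegative guarantee.
    2≤e : fromℕ 2 ≤ e
    2≤e = ≤-limit e-Euler 2 2≤partial
      where
      2≤partial : ∀ n → fromℕ 2 ≤ sum {n ℕ.+ 2} (λ k → 1/[ toℕ k !])
      2≤partial n rewrite ℕₚ.+-comm n 2 = begin
        1# + (1# + 0#)
          ≤⟨ +-mono-≤ (≥-reflexive 1/0!≈1) (+-mono-≤ (≥-reflexive 1/0!≈1) (∑-nonNeg {n} (λ k → 1/k!-nonNeg (suc (suc (toℕ k)))))) ⟩
        sum {suc (suc n)} (λ k → 1/[ toℕ k !]) ∎

    e-nonNeg : 0# ≤ e
    e-nonNeg = ≤-trans (fromℕ-nonNeg 2) 2≤e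

    e≉0 : ¬ (e ≈ 0#)
    e≉0 e≈0 = 1≰0 (≤-trans (1≤fromℕ-suc 1) (≤-trans 2≤e (≤-reflexive e≈0)))

    x≤e⁻¹ : ∀ {x} → x * e ≤ 1# → x ≤ e ⁻¹
    x≤e⁻¹ {x} xe≤1 = begin
      x                ≈⟨ sym (*-identityʳ x) ⟩
      x * 1#           ≈⟨ *-congˡ (sym (⁻¹-inverseʳ e≉0)) ⟩
      x * (e * e ⁻¹)   ≈⟨ sym (*-assoc x e _) ⟩
      x * e * e ⁻¹     ≤⟨ *-monoˡ-≤ (⁻¹-nonNeg e-nonNeg) xe≤1 ⟩
      1# * e ⁻¹        ≈⟨ *-identityˡ _ ⟩
      e ⁻¹             ∎

    e⁻¹≤½ : e ⁻¹ ≤ ½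
    e⁻¹≤½ = begin
      e ⁻¹                        ≈⟨ sym (*-identityˡ _) ⟩
      1# * e ⁻¹                   ≈⟨ *-congʳ (sym ½-inverse) ⟩
      fromℕ 2 * ½ * e ⁻¹          ≤⟨ *-monoˡ-≤ (⁻¹-nonNeg e-nonNeg) (*-monoˡ-≤ ½-nonNeg 2≤e) ⟩
      e * ½ * e ⁻¹                ≈⟨ solve 3 (λ e h f → e :* h :* f := h :* (e :* f)) refl e ½ (e ⁻¹) ⟩
      ½ * (e * e ⁻¹)              ≈⟨ *-congˡ (⁻¹-inverseʳ e≉0) ⟩
      ½ * 1#                      ≈⟨ *-identityʳ ½ ⟩
      ½                           ∎

    module _ {a : Level} {A : Set a} where

      -- At total weight 1 the truncated exponentials of `∏[1-v]*exp≤1` are the partial sums tending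
      -- to `e`, so the bound passes to the limit.
      ∏[1-v]≤e⁻¹ : {v : A → Carrier} → (∀ x → 0# ≤ v x) → ∀ xs → sumOver xs v ≈ 1# → productOver xs (λ x → 1# - v x) ≤ e ⁻¹
      ∏[1-v]≤e⁻¹ {v} 0≤v xs ∑≈1 = x≤e⁻¹ (limit-≤ e-Euler 1 (∏[1-v]-nonNeg 0≤v xs ∑≤1) (∏[1-v]≤1 0≤v xs ∑≤1) bound)
        where
        ∑≤1 = ≤-reflexive ∑≈1
        bound : ∀ n → productOver xs (λ x → 1# - v x) * sum {n ℕ.+ 1} (λ k → 1/[ toℕ k !]) ≤ 1#
        bound n rewrite ℕₚ.+-comm n 1 = begin
          productOver xs (λ x → 1# - v x) * sum {suc n} (λ k → 1/[ toℕ k !])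
            ≈⟨ *-congˡ (trans (sym (truncatedExp-1 (suc n))) (truncatedExp-cong (suc n) (sym ∑≈1))) ⟩
          productOver xs (λ x → 1# - v x) * truncatedExp (suc n) (sumOver xs v)
            ≤⟨ ∏[1-v]*exp≤1 0≤v n xs ∑≤1 ⟩
          1# ∎

      -- Rescale v to total weight 1 and use convexity in the scale.
      ∏[1-v]≤1-[1-e⁻¹]∑v : {v : A → Carrier} → (∀ x → 0# ≤ v x) → ∀ xs → sumOver xs v ≤ 1# →
        productOver xs (λ x → 1# - v x) ≤ 1# - (1# - e ⁻¹) * sumOver xs v
      ∏[1-v]≤1-[1-e⁻¹]∑v {v} 0≤v xs ∑≤1 with sumOver xs v ≈? 0#
      ... | yes ∑≈0 = ≤-trans (∏[1-v]≤1 0≤v xs ∑≤1) (≥-reflexive (begin-equality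
        1# - (1# - e ⁻¹) * sumOver xs v  ≈⟨ +-congˡ (-‿cong (*-congˡ ∑≈0)) ⟩
        1# - (1# - e ⁻¹) * 0#            ≈⟨ solve 1 (λ f → con (+ 1) :- (con (+ 1) :- f) :* con (+ 0) := con (+ 1)) refl (e ⁻¹) ⟩
        1#                               ∎))
      ... | no ∑≉0 = begin
        productOver xs (λ x → 1# - v x)
          ≈⟨ productOver-cong xs (λ x → +-congˡ (-‿cong (sym (s*w≈v x)))) ⟩
        productOver xs (λ x → 1# - s * w x)
          ≤⟨ ∏[1-q*v]-convex 0≤w (sumOver-nonNeg xs 0≤v) ∑≤1 xs (≤-reflexive ∑w≈1) ⟩
        (1# - s) + s * productOver xs (λ x → 1# - w x)
          ≤⟨ +-monoʳ-≤ _ (*-monoʳ-≤ (sumOver-nonNeg xs 0≤v) (∏[1-v]≤e⁻¹ 0≤w xs ∑w≈1)) ⟩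
        (1# - s) + s * e ⁻¹
          ≈⟨ solve 2 (λ s f → (con (+ 1) :- s) :+ s :* f := con (+ 1) :- (con (+ 1) :- f) :* s) refl s (e ⁻¹) ⟩
        1# - (1# - e ⁻¹) * s ∎
        where
        s = sumOver xs v
        w : A → Carrier
        w x = v x ÷ s
        0≤w : ∀ x → 0# ≤ w x
        0≤w x = *-nonNegative (0≤v x) (⁻¹-nonNeg (sumOver-nonNeg xs 0≤v))
        s*w≈v : ∀ x → s * w x ≈ v x
        s*w≈v x = begin-equality
          s * (v x * s ⁻¹)  ≈⟨ solve 3 (λ s v i → s :* (v :* i) := v :* (s :* i)) refl s (v x) (s ⁻¹) ⟩
          v x * (s * s ⁻¹)  ≈⟨ *-congˡ (⁻¹-inverseʳ ∑≉0) ⟩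
          v x * 1#          ≈⟨ *-identityʳ _ ⟩
          v x               ∎
        sumOver-÷ : ∀ ys → sumOver ys w ≈ sumOver ys v * s ⁻¹
        sumOver-÷ []       = sym (zeroˡ _)
        sumOver-÷ (y ∷ ys) = trans (+-congˡ (sumOver-÷ ys)) (sym (distribʳ _ _ _))
        ∑w≈1 : sumOver xs w ≈ 1#
        ∑w≈1 = trans (sumOver-÷ xs) (⁻¹-inverseʳ ∑≉0)

-- The dynamic program of one customer and the factor 1/2

module FractionalMatching {c ℓ₁ ℓ₂ : Level} (F : OrderedField c ℓ₁ ℓ₂)
  (M : AdCell.Market F) (x : AdCell.FractionalAllocation F M) (x-feasible : AdCell.LPFeasible F M x) where

  open FieldProperties F
  open Exponential F
  open AdCell F
  open Market M
  open LPFeasible x-feasible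
  open ≤-Reasoning poset

  blockSum : Fin s → Fin u → (Fin m → Fin n → Carrier) → Carrier
  blockSum k t f = sumWhen (inBlock k t) (λ j → sum (λ i → f i j))

  -- The probability that the block produces an offer, that is, a query arrives and draws an
  -- advertiser.
  mass : Fin s → Fin u → Carrier
  mass k t = blockSum k t x

  mass-nonNeg : ∀ k t → 0# ≤ mass k t
  mass-nonNeg k t = sumWhen-nonNeg (inBlock k t) (λ j → ∑-nonNeg (λ i → lower i j))

  mass≤1 : ∀ k t → mass k t ≤ 1#
  mass≤1 k t = ≤-trans (sumWhen-mono (inBlock k t) (λ j _ → perQuery j)) (blockProb≤1 k t)

  module _ (k : Fin s) (t : Fin u) where

    blockSum-cong : ∀ {f g} → (∀ i j → f i j ≈ g i j) → blockSum k t f ≈ blockSum k t g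
    blockSum-cong f≈g = sumWhen-cong (inBlock k t) (λ j _ → ∑-cong (λ i → f≈g i j))

    blockSum-mono : ∀ {f g} → (∀ i j → f i j ≤ g i j) → blockSum k t f ≤ blockSum k t g
    blockSum-mono f≤g = sumWhen-mono (inBlock k t) (λ j _ → ∑-mono (λ i → f≤g i j))

    blockSum-+ : ∀ f g → blockSum k t (λ i j → f i j + g i j) ≈ blockSum k t f + blockSum k t g
    blockSum-+ f g = trans (sumWhen-cong (inBlock k t) (λ j _ → ∑-distrib-+ {m} _ _))
                           (sumWhen-+ (inBlock k t) _ _)

    *-blockSum : ∀ a f → a * blockSum k t f ≈ blockSum k t (λ i j → a * f i j)
    *-blockSum a f = trans (*-sumWhen (inBlock k t) a _)
                           (sumWhen-cong (inBlock k t) (λ j _ → *-distribˡ-sum {m} a _))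

  sumOver-slots : ∀ k (f : Fin n → Carrier) →
                  sumOver (allFin u) (λ t → sumWhen (inBlock k t) f) ≈ sumWhen (inCustomer k) f
  sumOver-slots k f = trans (sumOver-∑ (allFin u) {n} _) (∑-cong λ j → begin-equality
    sumOver (allFin u) (λ t → if inBlock k t j then f j else 0#)
      ≡⟨ sumOver-tabulate {n = u} id _ ⟩
    sum (λ t → if inBlock k t j then f j else 0#)
      ≈⟨ ∑-single (slot j) (off j) ⟩
    (if inBlock k (slot j) j then f j else 0#)
      ≡⟨ ≡.cong (if_then f j else 0#) (on j) ⟩
    (if inCustomer k j then f j else 0#) ∎)
    where
    off : ∀ j t → t ≢ slot j → (if inBlock k t j then f j else 0#) ≈ 0#
    off j t t≢ with inCustomer k j | slot j ≟ᶠ t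
    ... | false | _      = refl
    ... | true  | no _   = refl
    ... | true  | yes eq = contradiction (≡.sym eq) t≢
    on : ∀ j → inBlock k (slot j) j ≡ inCustomer k j
    on j with inCustomer k j | slot j ≟ᶠ slot j
    ... | false | _      = ≡.refl
    ... | true  | yes _  = ≡.refl
    ... | true  | no neq = contradiction ≡.refl neq

  module _ (k : Fin s) where

    E : List (Fin u) → ℕ → Carrier
    E = AlgorithmC.E M x k

    -- The expected profit of the block when a unit of capacity costs `d` and only bids above the
    -- price are served.
    surplus : Fin u → Carrier → Carrier
    surplus t d = blockSum k t (λ i j → x i j * max (bid i j - d) 0#)

    value : Fin u → Carrier
    value t = blockSum k t (λ i j → x i j * bid i j)

    -- The expected gain of the unit of capacity number r + 1.
    marginal : List (Fin u) → ℕ → Carrier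
    marginal ts r = E ts (suc r) - E ts r

    E-zero : ∀ ts → E ts 0 ≡ 0#
    E-zero []       = ≡.refl
    E-zero (t ∷ ts) = ≡.refl

    max-shift : ∀ v a b → max (v + a) b ≈ b + max (v - (b - a)) 0#
    max-shift v a b = ≤-antisym
      (max-lub (≤-trans (≥-reflexive (solve 3 (λ v a b → b :+ (v :- (b :- a)) := v :+ a) refl v a b))
                        (+-monoʳ-≤ b (x≤max _ _)))
               (≤-trans (≥-reflexive (+-identityʳ b)) (+-monoʳ-≤ b (y≤max _ _))))
      (begin
        b + max (v - (b - a)) 0#
          ≤⟨ +-monoʳ-≤ b (max-lub
               (≤-trans (≤-reflexive (solve 3 (λ v a b → v :- (b :- a) := (v :+ a) :- b) refl v a b))
                        (+-monoˡ-≤ (- b) (x≤max _ _)))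
               (x≤y⇒0≤y-x (y≤max _ _))) ⟩
        b + (max (v + a) b - b)
          ≈⟨ solve 2 (λ b w → b :+ (w :- b) := w) refl b _ ⟩
        max (v + a) b ∎)

    -- Serving a query gives up the marginal value of one unit, so the `max` of the recursion is the
    -- old value plus the positive part of the bid minus that price. Together with `E-zero`, this
    -- form is all that the concavity argument uses of the recursion.
    E-step : ∀ t ts r → E (t ∷ ts) (suc r) ≈ E ts (suc r) + surplus t (marginal ts r)
    E-step t ts r = begin-equality
      blockSum k t (λ i j → x i j * max (bid i j + a) b) + (1# - mass k t) * b
        ≈⟨ +-congʳ (blockSum-cong k t λ i j →
             trans (*-congˡ (max-shift _ _ _))
                   (trans (distribˡ _ _ _) (+-congʳ (*-comm _ _)))) ⟩
      blockSum k t (λ i j → b * x i j + x i j * max (bid i j - (b - a)) 0#) + (1# - mass k t) * b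
        ≈⟨ +-congʳ (trans (blockSum-+ k t _ _) (+-congʳ (sym (*-blockSum k t b x)))) ⟩
      b * mass k t + surplus t (b - a) + (1# - mass k t) * b
        ≈⟨ solve 3 (λ b q s → b :* q :+ s :+ (con (+ 1) :- q) :* b := b :+ s) refl b (mass k t) _ ⟩
      b + surplus t (b - a) ∎
      where
      a = E ts r
      b = E ts (suc r)

    surplus-antitone : ∀ t {d d′} → d ≤ d′ → surplus t d′ ≤ surplus t d
    surplus-antitone t d≤d′ = blockSum-mono k t λ i j →
      *-monoʳ-≤ (lower i j) (max-mono (-‿mono-≤ ≤-refl d≤d′) ≤-refl)

    surplus-nonNeg : ∀ t d → 0# ≤ surplus t d
    surplus-nonNeg t d = sumWhen-nonNeg (inBlock k t) λ j → ∑-nonNeg λ i →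
      *-nonNegative (lower i j) (y≤max _ _)

    -- Lagrangian relaxation at price `d`: a bid is at most `d` plus its positive excess over `d`.
    value≤surplus+d*mass : ∀ t d → value t ≤ surplus t d + d * mass k t
    value≤surplus+d*mass t d = begin
      value t
        ≤⟨ blockSum-mono k t (λ i j → begin
             x i j * bid i j
               ≈⟨ solve 3 (λ x u d → x :* u := x :* (u :- d) :+ d :* x) refl _ _ d ⟩
             x i j * (bid i j - d) + d * x i j
               ≤⟨ +-monoˡ-≤ _ (*-monoʳ-≤ (lower i j) (x≤max _ _)) ⟩
             x i j * max (bid i j - d) 0# + d * x i j ∎) ⟩
      blockSum k t (λ i j → x i j * max (bid i j - d) 0# + d * x i j)
        ≈⟨ trans (blockSum-+ k t _ _) (+-congˡ (sym (*-blockSum k t d x))) ⟩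
      surplus t d + d * mass k t ∎

    -- When the price rises, the surplus falls at a rate of at most the probability of an offer.
    -- Exclusivity within the block enters through `mass≤1`.
    d+surplus-monotone : ∀ t {d d′} → d ≤ d′ → d + surplus t d ≤ d′ + surplus t d′
    d+surplus-monotone t {d} {d′} d≤d′ = begin
      d + surplus t d
        ≤⟨ +-monoʳ-≤ d (blockSum-mono k t λ i j → begin
             x i j * max (bid i j - d) 0#
               ≤⟨ *-monoʳ-≤ (lower i j) (max-lub
                    (≤-trans (≤-reflexive (solve 3 (λ u d d′ → u :- d := (d′ :- d) :+ (u :- d′)) refl _ d d′))
                             (+-monoʳ-≤ _ (x≤max _ _)))
                    (+-nonNeg 0≤d′-d (y≤max _ _))) ⟩
             x i j * ((d′ - d) + max (bid i j - d′) 0#)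
               ≈⟨ trans (distribˡ _ _ _) (+-congʳ (*-comm _ _)) ⟩
             (d′ - d) * x i j + x i j * max (bid i j - d′) 0# ∎) ⟩
      d + blockSum k t (λ i j → (d′ - d) * x i j + x i j * max (bid i j - d′) 0#)
        ≈⟨ +-congˡ (trans (blockSum-+ k t _ _) (+-congʳ (sym (*-blockSum k t (d′ - d) x)))) ⟩
      d + ((d′ - d) * mass k t + surplus t d′)
        ≤⟨ +-monoʳ-≤ d (+-monoˡ-≤ _ (*-monoʳ-≤ 0≤d′-d (mass≤1 k t))) ⟩
      d + ((d′ - d) * 1# + surplus t d′)
        ≈⟨ solve 3 (λ d d′ s → d :+ ((d′ :- d) :* con (+ 1) :+ s) := d′ :+ s) refl d d′ _ ⟩
      d′ + surplus t d′ ∎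
      where
      0≤d′-d = x≤y⇒0≤y-x d≤d′

    Concave : List (Fin u) → Set ℓ₂
    Concave ts = ∀ r → marginal ts (suc r) ≤ marginal ts r

    -- By concavity the next unit has the lower price and so collects the larger surplus from the
    -- new slot; at zero capacity nothing is collected. Concavity is an argument because the two
    -- facts are proved in one induction on the slots.
    marginal-grows : ∀ t ts → Concave ts → ∀ r → marginal ts r ≤ marginal (t ∷ ts) r
    marginal-grows t ts _ zero = ≤-by (surplus t (marginal ts 0)) (surplus-nonNeg t _) (begin-equality
      E ts 1 - E ts 0 + surplus t (marginal ts 0)
        ≡⟨ ≡.cong (λ e → E ts 1 - e + surplus t (marginal ts 0)) (E-zero ts) ⟩
      E ts 1 - 0# + surplus t (marginal ts 0)
        ≈⟨ solve 2 (λ e s → e :- con (+ 0) :+ s := e :+ s :- con (+ 0)) refl _ _ ⟩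
      E ts 1 + surplus t (marginal ts 0) - 0#
        ≈⟨ +-congʳ (sym (E-step t ts 0)) ⟩
      E (t ∷ ts) 1 - 0# ∎)
    marginal-grows t ts concave (suc r) = begin
      E ts (suc (suc r)) - E ts (suc r)
        ≤⟨ ≤-by (surplus t (marginal ts (suc r)) - surplus t (marginal ts r))
             (x≤y⇒0≤y-x (surplus-antitone t (concave r)))
             (solve 4 (λ a b p q → a :- b :+ (p :- q) := (a :+ p) :- (b :+ q)) refl _ _ _ _) ⟩
      (E ts (suc (suc r)) + surplus t (marginal ts (suc r))) - (E ts (suc r) + surplus t (marginal ts r))
        ≈⟨ +-cong (sym (E-step t ts (suc r))) (-‿cong (sym (E-step t ts r))) ⟩
      E (t ∷ ts) (suc (suc r)) - E (t ∷ ts) (suc r) ∎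

    -- The old marginal at `r` separates the two new ones: monotonicity of price plus surplus puts
    -- it above the new marginal at `suc r`, and `marginal-grows` puts it below the new marginal at
    -- `r`.
    E-concave : ∀ ts → Concave ts
    E-concave []       r = ≤-refl
    E-concave (t ∷ ts) r = begin
      E (t ∷ ts) (suc (suc r)) - E (t ∷ ts) (suc r)
        ≈⟨ +-cong (E-step t ts (suc r)) (-‿cong (E-step t ts r)) ⟩
      (E ts (suc (suc r)) + surplus t (marginal ts (suc r))) - (E ts (suc r) + surplus t (marginal ts r))
        ≈⟨ solve 4 (λ a b p q → (a :+ p) :- (b :+ q) := (a :- b) :+ p :- q) refl _ _ _ _ ⟩
      marginal ts (suc r) + surplus t (marginal ts (suc r)) - surplus t (marginal ts r)
        ≤⟨ +-monoˡ-≤ _ (d+surplus-monotone t (E-concave ts r)) ⟩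
      marginal ts r + surplus t (marginal ts r) - surplus t (marginal ts r)
        ≈⟨ solve 2 (λ a s → a :+ s :- s := a) refl _ _ ⟩
      marginal ts r
        ≤⟨ marginal-grows t ts (E-concave ts) r ⟩
      marginal (t ∷ ts) r ∎

    marginal-nonNeg : ∀ ts r → 0# ≤ marginal ts r
    marginal-nonNeg []       r = ≥-reflexive (-‿inverseʳ 0#)
    marginal-nonNeg (t ∷ ts) r = ≤-trans (marginal-nonNeg ts r) (marginal-grows t ts (E-concave ts) r)

    -- The last unit of capacity is the least valuable, so it earns at most the average.
    marginal-average : ∀ ts r → fromℕ (suc r) * marginal ts r ≤ E ts (suc r)
    marginal-average ts zero = ≤-reflexive (begin-equality
      fromℕ 1 * (E ts 1 - E ts 0)  ≡⟨ ≡.cong (λ e → fromℕ 1 * (E ts 1 - e)) (E-zero ts) ⟩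
      fromℕ 1 * (E ts 1 - 0#)      ≈⟨ solve 1 (λ e → (con (+ 1) :+ con (+ 0)) :* (e :- con (+ 0)) := e) refl _ ⟩
      E ts 1                       ∎)
    marginal-average ts (suc r) = begin
      (1# + fromℕ (suc r)) * marginal ts (suc r)
        ≈⟨ trans (distribʳ _ _ _) (+-congʳ (*-identityˡ _)) ⟩
      marginal ts (suc r) + fromℕ (suc r) * marginal ts (suc r)
        ≤⟨ +-monoʳ-≤ _ (≤-trans (*-monoʳ-≤ (fromℕ-nonNeg (suc r)) (E-concave ts r)) (marginal-average ts r)) ⟩
      marginal ts (suc r) + E ts (suc r)
        ≈⟨ solve 2 (λ a b → a :- b :+ b := a) refl _ _ ⟩
      E ts (suc (suc r)) ∎

    -- A single price `d` serves the whole induction: marginals only grow with the number of slots,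
    -- so a price that dominates the marginal of the full list dominates those of all its tails.
    value≤E+d*mass : ∀ ts r {d} → marginal ts r ≤ d →
                     sumOver ts value ≤ E ts (suc r) + d * sumOver ts (mass k)
    value≤E+d*mass []       r {d} _ = ≤-reflexive
      (solve 1 (λ d → con (+ 0) := con (+ 0) :+ d :* con (+ 0)) refl d)
    value≤E+d*mass (t ∷ ts) r {d} ≤d = begin
      value t + sumOver ts value
        ≤⟨ +-mono-≤ (value≤surplus+d*mass t (marginal ts r)) (value≤E+d*mass ts r d′≤d) ⟩
      surplus t (marginal ts r) + marginal ts r * mass k t + (E ts (suc r) + d * sumOver ts (mass k))
        ≤⟨ +-monoˡ-≤ _ (+-monoʳ-≤ _ (*-monoˡ-≤ (mass-nonNeg k t) d′≤d)) ⟩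
      surplus t (marginal ts r) + d * mass k t + (E ts (suc r) + d * sumOver ts (mass k))
        ≈⟨ solve 5 (λ s d q e l → s :+ d :* q :+ (e :+ d :* l) := e :+ s :+ d :* (q :+ l)) refl _ d _ _ _ ⟩
      E ts (suc r) + surplus t (marginal ts r) + d * (mass k t + sumOver ts (mass k))
        ≈⟨ +-congʳ (sym (E-step t ts r)) ⟩
      E (t ∷ ts) (suc r) + d * sumOver (t ∷ ts) (mass k) ∎
      where
      d′≤d = ≤-trans (marginal-grows t ts (E-concave ts) r) ≤d

    customerValue : Carrier
    customerValue = sumWhen (inCustomer k) (λ j → sum (λ i → x i j * bid i j))

    customerValue≤E+E : customerValue ≤ E (allFin u) (capacity k) + E (allFin u) (capacity k)
    customerValue≤E+E with capacity k | perCustomer k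
    -- Without capacity there is no last unit to price, but then the capacity constraint forces
    -- every `x i j` of the customer to vanish.
    ... | zero  | mass≤0 = begin
      customerValue
        ≈⟨ ∑-zero (λ j → trans (if-cong (inCustomer k j) (λ j∈S → ∑-zero (λ i →
             trans (*-congʳ (x≈0 j∈S i)) (zeroˡ _)))) (if-0 (inCustomer k j))) ⟩
      0#
        ≈⟨ sym (+-identityˡ 0#) ⟩
      0# + 0#
        ≡⟨ ≡.sym (≡.cong₂ _+_ (E-zero (allFin u)) (E-zero (allFin u))) ⟩
      E (allFin u) 0 + E (allFin u) 0 ∎
      where
      x≈0 : ∀ {j} → inCustomer k j ≡ true → ∀ i → x i j ≈ 0#
      x≈0 {j} j∈S i = ≤-antisym (begin
        x i j
          ≤⟨ term≤∑ (λ i → lower i j) i ⟩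
        sum (λ i → x i j)
          ≡⟨ ≡.sym (≡.cong (if_then sum (λ i → x i j) else 0#) j∈S) ⟩
        (if inCustomer k j then sum (λ i → x i j) else 0#)
          ≤⟨ term≤∑ (λ j → if-nonNeg (inCustomer k j) (∑-nonNeg (λ i → lower i j))) j ⟩
        sumWhen (inCustomer k) (λ j → sum (λ i → x i j))
          ≤⟨ mass≤0 ⟩
        0# ∎) (lower i j)
    -- The price is the marginal with index `r`, the value of the last of `suc r` units.
    ... | suc r | mass≤c = begin
      customerValue
        ≈⟨ sym (sumOver-slots k _) ⟩
      sumOver (allFin u) value
        ≤⟨ value≤E+d*mass (allFin u) r ≤-refl ⟩
      E (allFin u) (suc r) + marginal (allFin u) r * sumOver (allFin u) (mass k)
        ≤⟨ +-monoʳ-≤ _ (*-monoʳ-≤ (marginal-nonNeg (allFin u) r)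
             (≤-trans (≤-reflexive (sumOver-slots k _)) mass≤c)) ⟩
      E (allFin u) (suc r) + marginal (allFin u) r * fromℕ (suc r)
        ≈⟨ +-congˡ (*-comm _ _) ⟩
      E (allFin u) (suc r) + fromℕ (suc r) * marginal (allFin u) r
        ≤⟨ +-monoʳ-≤ _ (marginal-average (allFin u) r) ⟩
      E (allFin u) (suc r) + E (allFin u) (suc r) ∎

    ½*customerValue≤E : ½ * customerValue ≤ E (allFin u) (capacity k)
    ½*customerValue≤E = begin
      ½ * customerValue                        ≤⟨ *-monoʳ-≤ ½-nonNeg customerValue≤E+E ⟩
      ½ * (V + V)                              ≈⟨ solve 2 (λ h v → h :* (v :+ v) := v :* h :+ v :* h) refl ½ V ⟩
      V * ½ + V * ½                            ≈⟨ sym (x≈½x+½x V) ⟩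
      V                                        ∎
      where
      V = E (allFin u) (capacity k)

-- Pointwise updates and filtered lists

infixl 10 _[_≔_]

_[_≔_] : ∀ {a} {A : Set a} {n} → (Fin n → A) → Fin n → A → Fin n → A
f [ j ≔ a ] = updateAt f j (const a)

updates : ∀ {a} {A : Set a} {n} (f : Fin n → A) j {v} → (f [ j ≔ v ]) j ≡ v
updates f j = Vectorₚ.updateAt-updates j f

minimal : ∀ {a} {A : Set a} {n} (f : Fin n → A) {i j v} → i ≢ j → (f [ j ≔ v ]) i ≡ f i
minimal f {i} {j} i≢j = Vectorₚ.updateAt-minimal i j f i≢j

≔-cong : ∀ {a} {A : Set a} {n} {f g : Fin n → A} j {v} → (∀ i → f i ≡ g i) →
         ∀ i → (f [ j ≔ v ]) i ≡ (g [ j ≔ v ]) i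
≔-cong zero    f≗g zero    = ≡.refl
≔-cong zero    f≗g (suc i) = f≗g (suc i)
≔-cong (suc j) f≗g zero    = f≗g zero
≔-cong (suc j) f≗g (suc i) = ≔-cong j (λ i → f≗g (suc i)) i

∷-cong : ∀ {a} {A : Set a} {n} {x : A} {f g : Fin n → A} → (∀ i → f i ≡ g i) →
         ∀ i → (x Vector.∷ f) i ≡ (x Vector.∷ g) i
∷-cong f≗g zero    = ≡.refl
∷-cong f≗g (suc i) = f≗g i

∷-head-tail : ∀ {a} {A : Set a} {n} (f : Fin (suc n) → A) → ∀ i → (f zero Vector.∷ f ∘ suc) i ≡ f i
∷-head-tail f zero    = ≡.refl
∷-head-tail f (suc i) = ≡.refl

filterᵇ-cong : ∀ {a} {A : Set a} {p q : A → Bool} → (∀ a → p a ≡ q a) → ∀ as →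
               List.filterᵇ p as ≡ List.filterᵇ q as
filterᵇ-cong p≗q [] = ≡.refl
filterᵇ-cong {p = p} {q} p≗q (a ∷ as) with p a | q a | p≗q a
... | true  | .true  | ≡.refl = ≡.cong (a ∷_) (filterᵇ-cong p≗q as)
... | false | .false | ≡.refl = filterᵇ-cong p≗q as

filterᵇ-tabulate : ∀ {a b} {A : Set a} {B : Set b} (p : B → Bool) (g : A → B) {n} (f : Fin n → A) →
                   List.filterᵇ p (tabulate (g ∘ f)) ≡ List.map g (List.filterᵇ (p ∘ g) (tabulate f))
filterᵇ-tabulate p g {zero}  f = ≡.refl
filterᵇ-tabulate p g {suc n} f with p (g (f zero))
... | true  = ≡.cong (g (f zero) ∷_) (filterᵇ-tabulate p g (f ∘ suc))
... | false = filterᵇ-tabulate p g (f ∘ suc)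

-- Sums over functions and expectations over independent choices

module FunctionSums {c ℓ₁ ℓ₂ : Level} (F : OrderedField c ℓ₁ ℓ₂) where
  open FieldProperties F
  open ≤-Reasoning poset

  -- Taking functions apart and rebuilding them with `Vector.∷` and updates preserves them only
  -- pointwise, so integrands have to respect pointwise equality.
  Extensional : ∀ {n} {B : Set} → ((Fin n → B) → Carrier) → Set ℓ₁
  Extensional f = ∀ {I J} → (∀ j → I j ≡ J j) → f I ≈ f J

  -- Sum over the functions which agree with I outside the mask.
  sumOnMask : ∀ {n} → (Fin n → Bool) → (Fin n → Bool) → ((Fin n → Bool) → Carrier) → Carrier
  sumOnMask {zero}  q I f = f Vector.[]
  sumOnMask {suc n} q I f =
    if q zero then sumBool (λ b → sumOnMask (q ∘ suc) (I ∘ suc) (λ J → f (b Vector.∷ J)))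
              else sumOnMask (q ∘ suc) (I ∘ suc) (λ J → f (I zero Vector.∷ J))

  AgreeOff : ∀ {n} → (Fin n → Bool) → (I J : Fin n → Bool) → Set
  AgreeOff q I J = ∀ j → q j ≡ false → J j ≡ I j

  sumFunctions≡sumOnMask : ∀ {n} {q : Fin n → Bool} I f → (∀ j → q j ≡ true) →
                           sumFunctions n sumBool f ≡ sumOnMask q I f
  sumFunctions≡sumOnMask {zero}      I f q≡true = ≡.refl
  sumFunctions≡sumOnMask {suc n} {q} I f q≡true rewrite q≡true zero =
    ≡.cong₂ _+_ (sumFunctions≡sumOnMask (I ∘ suc) _ (q≡true ∘ suc))
                (sumFunctions≡sumOnMask (I ∘ suc) _ (q≡true ∘ suc))

  agree-∷ : ∀ {n} (q : Fin (suc n) → Bool) {I : Fin (suc n) → Bool} {b J} → (q zero ≡ false → b ≡ I zero) →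
            AgreeOff (q ∘ suc) (I ∘ suc) J → AgreeOff q I (b Vector.∷ J)
  agree-∷ q b≡ agree zero    = b≡
  agree-∷ q b≡ agree (suc j) = agree j

  sumOnMask-cong : ∀ {n} (q I : Fin n → Bool) {f g} → (∀ J → AgreeOff q I J → f J ≈ g J) →
                   sumOnMask q I f ≈ sumOnMask q I g
  sumOnMask-cong {zero}  q I f≈g = f≈g _ (λ ())
  sumOnMask-cong {suc n} q I f≈g with q zero in q₀
  ... | true  = +-cong (sumOnMask-cong _ _ λ J ag → f≈g _ (agree-∷ q (λ q₀′ → absurd (≡.trans (≡.sym q₀) q₀′)) ag))
                       (sumOnMask-cong _ _ λ J ag → f≈g _ (agree-∷ q (λ q₀′ → absurd (≡.trans (≡.sym q₀) q₀′)) ag))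
    where
    absurd : ∀ {a} {A : Set a} → true ≡ false → A
    absurd ()
  ... | false = sumOnMask-cong _ _ λ J ag → f≈g _ (agree-∷ q (λ _ → ≡.refl) ag)

  sumOnMask-mono : ∀ {n} (q I : Fin n → Bool) {f g} → (∀ J → f J ≤ g J) →
                   sumOnMask q I f ≤ sumOnMask q I g
  sumOnMask-mono {zero}  q I f≤g = f≤g _
  sumOnMask-mono {suc n} q I f≤g with q zero
  ... | true  = +-mono-≤ (sumOnMask-mono {n} _ _ λ J → f≤g (false Vector.∷ J)) (sumOnMask-mono {n} _ _ λ J → f≤g (true Vector.∷ J))
  ... | false = sumOnMask-mono {n} _ _ λ J → f≤g (I zero Vector.∷ J)

  sumOnMask-+ : ∀ {n} (q I : Fin n → Bool) f g →
                sumOnMask q I (λ J → f J + g J) ≈ sumOnMask q I f + sumOnMask q I g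
  sumOnMask-+ {zero}  q I f g = refl
  sumOnMask-+ {suc n} q I f g with q zero
  ... | true  = trans (+-cong (sumOnMask-+ {n} _ _ _ _) (sumOnMask-+ {n} _ _ _ _))
                      (solve 4 (λ a b c d → (a :+ b) :+ (c :+ d) := (a :+ c) :+ (b :+ d)) refl _ _ _ _)
  ... | false = sumOnMask-+ {n} _ _ _ _

  *-sumOnMask : ∀ {n} (q I : Fin n → Bool) a f → a * sumOnMask q I f ≈ sumOnMask q I (λ J → a * f J)
  *-sumOnMask {zero}  q I a f = refl
  *-sumOnMask {suc n} q I a f with q zero
  ... | true  = trans (distribˡ _ _ _) (+-cong (*-sumOnMask {n} _ _ a _) (*-sumOnMask {n} _ _ a _))
  ... | false = *-sumOnMask {n} _ _ a _

  -- Fubini for two sets of coordinates; disjointness keeps the inner sum from overwriting what the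
  -- outer one has fixed.
  sumOnMask-∨ : ∀ {n} (q r I : Fin n → Bool) f → (∀ j → q j ≡ true → r j ≡ false) →
                sumOnMask (λ j → q j ∨ r j) I f ≈ sumOnMask q I (λ J → sumOnMask r J f)
  sumOnMask-∨ {zero}  q r I f disjoint = refl
  sumOnMask-∨ {suc n} q r I f disjoint with q zero | r zero | disjoint zero
  ... | false | false | _ = sumOnMask-∨ _ _ _ _ (disjoint ∘ suc)
  ... | false | true  | _ = trans
    (+-cong (sumOnMask-∨ _ _ _ _ (disjoint ∘ suc)) (sumOnMask-∨ _ _ _ _ (disjoint ∘ suc)))
    (sym (sumOnMask-+ {n} _ _ _ _))
  ... | true  | false | _ = +-cong (sumOnMask-∨ _ _ _ _ (disjoint ∘ suc)) (sumOnMask-∨ _ _ _ _ (disjoint ∘ suc))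
  ... | true  | true  | p with () ← p ≡.refl

  selected : ∀ {n} → (q J : Fin n → Bool) → List (Fin n)
  selected {n} q J = List.filterᵇ (λ j → q j ∧ J j) (allFin n)

  selected-off : ∀ {n} (q : Fin (suc n) → Bool) b J → q zero ∧ b ≡ false →
                 selected q (b Vector.∷ J) ≡ List.map suc (selected (q ∘ suc) J)
  selected-off q b J off with q zero ∧ b
  selected-off q b J ≡.refl | false = filterᵇ-tabulate (λ j → q j ∧ (b Vector.∷ J) j) suc id

  selected-on : ∀ {n} (q : Fin (suc n) → Bool) b J → q zero ∧ b ≡ true →
                selected q (b Vector.∷ J) ≡ zero ∷ List.map suc (selected (q ∘ suc) J)
  selected-on q b J on with q zero ∧ b
  selected-on q b J ≡.refl | true = ≡.cong (zero ∷_) (filterᵇ-tabulate (λ j → q j ∧ (b Vector.∷ J) j) suc id)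

  -- A weight that kills all lists of two or more selected coordinates leaves only the blank
  -- pattern, which is `I` itself, and the patterns with one coordinate switched on. The weight is
  -- an arbitrary `ψ` so that the induction may pass to `ψ (zero ∷ List.map suc js)`, for which
  -- already one further coordinate is too many.
  sumOnMask-exclusive : ∀ {n} (q I : Fin n → Bool) (ψ : List (Fin n) → Carrier) h → Extensional h →
    (∀ a b as → ψ (a ∷ b ∷ as) ≈ 0#) → (∀ j → q j ≡ true → I j ≡ false) →
    sumOnMask q I (λ J → ψ (selected q J) * h J) ≈
    ψ [] * h I + sumWhen q (λ j → ψ (j ∷ []) * h (I [ j ≔ true ]))
  sumOnMask-exclusive {zero} q I ψ h h-ext ψ≈0 off =
    trans (*-congˡ (h-ext λ ())) (sym (+-identityʳ _))
  sumOnMask-exclusive {suc n} q I ψ h h-ext ψ≈0 off = step (q zero) ≡.refl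
    where
    q′ = q ∘ suc
    I′ = I ∘ suc
    φ : (Fin (suc n) → Bool) → Carrier
    φ J = ψ (selected q J) * h J
    step : ∀ b → q zero ≡ b →
      (if b then sumBool (λ a → sumOnMask q′ I′ (λ J → φ (a Vector.∷ J)))
            else sumOnMask q′ I′ (λ J → φ (I zero Vector.∷ J))) ≈
      ψ [] * h I + ((if b then ψ (zero ∷ []) * h (I [ zero ≔ true ]) else 0#) +
                    sumWhen q′ (λ j → ψ (suc j ∷ []) * h (I [ suc j ≔ true ])))
    step false q₀ = begin-equality
      sumOnMask q′ I′ (λ J → ψ (selected q (I zero Vector.∷ J)) * h (I zero Vector.∷ J))
        ≈⟨ sumOnMask-cong q′ I′ (λ J _ → *-congʳ (reflexive (≡.cong ψ
             (selected-off q (I zero) J (≡.cong (_∧ I zero) q₀))))) ⟩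
      sumOnMask q′ I′ (λ J → ψ (List.map suc (selected q′ J)) * h (I zero Vector.∷ J))
        ≈⟨ sumOnMask-exclusive q′ I′ (ψ ∘ List.map suc) _ (λ eq → h-ext (∷-cong eq)) (λ a b as → ψ≈0 _ _ _) (off ∘ suc) ⟩
      ψ [] * h (I zero Vector.∷ I′) + sumWhen q′ (λ j → ψ (suc j ∷ []) * h (I zero Vector.∷ (I′ [ j ≔ true ])))
        ≈⟨ +-cong (*-congˡ (h-ext (∷-head-tail I)))
             (sumWhen-cong q′ (λ j _ → *-congˡ (h-ext (∷-head-tail (I [ suc j ≔ true ]))))) ⟩
      ψ [] * h I + sumWhen q′ (λ j → ψ (suc j ∷ []) * h (I [ suc j ≔ true ]))
        ≈⟨ +-congˡ (sym (+-identityˡ _)) ⟩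
      ψ [] * h I + (0# + sumWhen q′ (λ j → ψ (suc j ∷ []) * h (I [ suc j ≔ true ]))) ∎
    step true q₀ = begin-equality
      sumOnMask q′ I′ (λ J → ψ (selected q (false Vector.∷ J)) * h (false Vector.∷ J)) +
      sumOnMask q′ I′ (λ J → ψ (selected q (true Vector.∷ J)) * h (true Vector.∷ J))
        ≈⟨ +-cong
             (sumOnMask-cong q′ I′ (λ J _ → *-congʳ (reflexive (≡.cong ψ
               (selected-off q false J (≡.cong (_∧ false) q₀))))))
             (sumOnMask-cong q′ I′ (λ J _ → *-congʳ (reflexive (≡.cong ψ
               (selected-on q true J (≡.cong (_∧ true) q₀)))))) ⟩
      sumOnMask q′ I′ (λ J → ψ (List.map suc (selected q′ J)) * h (false Vector.∷ J)) +
      sumOnMask q′ I′ (λ J → ψ (zero ∷ List.map suc (selected q′ J)) * h (true Vector.∷ J))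
        ≈⟨ +-cong
             (sumOnMask-exclusive q′ I′ (ψ ∘ List.map suc) _ (λ eq → h-ext (∷-cong eq)) (λ a b as → ψ≈0 _ _ _) (off ∘ suc))
             (sumOnMask-exclusive q′ I′ (λ js → ψ (zero ∷ List.map suc js)) _ (λ eq → h-ext (∷-cong eq)) (λ a b as → ψ≈0 _ _ _) (off ∘ suc)) ⟩
      (ψ [] * h (false Vector.∷ I′) +
        sumWhen q′ (λ j → ψ (suc j ∷ []) * h (false Vector.∷ (I′ [ j ≔ true ])))) +
      (ψ (zero ∷ []) * h (true Vector.∷ I′) +
        sumWhen q′ (λ j → ψ (zero ∷ suc j ∷ []) * h (true Vector.∷ (I′ [ j ≔ true ]))))
        ≈⟨ +-cong
             (+-cong (*-congˡ (h-ext λ { zero → ≡.sym (off zero q₀) ; (suc j) → ≡.refl }))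
               (sumWhen-cong q′ (λ j _ → *-congˡ
                 (h-ext λ { zero → ≡.sym (off zero q₀) ; (suc i) → ≡.refl }))))
             (+-cong (*-congˡ (h-ext (∷-head-tail (I [ zero ≔ true ]))))
               (∑-zero (λ j → trans (if-cong (q′ j) λ _ → trans (*-congʳ (ψ≈0 _ _ _)) (zeroˡ _)) (if-0 (q′ j))))) ⟩
      (ψ [] * h I + sumWhen q′ (λ j → ψ (suc j ∷ []) * h (I [ suc j ≔ true ]))) +
      (ψ (zero ∷ []) * h (I [ zero ≔ true ]) + 0#)
        ≈⟨ solve 3 (λ a b d → (a :+ b) :+ (d :+ con (+ 0)) := a :+ (d :+ b)) refl _ _ _ ⟩
      ψ [] * h I + (ψ (zero ∷ []) * h (I [ zero ≔ true ]) +
        sumWhen q′ (λ j → ψ (suc j ∷ []) * h (I [ suc j ≔ true ]))) ∎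

  module _ {m : ℕ} where

    sumMaybe-cong : ∀ {f g : Maybe (Fin m) → Carrier} → (∀ a → f a ≈ g a) → sumMaybe f ≈ sumMaybe g
    sumMaybe-cong f≈g = +-cong (f≈g nothing) (∑-cong (λ i → f≈g (just i)))

    sumMaybe-+ : ∀ (f g : Maybe (Fin m) → Carrier) → sumMaybe (λ a → f a + g a) ≈ sumMaybe f + sumMaybe g
    sumMaybe-+ f g = trans (+-congˡ (∑-distrib-+ {m} _ _))
      (solve 4 (λ a b c d → (a :+ b) :+ (c :+ d) := (a :+ c) :+ (b :+ d)) refl _ _ _ _)

    *-sumMaybe : ∀ y (f : Maybe (Fin m) → Carrier) → y * sumMaybe f ≈ sumMaybe (λ a → y * f a)
    *-sumMaybe y f = trans (distribˡ _ _ _) (+-congˡ (*-distribˡ-sum {m} y _))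

    sumMaybe-* : ∀ y (f : Maybe (Fin m) → Carrier) → sumMaybe f * y ≈ sumMaybe (λ a → f a * y)
    sumMaybe-* y f = trans (distribʳ _ _ _) (+-congˡ (*-distribʳ-sum {m} y _))

    -- Expectation under a product law in iterated form: every coordinate keeps its own weight,
    -- which permits induction on the coordinates.
    integral : ∀ {n} → (Fin n → Maybe (Fin m) → Carrier) → ((Fin n → Maybe (Fin m)) → Carrier) → Carrier
    integral {zero}  w f = f Vector.[]
    integral {suc n} w f = sumMaybe (λ a → w zero a * integral (w ∘ suc) (λ A → f (a Vector.∷ A)))

    sumFunctions-cong : ∀ n {f g : (Fin n → Maybe (Fin m)) → Carrier} → (∀ A → f A ≈ g A) →
                        sumFunctions n sumMaybe f ≈ sumFunctions n sumMaybe g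
    sumFunctions-cong zero    f≈g = f≈g _
    sumFunctions-cong (suc n) f≈g = sumMaybe-cong λ a → sumFunctions-cong n λ A → f≈g (a Vector.∷ A)

    *-sumFunctions : ∀ n y (f : (Fin n → Maybe (Fin m)) → Carrier) →
                     y * sumFunctions n sumMaybe f ≈ sumFunctions n sumMaybe (λ A → y * f A)
    *-sumFunctions zero    y f = refl
    *-sumFunctions (suc n) y f = trans (*-sumMaybe y (λ a → sumFunctions n sumMaybe (λ A → f (a Vector.∷ A))))
      (sumMaybe-cong λ a → *-sumFunctions n y (λ A → f (a Vector.∷ A)))

    sumFunctions≈integral : ∀ n (w : Fin n → Maybe (Fin m) → Carrier) f →
      sumFunctions n sumMaybe (λ A → product (λ j → w j (A j)) * f A) ≈ integral w f
    sumFunctions≈integral zero    w f = *-identityˡ _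
    sumFunctions≈integral (suc n) w f = sumMaybe-cong λ a → begin-equality
      sumFunctions n sumMaybe (λ A → w zero a * product (λ j → w (suc j) (A j)) * f (a Vector.∷ A))
        ≈⟨ sumFunctions-cong n (λ A → *-assoc _ _ _) ⟩
      sumFunctions n sumMaybe (λ A → w zero a * (product (λ j → w (suc j) (A j)) * f (a Vector.∷ A)))
        ≈⟨ sym (*-sumFunctions n _ _) ⟩
      w zero a * sumFunctions n sumMaybe (λ A → product (λ j → w (suc j) (A j)) * f (a Vector.∷ A))
        ≈⟨ *-congˡ (sumFunctions≈integral n (w ∘ suc) _) ⟩
      w zero a * integral (w ∘ suc) (λ A → f (a Vector.∷ A)) ∎

    integral-cong : ∀ {n} (w : Fin n → Maybe (Fin m) → Carrier) {f g} → (∀ A → f A ≈ g A) →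
                    integral w f ≈ integral w g
    integral-cong {zero}  w f≈g = f≈g _
    integral-cong {suc n} w f≈g = sumMaybe-cong λ a → *-congˡ {x = w zero a} (integral-cong (w ∘ suc) λ A → f≈g (a Vector.∷ A))

    integral-+ : ∀ {n} (w : Fin n → Maybe (Fin m) → Carrier) f g →
                 integral w (λ A → f A + g A) ≈ integral w f + integral w g
    integral-+ {zero}  w f g = refl
    integral-+ {suc n} w f g = trans
      (sumMaybe-cong λ a → trans
        (*-congˡ {x = w zero a} (integral-+ (w ∘ suc) (λ A → f (a Vector.∷ A)) (λ A → g (a Vector.∷ A))))
        (distribˡ _ _ _))
      (sumMaybe-+ (λ a → w zero a * integral (w ∘ suc) (λ A → f (a Vector.∷ A)))
                  (λ a → w zero a * integral (w ∘ suc) (λ A → g (a Vector.∷ A))))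

    *-integral : ∀ {n} (w : Fin n → Maybe (Fin m) → Carrier) y f →
                 y * integral w f ≈ integral w (λ A → y * f A)
    *-integral {zero}  w y f = refl
    *-integral {suc n} w y f = trans
      (*-sumMaybe y (λ a → w zero a * integral (w ∘ suc) (λ A → f (a Vector.∷ A))))
      (sumMaybe-cong λ a → trans
        (solve 3 (λ y w z → y :* (w :* z) := w :* (y :* z)) refl y (w zero a) _)
        (*-congˡ {x = w zero a} (*-integral (w ∘ suc) y (λ A → f (a Vector.∷ A)))))

    integral-0 : ∀ {n} (w : Fin n → Maybe (Fin m) → Carrier) → integral w (λ _ → 0#) ≈ 0#
    integral-0 w = trans (integral-cong w (λ _ → sym (zeroˡ 0#)))
                         (trans (sym (*-integral w 0# (λ _ → 0#))) (zeroˡ _))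

    integral-∑ : ∀ {n} (w : Fin n → Maybe (Fin m) → Carrier) {l} (f : Fin l → (Fin n → Maybe (Fin m)) → Carrier) →
                 integral w (λ A → sum (λ i → f i A)) ≈ sum (λ i → integral w (f i))
    integral-∑ w {zero}  f = integral-0 w
    integral-∑ w {suc l} f = trans (integral-+ w _ _) (+-congˡ (integral-∑ w (f ∘ suc)))

    integral-if : ∀ {n} (w : Fin n → Maybe (Fin m) → Carrier) b f →
                  integral w (λ A → if b then f A else 0#) ≈ (if b then integral w f else 0#)
    integral-if w true  f = refl
    integral-if w false f = integral-0 w

    integral-sumMaybe : ∀ {n} (w : Fin n → Maybe (Fin m) → Carrier) (f : Maybe (Fin m) → (Fin n → Maybe (Fin m)) → Carrier) →
                        integral w (λ A → sumMaybe (λ a → f a A)) ≈ sumMaybe (λ a → integral w (f a))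
    integral-sumMaybe w f = trans (integral-+ w (f nothing) _) (+-congˡ (integral-∑ w {m} (λ i → f (just i))))

    integral-const : ∀ {n} (w : Fin n → Maybe (Fin m) → Carrier) y → (∀ j → sumMaybe (w j) ≈ 1#) →
                     integral w (λ _ → y) ≈ y
    integral-const {zero}  w y w≈1 = refl
    integral-const {suc n} w y w≈1 = begin-equality
      sumMaybe (λ a → w zero a * integral (w ∘ suc) (λ _ → y))
        ≈⟨ sumMaybe-cong (λ a → *-congˡ {x = w zero a} (integral-const (w ∘ suc) y (w≈1 ∘ suc))) ⟩
      sumMaybe (λ a → w zero a * y)  ≈⟨ sym (sumMaybe-* y (w zero)) ⟩
      sumMaybe (w zero) * y          ≈⟨ *-congʳ (w≈1 zero) ⟩
      1# * y                         ≈⟨ *-identityˡ y ⟩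
      y                              ∎

    -- Redrawing one coordinate from its own law changes nothing when its weights total 1. This
    -- exposes the draw of a particular query wherever it stands among the coordinates.
    integral-resample : ∀ {n} (w : Fin n → Maybe (Fin m) → Carrier) j f → Extensional f →
                        sumMaybe (w j) ≈ 1# →
                        integral w f ≈ integral w (λ A → sumMaybe (λ a → w j a * f (A [ j ≔ a ])))
    integral-resample {suc n} w zero f f-ext w≈1 = begin-equality
      integral w f
        ≈⟨ sym (*-identityˡ _) ⟩
      1# * integral w f
        -- The factor 1 becomes a draw `b` of the coordinate, which the update then overwrites.
        ≈⟨ *-congʳ (sym w≈1) ⟩
      sumMaybe (w zero) * integral w f
        ≈⟨ sumMaybe-* _ (w zero) ⟩
      sumMaybe (λ b → w zero b * integral w f)
        ≈⟨ sumMaybe-cong (λ b → *-congˡ {x = w zero b} (begin-equality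
             sumMaybe (λ a → w zero a * integral (w ∘ suc) (λ A → f (a Vector.∷ A)))
               ≈⟨ sumMaybe-cong (λ a → trans (*-integral (w ∘ suc) (w zero a) _)
                    (integral-cong (w ∘ suc) (λ A → *-congˡ (f-ext {a Vector.∷ A} {(b Vector.∷ A) [ zero ≔ a ]}
                      λ { zero → ≡.refl ; (suc i) → ≡.refl })))) ⟩
             sumMaybe (λ a → integral (w ∘ suc) (λ A → w zero a * f ((b Vector.∷ A) [ zero ≔ a ])))
               ≈⟨ sym (integral-sumMaybe (w ∘ suc) (λ a A → w zero a * f ((b Vector.∷ A) [ zero ≔ a ]))) ⟩
             integral (w ∘ suc) (λ A → sumMaybe (λ a → w zero a * f ((b Vector.∷ A) [ zero ≔ a ]))) ∎)) ⟩
      integral w (λ A → sumMaybe (λ a → w zero a * f (A [ zero ≔ a ]))) ∎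
    integral-resample {suc n} w (suc j) f f-ext w≈1 = sumMaybe-cong λ b → *-congˡ {x = w zero b} (begin-equality
      integral (w ∘ suc) (λ A → f (b Vector.∷ A))
        ≈⟨ integral-resample (w ∘ suc) j _ (λ eq → f-ext (∷-cong eq)) w≈1 ⟩
      integral (w ∘ suc) (λ A → sumMaybe (λ a → w (suc j) a * f (b Vector.∷ (A [ j ≔ a ]))))
        ≈⟨ integral-cong (w ∘ suc) (λ A → sumMaybe-cong λ a → *-congˡ {x = w (suc j) a}
             (f-ext {b Vector.∷ (A [ j ≔ a ])} {(b Vector.∷ A) [ suc j ≔ a ]} λ { zero → ≡.refl ; (suc i) → ≡.refl })) ⟩
      integral (w ∘ suc) (λ A → sumMaybe (λ a → w (suc j) a * f ((b Vector.∷ A) [ suc j ≔ a ]))) ∎)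

-- From arrivals and choices to independent blocks of offers

module Outcomes {c ℓ₁ ℓ₂ : Level} (F : OrderedField c ℓ₁ ℓ₂)
  (M : AdCell.Market F) (x : AdCell.FractionalAllocation F M) (x-feasible : AdCell.LPFeasible F M x) where

  open FieldProperties F
  open FunctionSums F
  open FractionalMatching F M x x-feasible
  open AdCell F
  open Market M
  open LPFeasible x-feasible
  open AlgorithmC M x using (choiceProb; 𝔼-choices)
  open ≤-Reasoning poset

  Block : Set
  Block = Fin s × Fin u

  inB : Block → Fin n → Bool
  inB (k , t) = inBlock k t

  covered : List Block → Fin n → Bool
  covered []       j = false
  covered (b ∷ bs) j = inB b j ∨ covered bs j

  block : Fin n → Block
  block j = customer j , slot j

  inB⇒≡ : ∀ b {j} → inB b j ≡ true → block j ≡ b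
  inB⇒≡ (k , t) {j} eq with customer j ≟ᶠ k | slot j ≟ᶠ t
  ... | yes ≡.refl | yes ≡.refl = ≡.refl

  inB-block : ∀ j → inB (block j) j ≡ true
  inB-block j with customer j ≟ᶠ customer j | slot j ≟ᶠ slot j
  ... | yes _  | yes _  = ≡.refl
  ... | yes _  | no neq = contradiction ≡.refl neq
  ... | no neq | _      = contradiction ≡.refl neq

  covered⇒∈ : ∀ bs {j} → covered bs j ≡ true → block j ∈ bs
  covered⇒∈ (b ∷ bs) {j} eq with inB b j in j∈b
  ... | true  = here (inB⇒≡ b j∈b)
  ... | false = there (covered⇒∈ bs eq)

  ∈⇒covered : ∀ {bs j} → block j ∈ bs → covered bs j ≡ true
  ∈⇒covered {j = j} (here ≡.refl) rewrite inB-block j = ≡.refl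
  ∈⇒covered {b ∷ bs} {j} (there j∈bs) with inB b j
  ... | true  = ≡.refl
  ... | false = ∈⇒covered j∈bs

  covered-tail : ∀ b bs {j} → covered bs j ≡ true → covered (b ∷ bs) j ≡ true
  covered-tail b bs eq = ∈⇒covered (there (covered⇒∈ bs eq))

  covered-head : ∀ b bs {j} → inB b j ≡ true → covered (b ∷ bs) j ≡ true
  covered-head b bs eq rewrite eq = ≡.refl

  disjoint : ∀ {b bs} → All (b ≢_) bs → ∀ j → inB b j ≡ true → covered bs j ≡ false
  disjoint {b} {bs} b∉bs j j∈b with covered bs j in j∈bs
  ... | false = ≡.refl
  ... | true  = contradiction (≡.sym (inB⇒≡ b j∈b)) (All.lookup b∉bs (covered⇒∈ bs j∈bs))

  disjoint′ : ∀ {b bs} → All (b ≢_) bs → ∀ j → covered bs j ≡ true → inB b j ≡ false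
  disjoint′ {b} b∉bs j j∈bs with inB b j in j∈b
  ... | false = ≡.refl
  ... | true  with () ← ≡.trans (≡.sym j∈bs) (disjoint b∉bs j j∈b)

  blocks : List Block
  blocks = List.cartesianProduct (allFin s) (allFin u)

  blocks-unique : Unique blocks
  blocks-unique = cartesianProduct⁺ (allFin⁺ s) (allFin⁺ u)

  blocks-complete : ∀ b → b ∈ blocks
  blocks-complete (k , t) = ∈-cartesianProduct⁺ (∈-allFin k) (∈-allFin t)

  -- The invariant of the inductions along blocks: the configuration is still blank wherever it
  -- remains to be drawn. The blank value is `false` for arrivals and `nothing` for outcomes.
  OffCovered : ∀ {A : Set} → A → List Block → (Fin n → A) → Set
  OffCovered a bs I = ∀ j → covered bs j ≡ true → I j ≡ a

  OffCovered-tail : ∀ {A : Set} {a : A} {b bs I} → OffCovered a (b ∷ bs) I → OffCovered a bs I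
  OffCovered-tail {b = b} {bs} off j j∈bs = off j (covered-tail b bs j∈bs)

  OffCovered-≔ : ∀ {A : Set} {a : A} {b bs I} → All (b ≢_) bs → OffCovered a (b ∷ bs) I →
                 ∀ {v} j → inB b j ≡ true → OffCovered a bs (I [ j ≔ v ])
  OffCovered-≔ {b = b} {bs} {I} b∉bs off {v} j j∈b i i∈bs with i ≟ᶠ j
  ... | no  i≢j    = ≡.trans (minimal I i≢j) (off i (covered-tail b bs i∈bs))
  ... | yes ≡.refl with () ← ≡.trans (≡.sym i∈bs) (disjoint b∉bs i j∈b)

  -- The law of one block as an operator on functions of the configuration. Composing these
  -- operators replaces the sum over all arrival patterns.
  arrivalStep : Block → (Arrivals M → Carrier) → Arrivals M → Carrier
  arrivalStep (k , t) h I = (1# - sumWhen (inBlock k t) prob) * h I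
                          + sumWhen (inBlock k t) (λ j → prob j * h (I [ j ≔ true ]))

  arrivalExp : List Block → (Arrivals M → Carrier) → Arrivals M → Carrier
  arrivalExp []       f = f
  arrivalExp (b ∷ bs) f = arrivalStep b (arrivalExp bs f)

  arrivalStep-cong : ∀ b {g h} {I J} → g I ≈ h J → (∀ j → g (I [ j ≔ true ]) ≈ h (J [ j ≔ true ])) →
                     arrivalStep b g I ≈ arrivalStep b h J
  arrivalStep-cong (k , t) g≈h g≈h′ =
    +-cong (*-congˡ g≈h) (sumWhen-cong (inBlock k t) (λ j _ → *-congˡ (g≈h′ j)))

  arrivalExp-cong : ∀ bs {f g} → (∀ I → f I ≈ g I) → ∀ I → arrivalExp bs f I ≈ arrivalExp bs g I
  arrivalExp-cong []       f≈g = f≈g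
  arrivalExp-cong (b ∷ bs) {f} {g} f≈g I = arrivalStep-cong b {arrivalExp bs f} {arrivalExp bs g} {I} {I}
    (arrivalExp-cong bs f≈g I) (λ j → arrivalExp-cong bs f≈g (I [ j ≔ true ]))

  arrivalExp-ext : ∀ bs {f} → Extensional f → Extensional (arrivalExp bs f)
  arrivalExp-ext []       f-ext I≗J = f-ext I≗J
  arrivalExp-ext (b ∷ bs) {f} f-ext {I} {J} I≗J = arrivalStep-cong b {arrivalExp bs f} {arrivalExp bs f} {I} {J}
    (arrivalExp-ext bs f-ext I≗J) (λ j → arrivalExp-ext bs f-ext (≔-cong j I≗J))

  blockLaw : Block → Arrivals M → Carrier
  blockLaw (k , t) = blockProb M k t

  blockLaw-local : ∀ b {I J} → (∀ j → inB b j ≡ true → I j ≡ J j) → blockLaw b I ≈ blockLaw b J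
  blockLaw-local (k , t) {I} {J} I≗J = reflexive (≡.cong (blockWeight M k t) (filterᵇ-cong same (allFin n)))
    where
    same : ∀ j → inBlock k t j ∧ I j ≡ inBlock k t j ∧ J j
    same j with inBlock k t j | I≗J j
    ... | true  | eq = eq ≡.refl
    ... | false | _  = ≡.refl

  sumOnMask-none : ∀ {n} (I : Fin n → Bool) {f} → Extensional f → sumOnMask (λ _ → false) I f ≈ f I
  sumOnMask-none {zero}  I f-ext = f-ext λ ()
  sumOnMask-none {suc n} I f-ext = trans (sumOnMask-none (I ∘ suc) (λ eq → f-ext (∷-cong eq)))
                                         (f-ext (∷-head-tail I))

  -- The blocks are integrated one at a time: the law of a block does not depend on the others.
  sumOnMask-arrivals : ∀ bs → Unique bs → ∀ I {f} → Extensional f → OffCovered false bs I →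
    sumOnMask (covered bs) I (λ J → productOver bs (λ b → blockLaw b J) * f J) ≈ arrivalExp bs f I
  sumOnMask-arrivals [] _ I f-ext off = trans
    (sumOnMask-cong _ I (λ J _ → *-identityˡ _)) (sumOnMask-none I f-ext)
  sumOnMask-arrivals (b@(k , t) ∷ bs) (b∉bs ∷ bs-unique) I {f} f-ext off = begin-equality
    sumOnMask (λ j → inB b j ∨ covered bs j) I (λ J → blockLaw b J * Π J * f J)
      ≈⟨ sumOnMask-∨ (inB b) (covered bs) I _ (disjoint b∉bs) ⟩
    sumOnMask (inB b) I (λ J → sumOnMask (covered bs) J (λ K → blockLaw b K * Π K * f K))
      ≈⟨ sumOnMask-cong (inB b) I (λ J J∼I → begin-equality
           sumOnMask (covered bs) J (λ K → blockLaw b K * Π K * f K)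
             ≈⟨ sumOnMask-cong (covered bs) J (λ K K∼J → trans (*-assoc _ _ _)
                  (*-congʳ (blockLaw-local b (λ j j∈b → K∼J j (disjoint b∉bs j j∈b))))) ⟩
           sumOnMask (covered bs) J (λ K → blockLaw b J * (Π K * f K))
             ≈⟨ sym (*-sumOnMask (covered bs) J _ _) ⟩
           blockLaw b J * sumOnMask (covered bs) J (λ K → Π K * f K)
             ≈⟨ *-congˡ (sumOnMask-arrivals bs bs-unique J f-ext (λ j j∈bs →
                  ≡.trans (J∼I j (disjoint′ b∉bs j j∈bs)) (off j (covered-tail b bs j∈bs)))) ⟩
           blockLaw b J * arrivalExp bs f J ∎) ⟩
    sumOnMask (inB b) I (λ J → blockLaw b J * arrivalExp bs f J)
      ≈⟨ sumOnMask-exclusive (inB b) I (blockWeight M k t) (arrivalExp bs f) (arrivalExp-ext bs f-ext)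
           (λ _ _ _ → refl) (λ j j∈b → off j (covered-head b bs j∈b)) ⟩
    arrivalStep b (arrivalExp bs f) I ∎
    where
    Π : Arrivals M → Carrier
    Π K = productOver bs (λ b → blockLaw b K)

  productOver-cartesian : ∀ {A B : Set} (as : List A) (bs : List B) (f : A × B → Carrier) →
    productOver (List.cartesianProduct as bs) f ≈ productOver as (λ a → productOver bs (λ b → f (a , b)))
  productOver-cartesian []       bs f = refl
  productOver-cartesian (a ∷ as) bs f = trans (productOver-++ (List.map (a ,_) bs) _ f)
    (*-cong (reflexive (productOver-map bs (a ,_) f)) (productOver-cartesian as bs f))

  arrivalProb≈ : ∀ I → arrivalProb M I ≈ productOver blocks (λ b → blockLaw b I)
  arrivalProb≈ I = sym (begin-equality
    productOver blocks (λ b → blockLaw b I)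
      ≈⟨ productOver-cartesian (allFin s) (allFin u) _ ⟩
    productOver (allFin s) (λ k → productOver (allFin u) (λ t → blockProb M k t I))
      ≈⟨ productOver-cong (allFin s) (λ k → reflexive (productOver-tabulate {n = u} id (λ t → blockProb M k t I))) ⟩
    productOver (allFin s) (λ k → product (λ t → blockProb M k t I))
      ≡⟨ productOver-tabulate {n = s} id (λ k → product (λ t → blockProb M k t I)) ⟩
    arrivalProb M I ∎)

  𝔼-arrivals≈sumOnMask : ∀ f → 𝔼-arrivals M f ≈
    sumOnMask (covered blocks) (λ _ → false) (λ J → productOver blocks (λ b → blockLaw b J) * f J)
  𝔼-arrivals≈sumOnMask f = trans
    (reflexive (sumFunctions≡sumOnMask (λ _ → false) _ (λ j → ∈⇒covered (blocks-complete (block j)))))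
    (sumOnMask-cong (covered blocks) _ (λ J _ → *-congʳ (arrivalProb≈ J)))

  𝔼-arrivals≈arrivalExp : ∀ {f} → Extensional f → 𝔼-arrivals M f ≈ arrivalExp blocks f (λ _ → false)
  𝔼-arrivals≈arrivalExp {f} f-ext = trans (𝔼-arrivals≈sumOnMask f)
    (sumOnMask-arrivals blocks blocks-unique (λ _ → false) f-ext (λ _ _ → ≡.refl))

  -- The advertiser offered each query: the arrivals and the choices matter only through it.
  Outcome : Set
  Outcome = Fin n → Maybe (Fin m)

  effective : Arrivals M → (Fin n → Maybe (Fin m)) → Outcome
  effective I A j = if I j then A j else nothing

  -- Arrival of `j` and the draw of `i` have joint probability `x i j`; a query that arrives and
  -- draws nobody counts as no offer.
  outcomeStep : Block → (Outcome → Carrier) → Outcome → Carrier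
  outcomeStep (k , t) h Z = (1# - mass k t) * h Z + blockSum k t (λ i j → x i j * h (Z [ j ≔ just i ]))

  𝔼 : List Block → (Outcome → Carrier) → Outcome → Carrier
  𝔼 []       g = g
  𝔼 (b ∷ bs) g = outcomeStep b (𝔼 bs g)

  outcomeStep-cong : ∀ b {g h} {Y Z} → g Y ≈ h Z →
    (∀ i j → inB b j ≡ true → g (Y [ j ≔ just i ]) ≈ h (Z [ j ≔ just i ])) →
    outcomeStep b g Y ≈ outcomeStep b h Z
  outcomeStep-cong (k , t) g≈h g≈h′ =
    +-cong (*-congˡ g≈h) (sumWhen-cong (inBlock k t) (λ j j∈b → ∑-cong (λ i → *-congˡ (g≈h′ i j j∈b))))

  𝔼-ext : ∀ bs {g} → Extensional g → Extensional (𝔼 bs g)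
  𝔼-ext []       g-ext Y≗Z = g-ext Y≗Z
  𝔼-ext (b ∷ bs) {g} g-ext {Y} {Z} Y≗Z = outcomeStep-cong b {𝔼 bs g} {𝔼 bs g} {Y} {Z}
    (𝔼-ext bs g-ext Y≗Z) (λ i j _ → 𝔼-ext bs g-ext (≔-cong j Y≗Z))

  x≤prob : ∀ i j → x i j ≤ prob j
  x≤prob i j = ≤-trans (term≤∑ (λ i → lower i j) i) (perQuery j)

  prob*choice : ∀ i j → prob j * choiceProb j (just i) ≈ x i j
  prob*choice i j = x*[y÷x]≈y (lower i j) (x≤prob i j)

  prob*nothing : ∀ j → prob j * choiceProb j nothing ≈ prob j - sum (λ i → x i j)
  prob*nothing j = begin-equality
    prob j * (1# - sum (λ i → x i j ÷ prob j))
      ≈⟨ solve 2 (λ p q → p :* (con (+ 1) :- q) := p :- p :* q) refl _ _ ⟩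
    prob j - prob j * sum (λ i → x i j ÷ prob j)
      ≈⟨ +-congˡ (-‿cong (trans (*-distribˡ-sum {m} _ _) (∑-cong (λ i → prob*choice i j)))) ⟩
    prob j - sum (λ i → x i j) ∎

  choiceProb-total : ∀ j → sumMaybe (choiceProb j) ≈ 1#
  choiceProb-total j = solve 1 (λ q → con (+ 1) :- q :+ q := con (+ 1)) refl _

  effective-≔ : ∀ I A j a → ∀ i → effective (I [ j ≔ true ]) (A [ j ≔ a ]) i ≡ (effective I A [ j ≔ a ]) i
  effective-≔ I A j a i with i ≟ᶠ j
  ... | yes ≡.refl rewrite updates I i {true} | updates A i {a} | updates (effective I A) i {a} = ≡.refl
  ... | no  i≢j    rewrite minimal I {v = true} i≢j | minimal A {v = a} i≢j
                         | minimal (effective I A) {v = a} i≢j = ≡.refl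

  effective-≔nothing : ∀ I A j → I j ≡ false → ∀ i → (effective I A [ j ≔ nothing ]) i ≡ effective I A i
  effective-≔nothing I A j off i with i ≟ᶠ j
  ... | yes ≡.refl rewrite updates (effective I A) i {nothing} | off = ≡.refl
  ... | no  i≢j    = minimal (effective I A) i≢j

  effective-cong : ∀ I {A B} → (∀ j → A j ≡ B j) → ∀ j → effective I A j ≡ effective I B j
  effective-cong I A≗B j rewrite A≗B j = ≡.refl

  -- Before the arrival the draw of `j` is masked. Resampling makes it explicit, and drawing nobody
  -- leads back to the outcome without the arrival.
  integrate-arrival : ∀ I j {h} → Extensional h → I j ≡ false →
    prob j * integral choiceProb (λ A → h (effective (I [ j ≔ true ]) A)) ≈
    integral choiceProb (λ A → (prob j - sum (λ i → x i j)) * h (effective I A)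
                             + sum (λ i → x i j * h (effective I A [ j ≔ just i ])))
  integrate-arrival I j {h} h-ext off = begin-equality
    prob j * integral choiceProb (λ A → h (effective (I [ j ≔ true ]) A))
      ≈⟨ *-congˡ (integral-resample choiceProb j _
           (λ A≗B → h-ext (effective-cong (I [ j ≔ true ]) A≗B)) (choiceProb-total j)) ⟩
    prob j * integral choiceProb (λ A → sumMaybe (λ a →
      choiceProb j a * h (effective (I [ j ≔ true ]) (A [ j ≔ a ]))))
      ≈⟨ *-integral choiceProb _ _ ⟩
    integral choiceProb (λ A → prob j * sumMaybe (λ a →
      choiceProb j a * h (effective (I [ j ≔ true ]) (A [ j ≔ a ]))))
      ≈⟨ integral-cong choiceProb (λ A → begin-equality
           prob j * sumMaybe (λ a → choiceProb j a * h (effective (I [ j ≔ true ]) (A [ j ≔ a ])))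
             ≈⟨ trans (*-sumMaybe (prob j) (λ a → choiceProb j a * h (effective (I [ j ≔ true ]) (A [ j ≔ a ]))))
                      (+-cong (sym (*-assoc _ _ _)) (∑-cong {m} (λ i → sym (*-assoc _ _ _)))) ⟩
           prob j * choiceProb j nothing * h (effective (I [ j ≔ true ]) (A [ j ≔ nothing ])) +
           sum (λ i → prob j * choiceProb j (just i) * h (effective (I [ j ≔ true ]) (A [ j ≔ just i ])))
             ≈⟨ +-cong
                  (*-cong (prob*nothing j) (h-ext (λ i →
                    ≡.trans (effective-≔ I A j nothing i) (effective-≔nothing I A j off i))))
                  (∑-cong (λ i → *-cong (prob*choice i j) (h-ext (effective-≔ I A j (just i))))) ⟩
           (prob j - sum (λ i → x i j)) * h (effective I A)
             + sum (λ i → x i j * h (effective I A [ j ≔ just i ])) ∎) ⟩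
    _ ∎

  -- The choices are drawn up front for all queries, whereas `𝔼` draws block by block; the induction
  -- moves each block's draws inside its arrival step.
  arrivalExp-integral : ∀ bs → Unique bs → ∀ I {g} → Extensional g → OffCovered false bs I →
    arrivalExp bs (λ J → integral choiceProb (λ A → g (effective J A))) I ≈
    integral choiceProb (λ A → 𝔼 bs g (effective I A))
  arrivalExp-integral [] _ I g-ext off = refl
  arrivalExp-integral (b@(k , t) ∷ bs) (b∉bs ∷ bs-unique) I {g} g-ext off = begin-equality
    (1# - P) * arrivalExp bs f I + sumWhen (inB b) (λ j → prob j * arrivalExp bs f (I [ j ≔ true ]))
      ≈⟨ +-cong
           (*-congˡ (arrivalExp-integral bs bs-unique I g-ext (OffCovered-tail {b = b} {bs} off)))
           (sumWhen-cong (inB b) (λ j j∈b → trans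
             (*-congˡ (arrivalExp-integral bs bs-unique (I [ j ≔ true ]) g-ext (OffCovered-≔ b∉bs off j j∈b)))
             (integrate-arrival I j (𝔼-ext bs g-ext) (off j (covered-head b bs j∈b))))) ⟩
    (1# - P) * integral choiceProb (λ A → h (effective I A)) + sumWhen (inB b) (λ j → integral choiceProb (K j))
      ≈⟨ +-cong (*-integral choiceProb _ _)
           (trans (∑-cong (λ j → sym (integral-if choiceProb (inB b j) (K j))))
                  (sym (integral-∑ choiceProb {n} (λ j A → if inB b j then K j A else 0#)))) ⟩
    integral choiceProb (λ A → (1# - P) * h (effective I A)) +
    integral choiceProb (λ A → sumWhen (inB b) (λ j → K j A))
      ≈⟨ sym (integral-+ choiceProb _ _) ⟩
    integral choiceProb (λ A → (1# - P) * h (effective I A) + sumWhen (inB b) (λ j → K j A))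
      ≈⟨ integral-cong choiceProb (λ A → begin-equality
           (1# - P) * h (effective I A) + sumWhen (inB b) (λ j → K j A)
             ≈⟨ +-congˡ (trans (sumWhen-+ (inB b) _ _)
                  (+-congʳ (begin-equality
                    sumWhen (inB b) (λ j → (prob j - sum (λ i → x i j)) * h (effective I A))
                      ≈⟨ sumWhen-cong (inB b) (λ j _ → *-comm _ _) ⟩
                    sumWhen (inB b) (λ j → h (effective I A) * (prob j - sum (λ i → x i j)))
                      ≈⟨ sym (*-sumWhen (inB b) _ _) ⟩
                    h (effective I A) * sumWhen (inB b) (λ j → prob j - sum (λ i → x i j))
                      ≈⟨ *-congˡ (sumWhen-- (inB b) _ _) ⟩
                    h (effective I A) * (P - mass k t) ∎))) ⟩
           (1# - P) * h (effective I A) + (h (effective I A) * (P - mass k t)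
             + blockSum k t (λ i j → x i j * h (effective I A [ j ≔ just i ])))
             -- No arrival, of probability `1# - P`, and an arrival without a draw, of probability
             -- `P - mass k t`, merge into the single case of no offer.
             ≈⟨ solve 4 (λ p h q r → (con (+ 1) :- p) :* h :+ (h :* (p :- q) :+ r) := (con (+ 1) :- q) :* h :+ r)
                  refl P _ (mass k t) _ ⟩
           𝔼 (b ∷ bs) g (effective I A) ∎) ⟩
    integral choiceProb (λ A → 𝔼 (b ∷ bs) g (effective I A)) ∎
    where
    P = sumWhen (inB b) prob
    f : Arrivals M → Carrier
    f J = integral choiceProb (λ A → g (effective J A))
    h = 𝔼 bs g
    K : Fin n → (Fin n → Maybe (Fin m)) → Carrier
    K j A = (prob j - sum (λ i → x i j)) * h (effective I A)
          + sum (λ i → x i j * h (effective I A [ j ≔ just i ]))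

  effective-congˡ : ∀ {I J} A → (∀ j → I j ≡ J j) → ∀ j → effective I A j ≡ effective J A j
  effective-congˡ A I≗J j rewrite I≗J j = ≡.refl

  expectation≈𝔼 : ∀ {g} → Extensional g →
    𝔼-arrivals M (λ I → 𝔼-choices (λ A → g (effective I A))) ≈ 𝔼 blocks g (λ _ → nothing)
  expectation≈𝔼 {g} g-ext = begin-equality
    𝔼-arrivals M (λ I → 𝔼-choices (λ A → g (effective I A)))
      ≈⟨ 𝔼-arrivals≈arrivalExp (λ {I} {J} I≗J → trans (choices≈ I) (trans
           (integral-cong choiceProb (λ A → g-ext (effective-congˡ A I≗J))) (sym (choices≈ J)))) ⟩
    arrivalExp blocks (λ I → 𝔼-choices (λ A → g (effective I A))) (λ _ → false)
      ≈⟨ arrivalExp-cong blocks choices≈ (λ _ → false) ⟩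
    arrivalExp blocks (λ I → integral choiceProb (λ A → g (effective I A))) (λ _ → false)
      ≈⟨ arrivalExp-integral blocks blocks-unique (λ _ → false) g-ext (λ _ _ → ≡.refl) ⟩
    -- Without arrivals the effective outcome is `nothing` everywhere, so the integrand has become
    -- constant in the choices.
    integral choiceProb (λ A → 𝔼 blocks g (λ _ → nothing))
      ≈⟨ integral-const choiceProb _ choiceProb-total ⟩
    𝔼 blocks g (λ _ → nothing) ∎
    where
    choices≈ : ∀ I → 𝔼-choices (λ A → g (effective I A)) ≈ integral choiceProb (λ A → g (effective I A))
    choices≈ I = sumFunctions≈integral n choiceProb (λ A → g (effective I A))

-- Expectations over outcomes and independence of the customers

module OutcomeExpectation {c ℓ₁ ℓ₂ : Level} (F : OrderedField c ℓ₁ ℓ₂)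
  (M : AdCell.Market F) (x : AdCell.FractionalAllocation F M) (x-feasible : AdCell.LPFeasible F M x) where

  open FieldProperties F
  open FunctionSums F
  open Exponential F
  open FractionalMatching F M x x-feasible
  open Outcomes F M x x-feasible
  open AdCell F
  open Market M
  open LPFeasible x-feasible
  open ≤-Reasoning poset

  ∑-customers : ∀ (f : Fin n → Carrier) → sum (λ k → sumWhen (inCustomer k) f) ≈ sum f
  ∑-customers f = trans (∑-comm {s} {n} _) (∑-cong {n} λ j → begin-equality
    sum (λ k → if inCustomer k j then f j else 0#)
      ≈⟨ ∑-single (customer j) (off j) ⟩
    (if inCustomer (customer j) j then f j else 0#)
      ≡⟨ ≡.cong (if_then f j else 0#) (dec-true (customer j ≟ᶠ customer j) ≡.refl) ⟩
    f j ∎)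
    where
    off : ∀ j k → k ≢ customer j → (if inCustomer k j then f j else 0#) ≈ 0#
    off j k k≢ = reflexive (≡.cong (if_then f j else 0#) (dec-false (customer j ≟ᶠ k) (k≢ ∘ ≡.sym)))

  sumOver-cartesian : ∀ {A B : Set} (as : List A) (bs : List B) (f : A × B → Carrier) →
    sumOver (List.cartesianProduct as bs) f ≈ sumOver as (λ a → sumOver bs (λ b → f (a , b)))
  sumOver-cartesian []       bs f = refl
  sumOver-cartesian (a ∷ as) bs f = trans (sumOver-++ (List.map (a ,_) bs) _ f)
    (+-cong (reflexive (sumOver-map bs (a ,_) f)) (sumOver-cartesian as bs f))

  sumOver-blocks : ∀ (f : Fin n → Carrier) → sumOver blocks (λ b → sumWhen (inB b) f) ≈ sum f
  sumOver-blocks f = begin-equality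
    sumOver blocks (λ b → sumWhen (inB b) f)
      ≈⟨ sumOver-cartesian (allFin s) (allFin u) _ ⟩
    sumOver (allFin s) (λ k → sumOver (allFin u) (λ t → sumWhen (inBlock k t) f))
      ≈⟨ sumOver-cong (allFin s) (λ k → sumOver-slots k f) ⟩
    sumOver (allFin s) (λ k → sumWhen (inCustomer k) f)
      ≡⟨ sumOver-tabulate {n = s} id (λ k → sumWhen (inCustomer k) f) ⟩
    sum (λ k → sumWhen (inCustomer k) f)
      ≈⟨ ∑-customers f ⟩
    sum f ∎

  outcomeStep-mono : ∀ b {g h : Outcome → Carrier} Z → g Z ≤ h Z →
    (∀ i j → g (Z [ j ≔ just i ]) ≤ h (Z [ j ≔ just i ])) → outcomeStep b g Z ≤ outcomeStep b h Z
  outcomeStep-mono (k , t) Z g≤h g≤h′ = +-mono-≤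
    (*-monoʳ-≤ (x≤y⇒0≤y-x (mass≤1 k t)) g≤h)
    (blockSum-mono k t (λ i j → *-monoʳ-≤ (lower i j) (g≤h′ i j)))

  𝔼-mono : ∀ bs {g h : Outcome → Carrier} → (∀ Z → g Z ≤ h Z) → ∀ Z → 𝔼 bs g Z ≤ 𝔼 bs h Z
  𝔼-mono []       g≤h Z = g≤h Z
  𝔼-mono (b ∷ bs) {g} {h} g≤h Z = outcomeStep-mono b {𝔼 bs g} {𝔼 bs h} Z (𝔼-mono bs g≤h Z) (λ i j → 𝔼-mono bs g≤h (Z [ j ≔ just i ]))

  𝔼-cong : ∀ bs {g h : Outcome → Carrier} → (∀ Z → g Z ≈ h Z) → ∀ Z → 𝔼 bs g Z ≈ 𝔼 bs h Z
  𝔼-cong bs g≈h Z = ≤-antisym (𝔼-mono bs (λ Z → ≤-reflexive (g≈h Z)) Z)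
                               (𝔼-mono bs (λ Z → ≥-reflexive (g≈h Z)) Z)

  𝔼-+ : ∀ bs (g h : Outcome → Carrier) Z → 𝔼 bs (λ Z → g Z + h Z) Z ≈ 𝔼 bs g Z + 𝔼 bs h Z
  𝔼-+ []             g h Z = refl
  𝔼-+ (b@(k , t) ∷ bs) g h Z = begin-equality
    (1# - mass k t) * 𝔼 bs (λ Z → g Z + h Z) Z
      + blockSum k t (λ i j → x i j * 𝔼 bs (λ Z → g Z + h Z) (Z [ j ≔ just i ]))
      ≈⟨ +-cong (trans (*-congˡ (𝔼-+ bs g h Z)) (distribˡ _ _ _))
           (trans (blockSum-cong k t (λ i j → trans (*-congˡ (𝔼-+ bs g h _)) (distribˡ _ _ _)))
                  (blockSum-+ k t _ _)) ⟩
    ((1# - mass k t) * 𝔼 bs g Z + (1# - mass k t) * 𝔼 bs h Z)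
      + (blockSum k t (λ i j → x i j * 𝔼 bs g (Z [ j ≔ just i ]))
      + blockSum k t (λ i j → x i j * 𝔼 bs h (Z [ j ≔ just i ])))
      ≈⟨ solve 4 (λ a b c d → (a :+ b) :+ (c :+ d) := (a :+ c) :+ (b :+ d)) refl _ _ _ _ ⟩
    𝔼 (b ∷ bs) g Z + 𝔼 (b ∷ bs) h Z ∎

  𝔼-0 : ∀ bs Z → 𝔼 bs (λ _ → 0#) Z ≈ 0#
  𝔼-0 []             Z = refl
  𝔼-0 ((k , t) ∷ bs) Z = trans
    (+-cong (trans (*-congˡ (𝔼-0 bs Z)) (zeroʳ _))
            (trans (blockSum-cong k t (λ i j → trans (*-congˡ (𝔼-0 bs (Z [ j ≔ just i ]))) (*-comm (x i j) 0#)))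
                   (trans (sym (*-blockSum k t 0# x)) (zeroˡ _))))
    (+-identityˡ 0#)

  𝔼-∑ : ∀ bs {l} (g : Fin l → Outcome → Carrier) Z → 𝔼 bs (λ Z → sum (λ i → g i Z)) Z ≈ sum (λ i → 𝔼 bs (g i) Z)
  𝔼-∑ bs {zero}  g Z = 𝔼-0 bs Z
  𝔼-∑ bs {suc l} g Z = trans (𝔼-+ bs (g zero) _ Z) (+-congˡ (𝔼-∑ bs (g ∘ suc) Z))

  𝔼-++ : ∀ bs cs (g : Outcome → Carrier) Z → 𝔼 (bs ++ cs) g Z ≡ 𝔼 bs (𝔼 cs g) Z
  𝔼-++ []       cs g Z = ≡.refl
  𝔼-++ (b@(k , t) ∷ bs) cs g Z = ≡.cong₂ (λ a f → (1# - mass k t) * a + f)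
    (𝔼-++ bs cs g Z)
    (sum-cong-≗ {n} (λ j → ≡.cong (λ f → if inB b j then f else 0#)
      (sum-cong-≗ {m} (λ i → ≡.cong (x i j *_) (𝔼-++ bs cs g (Z [ j ≔ just i ]))))))

  -- Only outcomes that agree with Z outside bs have positive weight.
  𝔼-local : ∀ bs {g h : Outcome → Carrier} Z →
    (∀ Y → (∀ j → covered bs j ≡ false → Y j ≡ Z j) → g Y ≈ h Y) → 𝔼 bs g Z ≈ 𝔼 bs h Z
  𝔼-local []       Z g≈h = g≈h Z (λ _ _ → ≡.refl)
  𝔼-local (b ∷ bs) {g} {h} Z g≈h = outcomeStep-cong b {𝔼 bs g} {𝔼 bs h} {Z} {Z}
    (𝔼-local bs Z (λ Y Y∼Z → g≈h Y (λ j j∉ → Y∼Z j (proj₂ (split j j∉)))))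
    (λ i j j∈b → 𝔼-local bs (Z [ j ≔ just i ]) (λ Y Y∼Z → g≈h Y (λ j′ j′∉ → ≡.trans
      (Y∼Z j′ (proj₂ (split j′ j′∉)))
      (minimal Z (λ { ≡.refl → true≢false (≡.trans (≡.sym j∈b) (proj₁ (split j′ j′∉))) })))))
    where
    true≢false : true ≢ false
    true≢false ()
    split : ∀ j → inB b j ∨ covered bs j ≡ false → inB b j ≡ false × covered bs j ≡ false
    split j eq with inB b j
    ... | false = ≡.refl , eq

  -- The weights of the step total 1, so a baseline valid in every case factors out and only the
  -- extra amounts earned by offers remain. All lower bounds by induction on blocks have this shape.
  outcomeStep-≥ : ∀ k t {h : Outcome → Carrier} Z h₀ (d : Fin m → Fin n → Carrier) → h₀ ≤ h Z →
    (∀ i j → inBlock k t j ≡ true → h₀ + d i j ≤ h (Z [ j ≔ just i ])) →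
    h₀ + blockSum k t (λ i j → x i j * d i j) ≤ outcomeStep (k , t) h Z
  outcomeStep-≥ k t {h} Z h₀ d h₀≤h h₀+d≤h = begin
    h₀ + blockSum k t (λ i j → x i j * d i j)
      ≈⟨ solve 3 (λ h q r → h :+ r := (con (+ 1) :- q) :* h :+ (h :* q :+ r)) refl h₀ (mass k t) _ ⟩
    (1# - mass k t) * h₀ + (h₀ * mass k t + blockSum k t (λ i j → x i j * d i j))
      ≈⟨ +-congˡ (trans (+-congʳ (*-blockSum k t h₀ x)) (trans (sym (blockSum-+ k t _ _))
           (blockSum-cong k t (λ i j → trans (+-congʳ (*-comm h₀ _)) (sym (distribˡ _ _ _)))))) ⟩
    (1# - mass k t) * h₀ + blockSum k t (λ i j → x i j * (h₀ + d i j))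
      ≤⟨ +-mono-≤ (*-monoʳ-≤ (x≤y⇒0≤y-x (mass≤1 k t)) h₀≤h)
           (sumWhen-mono (inBlock k t) (λ j j∈b → ∑-mono (λ i → *-monoʳ-≤ (lower i j) (h₀+d≤h i j j∈b)))) ⟩
    outcomeStep (k , t) h Z ∎

  LocalTo : Fin s → (Outcome → Carrier) → Set ℓ₁
  LocalTo k g = ∀ {Y Z} → (∀ j → customer j ≡ k → Y j ≡ Z j) → g Y ≈ g Z

  𝔼-LocalTo : ∀ {k} bs {g} → LocalTo k g → LocalTo k (𝔼 bs g)
  𝔼-LocalTo []       g-local Y∼Z = g-local Y∼Z
  𝔼-LocalTo (b ∷ bs) {g} g-local {Y} {Z} Y∼Z = outcomeStep-cong b {𝔼 bs g} {𝔼 bs g} {Y} {Z}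
    (𝔼-LocalTo bs g-local Y∼Z) (λ i j _ → 𝔼-LocalTo bs g-local (same i j))
    where
    same : ∀ i j j′ → customer j′ ≡ _ → (Y [ j ≔ just i ]) j′ ≡ (Z [ j ≔ just i ]) j′
    same i j j′ j′∈S with j′ ≟ᶠ j
    ... | yes ≡.refl = ≡.trans (updates Y j′) (≡.sym (updates Z j′))
    ... | no  j′≢j   = ≡.trans (minimal Y j′≢j) (≡.trans (Y∼Z j′ j′∈S) (≡.sym (minimal Z j′≢j)))

  -- Blocks of another customer leave the coordinates of `k` alone, and their weights total 1.
  𝔼-skip : ∀ {k k′} → k ≢ k′ → ∀ ts {g} → LocalTo k g → ∀ Z → 𝔼 (List.map (k′ ,_) ts) g Z ≈ g Z
  𝔼-skip k≢k′ []       g-local Z = refl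
  𝔼-skip {k} {k′} k≢k′ (t ∷ ts) {g} g-local Z = begin-equality
    outcomeStep (k′ , t) (𝔼 (List.map (k′ ,_) ts) g) Z
      ≈⟨ outcomeStep-cong (k′ , t) {𝔼 (List.map (k′ ,_) ts) g} {λ _ → g Z} {Z} {Z} (𝔼-skip k≢k′ ts g-local Z)
           (λ i j j∈b → trans (𝔼-skip k≢k′ ts g-local _)
             (g-local (λ j′ j′∈S → minimal Z λ { ≡.refl →
               k≢k′ (≡.trans (≡.sym j′∈S) (≡.cong proj₁ (inB⇒≡ (k′ , t) j∈b))) }))) ⟩
    (1# - mass k′ t) * g Z + blockSum k′ t (λ i j → x i j * g Z)
      ≈⟨ +-congˡ (trans (blockSum-cong k′ t (λ i j → *-comm _ _)) (sym (*-blockSum k′ t (g Z) x))) ⟩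
    (1# - mass k′ t) * g Z + g Z * mass k′ t
      ≈⟨ solve 2 (λ q g → (con (+ 1) :- q) :* g :+ g :* q := g) refl (mass k′ t) (g Z) ⟩
    g Z ∎

  𝔼-skipAll : ∀ {k ks} → All (k ≢_) ks → ∀ ts {g} → LocalTo k g → ∀ Z → 𝔼 (List.cartesianProduct ks ts) g Z ≈ g Z
  𝔼-skipAll All.[] ts g-local Z = refl
  𝔼-skipAll {ks = k′ ∷ ks} (k≢k′ All.∷ k∉ks) ts {g} g-local Z = begin-equality
    𝔼 (List.map (k′ ,_) ts ++ List.cartesianProduct ks ts) g Z
      ≡⟨ 𝔼-++ (List.map (k′ ,_) ts) _ g Z ⟩
    𝔼 (List.map (k′ ,_) ts) (𝔼 (List.cartesianProduct ks ts) g) Z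
      ≈⟨ 𝔼-cong (List.map (k′ ,_) ts) (𝔼-skipAll k∉ks ts g-local) Z ⟩
    𝔼 (List.map (k′ ,_) ts) g Z
      ≈⟨ 𝔼-skip k≢k′ ts g-local Z ⟩
    g Z ∎

  -- `blocks` runs through the customers in its outer loop, so what remains are the blocks of `k` in
  -- slot order, which is the order of the dynamic program.
  𝔼-customer : ∀ {k ks} → Unique ks → k ∈ ks → ∀ ts {g} → LocalTo k g → ∀ Z →
    𝔼 (List.cartesianProduct ks ts) g Z ≈ 𝔼 (List.map (k ,_) ts) g Z
  𝔼-customer {k} {k ∷ ks} (k∉ks ∷ _) (here ≡.refl) ts {g} g-local Z = trans
    (reflexive (𝔼-++ (List.map (k ,_) ts) _ g Z))
    (𝔼-cong (List.map (k ,_) ts) (𝔼-skipAll k∉ks ts g-local) Z)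
  𝔼-customer {k} {k′ ∷ ks} (k′∉ks ∷ unique) (there k∈ks) ts {g} g-local Z = begin-equality
    𝔼 (List.map (k′ ,_) ts ++ List.cartesianProduct ks ts) g Z
      ≡⟨ 𝔼-++ (List.map (k′ ,_) ts) _ g Z ⟩
    𝔼 (List.map (k′ ,_) ts) (𝔼 (List.cartesianProduct ks ts) g) Z
      ≈⟨ 𝔼-skip (λ { ≡.refl → All.lookup k′∉ks k∈ks ≡.refl }) ts
           (𝔼-LocalTo (List.cartesianProduct ks ts) g-local) Z ⟩
    𝔼 (List.cartesianProduct ks ts) g Z
      ≈⟨ 𝔼-customer unique k∈ks ts g-local Z ⟩
    𝔼 (List.map (k ,_) ts) g Z ∎

  -- Demand and the loss caused by budgets

  offers : Maybe (Fin m) → Fin m → Bool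
  offers nothing   i = false
  offers (just i′) i = does (i′ ≟ᶠ i)

  blockSum-single : ∀ k t i (e : Fin n → Carrier) →
    blockSum k t (λ i′ j → x i′ j * (if does (i′ ≟ᶠ i) then e j else 0#)) ≈
    sumWhen (inBlock k t) (λ j → x i j * e j)
  blockSum-single k t i e = sumWhen-cong (inBlock k t) λ j _ → trans
    (∑-single i (λ i′ i′≢i → trans
      (*-congˡ (reflexive (≡.cong (if_then e j else 0#) (dec-false (i′ ≟ᶠ i) i′≢i)))) (zeroʳ _)))
    (*-congˡ (reflexive (≡.cong (if_then e j else 0#) (dec-true (i ≟ᶠ i) ≡.refl))))

  module _ (i : Fin m) where

    -- What advertiser i would spend if budgets and capacities were ignored.
    demand : Outcome → Carrier
    demand Z = sum (λ j → if offers (Z j) i then bid i j else 0#)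

    demand-nonNeg : ∀ Z → 0# ≤ demand Z
    demand-nonNeg Z = sumWhen-nonNeg (λ j → offers (Z j) i) (λ j → bid≥0 i j)

    demand-≔ : ∀ Z i′ j → Z j ≡ nothing →
               demand (Z [ j ≔ just i′ ]) ≈ demand Z + (if does (i′ ≟ᶠ i) then bid i j else 0#)
    demand-≔ Z i′ j Zj = begin-equality
      demand (Z [ j ≔ just i′ ])
        ≈⟨ solve 2 (λ a b → a := b :+ (a :- b)) refl _ (demand Z) ⟩
      demand Z + (demand (Z [ j ≔ just i′ ]) - demand Z)
        ≈⟨ +-congˡ (sym (∑-distrib-- {n} _ _)) ⟩
      demand Z + sum (λ l → (if offers ((Z [ j ≔ just i′ ]) l) i then bid i l else 0#)
                          - (if offers (Z l) i then bid i l else 0#))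
        ≈⟨ +-congˡ (∑-single j (λ l l≢j → trans
             (+-congʳ (reflexive (≡.cong (λ a → if offers a i then bid i l else 0#) (minimal Z l≢j))))
             (-‿inverseʳ _))) ⟩
      demand Z + ((if offers ((Z [ j ≔ just i′ ]) j) i then bid i j else 0#)
                - (if offers (Z j) i then bid i j else 0#))
        ≡⟨ ≡.cong₂ (λ a b → demand Z + ((if offers a i then bid i j else 0#) - (if offers b i then bid i j else 0#)))
             (updates Z j) Zj ⟩
      demand Z + ((if does (i′ ≟ᶠ i) then bid i j else 0#) - 0#)
        ≈⟨ solve 2 (λ a b → a :+ (b :- con (+ 0)) := a :+ b) refl _ _ ⟩
      demand Z + (if does (i′ ≟ᶠ i) then bid i j else 0#) ∎

    demand-zero : demand (λ _ → nothing) ≈ 0#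
    demand-zero = ∑-zero {n} (λ _ → refl)

    lpSpend : Carrier
    lpSpend = sum (λ j → x i j * bid i j)

    -- An upper bound on the expected demand, put in terms of its negative so that `outcomeStep-≥`
    -- applies.
    𝔼-demand≤ : ∀ bs → Unique bs → ∀ Z → OffCovered nothing bs Z →
      - demand Z - sumOver bs (λ b → sumWhen (inB b) (λ j → x i j * bid i j)) ≤ 𝔼 bs (λ Z → - demand Z) Z
    𝔼-demand≤ [] _ Z _ = ≤-reflexive (solve 1 (λ a → a :- con (+ 0) := a) refl _)
    𝔼-demand≤ (b@(k , t) ∷ bs) (b∉bs ∷ unique) Z off = begin
      - demand Z - (sumWhen (inB b) (λ j → x i j * bid i j) + R)
        ≈⟨ solve 3 (λ d v r → :- d :- (v :+ r) := (:- d :- r) :+ (:- con (+ 1)) :* v) refl _ _ R ⟩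
      - demand Z - R + (- 1#) * sumWhen (inB b) (λ j → x i j * bid i j)
        ≈⟨ +-congˡ (trans (*-sumWhen (inB b) _ _) (sumWhen-cong (inB b) (λ j _ →
             solve 2 (λ x u → (:- con (+ 1)) :* (x :* u) := x :* (:- u)) refl _ _))) ⟩
      - demand Z - R + sumWhen (inB b) (λ j → x i j * - bid i j)
        ≈⟨ +-congˡ (sym (blockSum-single k t i (λ j → - bid i j))) ⟩
      - demand Z - R + blockSum k t (λ i′ j → x i′ j * (if does (i′ ≟ᶠ i) then - bid i j else 0#))
        ≤⟨ outcomeStep-≥ k t {𝔼 bs (λ Z → - demand Z)} Z (- demand Z - R) _
             (𝔼-demand≤ bs unique Z (OffCovered-tail {b = b} {bs} off))
             (λ i′ j j∈b → ≤-trans (≤-reflexive (after i′ j (off j (covered-head b bs j∈b))))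
               (𝔼-demand≤ bs unique (Z [ j ≔ just i′ ]) (OffCovered-≔ b∉bs off j j∈b))) ⟩
      𝔼 (b ∷ bs) (λ Z → - demand Z) Z ∎
      where
      R = sumOver bs (λ b → sumWhen (inB b) (λ j → x i j * bid i j))
      if-neg : ∀ p {y} → (if p then - y else 0#) ≈ - (if p then y else 0#)
      if-neg true  = refl
      if-neg false = solve 0 (con (+ 0) := :- con (+ 0)) refl
      after : ∀ i′ j → Z j ≡ nothing →
        - demand Z - R + (if does (i′ ≟ᶠ i) then - bid i j else 0#) ≈ - demand (Z [ j ≔ just i′ ]) - R
      after i′ j Zj = trans (+-congˡ (if-neg (does (i′ ≟ᶠ i)))) (trans
        (solve 3 (λ d r y → :- d :- r :+ :- y := :- (d :+ y) :- r) refl _ _ _)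
        (+-congʳ (-‿cong (sym (demand-≔ Z i′ j Zj)))))

    -- The `a_B` of the product bound. For a zero budget the quotients default to 0, in agreement
    -- with the bids, which then vanish as well.
    share : Block → Carrier
    share b = sumWhen (inB b) (λ j → x i j * (bid i j ÷ budget i))

    bidShare-nonNeg : ∀ j → 0# ≤ bid i j ÷ budget i
    bidShare-nonNeg j = *-nonNegative (bid≥0 i j) (⁻¹-nonNeg (budget≥0 i))

    share-nonNeg : ∀ b → 0# ≤ share b
    share-nonNeg b = sumWhen-nonNeg (inB b) (λ j → *-nonNegative (lower i j) (bidShare-nonNeg j))

    lpSpend-nonNeg : 0# ≤ lpSpend
    lpSpend-nonNeg = ∑-nonNeg (λ j → *-nonNegative (lower i j) (bid≥0 i j))

    ∑share : sumOver blocks share ≈ lpSpend ÷ budget i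
    ∑share = trans (sumOver-blocks _) (trans (∑-cong {n} (λ j → sym (*-assoc _ _ _)))
      (sym (*-distribʳ-sum {n} (budget i ⁻¹) (λ j → x i j * bid i j))))

    -- A further bid either uses up the budget or lowers the slack by `v`, which is at least the
    -- fraction `v ÷ budget i` of it because the slack is at most the budget. `v ≤ budget i` keeps
    -- the contraction factor nonnegative.
    slack-decay : ∀ {w v} → 0# ≤ w → 0# ≤ v → v ≤ budget i →
      budget i - min (w + v) (budget i) ≤
      (budget i - min w (budget i)) * (1# - v ÷ budget i)
    slack-decay {w} {v} 0≤w 0≤v v≤b = [ within , beyond ]′ (≤-total (w + v) (budget i))
      where
      Decay = budget i - min (w + v) (budget i) ≤ (budget i - min w (budget i)) * (1# - v ÷ budget i)
      beyond : budget i ≤ w + v → Decay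
      beyond b≤w+v = begin
        budget i - min (w + v) (budget i)
          ≈⟨ trans (+-congˡ (-‿cong (y≤x⇒min≈y b≤w+v))) (-‿inverseʳ _) ⟩
        0#
          ≤⟨ *-nonNegative (x≤y⇒0≤y-x (min≤y w _)) (x≤y⇒0≤y-x (y÷x≤1 0≤v v≤b)) ⟩
        (budget i - min w (budget i)) * (1# - v ÷ budget i) ∎
      within : w + v ≤ budget i → Decay
      within w+v≤b = begin
        budget i - min (w + v) (budget i)
          ≈⟨ +-congˡ (-‿cong (x≤y⇒min≈x w+v≤b)) ⟩
        budget i - (w + v)
          ≤⟨ ≤-by (w * (v ÷ budget i)) (*-nonNegative 0≤w (*-nonNegative 0≤v (⁻¹-nonNeg (budget≥0 i)))) (begin-equality
               budget i - (w + v) + w * (v ÷ budget i)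
                 ≈⟨ +-congʳ (+-congˡ (-‿cong (+-congˡ (sym (x*[y÷x]≈y 0≤v v≤b))))) ⟩
               budget i - (w + budget i * (v ÷ budget i)) + w * (v ÷ budget i)
                 ≈⟨ solve 3 (λ b w a → b :- (w :+ b :* a) :+ w :* a := (b :- w) :* (con (+ 1) :- a)) refl _ _ _ ⟩
               (budget i - w) * (1# - v ÷ budget i) ∎) ⟩
        (budget i - w) * (1# - v ÷ budget i)
          ≈⟨ *-congʳ (+-congˡ (-‿cong (sym (x≤y⇒min≈x w≤b)))) ⟩
        (budget i - min w (budget i)) * (1# - v ÷ budget i) ∎
        where
        w≤b : w ≤ budget i
        w≤b = ≤-trans (≤-by v 0≤v refl) w+v≤b

    cappedDemand : Outcome → Carrier
    cappedDemand Z = min (demand Z) (budget i)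

    -- The slack shrinks in expectation by the factor `1# - share b` at each block, and the factors
    -- multiply. The statement starts from the slack at an arbitrary `Z` because the induction
    -- continues after an offer has been made.
    𝔼-cappedDemand≥ : ∀ bs → Unique bs → sumOver bs share ≤ 1# → ∀ Z → OffCovered nothing bs Z →
      budget i - (budget i - cappedDemand Z) * productOver bs (λ b → 1# - share b) ≤ 𝔼 bs cappedDemand Z
    𝔼-cappedDemand≥ [] _ _ Z _ = ≤-reflexive
      (solve 2 (λ b y → b :- (b :- y) :* con (+ 1) := y) refl (budget i) (cappedDemand Z))
    𝔼-cappedDemand≥ (b@(k , t) ∷ bs) (b∉bs ∷ unique) ∑≤1 Z off = begin
      budget i - r * ((1# - share b) * P)
        -- `h₀` is the bound if the block offers nothing to advertiser `i`; the other summand is the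
        -- improvement, to be distributed over the possible offers.
        ≈⟨ solve 4 (λ b r v P → b :- r :* ((con (+ 1) :- v) :* P) := (b :- r :* P) :+ r :* P :* v) refl _ _ (share b) _ ⟩
      h₀ + r * P * share b
        ≈⟨ +-congˡ (trans (*-sumWhen (inB b) _ _) (sumWhen-cong (inB b) (λ j _ →
             solve 3 (λ q x a → q :* (x :* a) := x :* (q :* a)) refl _ _ _))) ⟩
      h₀ + sumWhen (inB b) (λ j → x i j * (r * P * (bid i j ÷ budget i)))
        ≈⟨ +-congˡ (sym (blockSum-single k t i (λ j → r * P * (bid i j ÷ budget i)))) ⟩
      h₀ + blockSum k t (λ i′ j → x i′ j * (if does (i′ ≟ᶠ i) then r * P * (bid i j ÷ budget i) else 0#))
        ≤⟨ outcomeStep-≥ k t {𝔼 bs cappedDemand} Z h₀ _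
             (𝔼-cappedDemand≥ bs unique ∑≤1′ Z (OffCovered-tail {b = b} {bs} off))
             (λ i′ j j∈b → ≤-trans (after i′ j (off j (covered-head b bs j∈b)))
               (𝔼-cappedDemand≥ bs unique ∑≤1′ (Z [ j ≔ just i′ ]) (OffCovered-≔ b∉bs off j j∈b))) ⟩
      𝔼 (b ∷ bs) cappedDemand Z ∎
      where
      P = productOver bs (λ b → 1# - share b)
      r = budget i - cappedDemand Z
      h₀ = budget i - r * P
      ∑≤1′ = tail≤1 bs share-nonNeg ∑≤1
      after : ∀ i′ j → Z j ≡ nothing →
        h₀ + (if does (i′ ≟ᶠ i) then r * P * (bid i j ÷ budget i) else 0#) ≤
        budget i - (budget i - cappedDemand (Z [ j ≔ just i′ ])) * P
      after i′ j Zj with does (i′ ≟ᶠ i) | demand-≔ Z i′ j Zj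
      ... | false | eq = ≤-reflexive (trans (+-identityʳ _)
        (+-congˡ (-‿cong (*-congʳ (+-congˡ (-‿cong (min-cong (sym (trans eq (+-identityʳ _))) refl)))))))
      ... | true | eq = begin
        budget i - r * P + r * P * (bid i j ÷ budget i)
          ≈⟨ solve 4 (λ b r P a → b :- r :* P :+ r :* P :* a := b :- r :* (con (+ 1) :- a) :* P) refl _ _ _ _ ⟩
        budget i - r * (1# - bid i j ÷ budget i) * P
          ≤⟨ -‿mono-≤ ≤-refl (*-monoˡ-≤ (∏[1-v]-nonNeg share-nonNeg bs ∑≤1′)
               (slack-decay (demand-nonNeg Z) (bid≥0 i j) (bid≤budget i j))) ⟩
        budget i - (budget i - min (demand Z + bid i j) (budget i)) * P
          ≈⟨ +-congˡ (-‿cong (*-congʳ (+-congˡ (-‿cong (min-cong (sym eq) refl))))) ⟩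
        budget i - (budget i - cappedDemand (Z [ j ≔ just i′ ])) * P ∎

    -- The budget constraint of the linear program is what makes the shares total at most 1, and at
    -- the blank outcome the slack is the whole budget.
    𝔼-cappedDemand : ∀ {e} → IsEuler e → (1# - e ⁻¹) * lpSpend ≤ 𝔼 blocks cappedDemand (λ _ → nothing)
    𝔼-cappedDemand {e} e-Euler = begin
      (1# - e ⁻¹) * lpSpend
        ≈⟨ *-congˡ (sym (x*[y÷x]≈y lpSpend-nonNeg (perAdvertiser i))) ⟩
      (1# - e ⁻¹) * (budget i * (lpSpend ÷ budget i))
        ≈⟨ solve 3 (λ f b v → (con (+ 1) :- f) :* (b :* v) := b :- b :* (con (+ 1) :- (con (+ 1) :- f) :* v)) refl (e ⁻¹) _ _ ⟩
      budget i - budget i * (1# - (1# - e ⁻¹) * (lpSpend ÷ budget i))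
        ≈⟨ +-congˡ (-‿cong (*-congˡ (+-congˡ (-‿cong (*-congˡ (sym ∑share)))))) ⟩
      budget i - budget i * (1# - (1# - e ⁻¹) * sumOver blocks share)
        ≤⟨ -‿mono-≤ ≤-refl (*-monoʳ-≤ (budget≥0 i) (∏[1-v]≤1-[1-e⁻¹]∑v e-Euler share-nonNeg blocks ∑≤1)) ⟩
      budget i - budget i * productOver blocks (λ b → 1# - share b)
        ≈⟨ +-congˡ (-‿cong (*-congʳ (trans (solve 1 (λ b → b := b :- con (+ 0)) refl _)
             (+-congˡ (-‿cong (sym (trans (x≤y⇒min≈x (≤-trans (≤-reflexive demand-zero) (budget≥0 i))) demand-zero))))))) ⟩
      budget i - (budget i - cappedDemand (λ _ → nothing)) * productOver blocks (λ b → 1# - share b)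
        ≤⟨ 𝔼-cappedDemand≥ blocks blocks-unique ∑≤1 (λ _ → nothing) (λ _ _ → ≡.refl) ⟩
      𝔼 blocks cappedDemand (λ _ → nothing) ∎
      where
      ∑≤1 : sumOver blocks share ≤ 1#
      ∑≤1 = ≤-trans (≤-reflexive ∑share) (y÷x≤1 lpSpend-nonNeg (perAdvertiser i))

    𝔼-demand : - lpSpend ≤ 𝔼 blocks (λ Z → - demand Z) (λ _ → nothing)
    𝔼-demand = ≤-trans
      (≤-reflexive (trans (solve 1 (λ v → :- v := :- con (+ 0) :- v) refl lpSpend)
        (+-cong (-‿cong (sym demand-zero)) (-‿cong (sym (sumOver-blocks _))))))
      (𝔼-demand≤ blocks blocks-unique (λ _ → nothing) (λ _ _ → ≡.refl))

-- Algorithm C as a function of the outcome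

module SumUpdate {a ℓ : Level} (M : CommutativeMonoid a ℓ) where
  open CommutativeMonoid M
  open MonoidSum M using (sum; sum-cong-≋)
  open SemigroupProperties commutativeSemigroup using (xy∙z≈xz∙y)

  -- Stated over a commutative monoid so as to serve both loads, counted in `ℕ`, and gains, valued
  -- in the field.
  sum-update : ∀ {n} {f g : Fin n → Carrier} {d} j → g j ≈ f j ∙ d → (∀ i → i ≢ j → g i ≈ f i) →
               sum g ≈ sum f ∙ d
  sum-update zero gj≈ g≈f = trans (∙-cong gj≈ (sum-cong-≋ (λ i → g≈f (suc i) λ ()))) (xy∙z≈xz∙y _ _ _)
  sum-update (suc j) gj≈ g≈f = trans
    (∙-cong (g≈f zero λ ()) (sum-update j gj≈ (λ i i≢j → g≈f (suc i) λ { ≡.refl → i≢j ≡.refl })))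
    (sym (assoc _ _ _))

module Analysis {c ℓ₁ ℓ₂ : Level} (F : OrderedField c ℓ₁ ℓ₂)
  (M : AdCell.Market F) (x : AdCell.FractionalAllocation F M) (x-feasible : AdCell.LPFeasible F M x) where

  open FieldProperties F
  open FunctionSums F
  open FractionalMatching F M x x-feasible
  open Outcomes F M x x-feasible
  open OutcomeExpectation F M x x-feasible
  open AdCell F
  open Market M
  open AlgorithmC M x using (accepts; allocate; remaining; offer; runFrom; expectedRevenue)
  private
    module ℕSum = MonoidSum ℕₚ.+-0-commutativeMonoid
    module ℕUpdate = SumUpdate ℕₚ.+-0-commutativeMonoid
    module FUpdate = SumUpdate (Semiring.+-commutativeMonoid semiring)
  open ℕSum using () renaming (sum to sumℕ)
  open ≤-Reasoning poset

  slotQueries : Fin u → List (Fin n)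
  slotQueries t = List.filterᵇ (λ j → does (slot j ≟ᶠ t)) (allFin n)

  offerAll : List (Fin u) → Outcome → Allocation M → List (Fin n) → Allocation M
  offerAll ts Z = foldl (λ Y j → offer ts j (Z j) Y)

  -- Every query of a slot is presented; one that did not arrive carries `nothing` and has no
  -- effect. This removes the arrivals from the list that is traversed.
  runOn : List (Fin u) → Outcome → Allocation M → Allocation M
  runOn []       Z X = X
  runOn (t ∷ ts) Z X = runOn ts Z (offerAll ts Z X (slotQueries t))

  offerAll-effective : ∀ ts I A (p : Fin n → Bool) js X →
    foldl (λ Y j → offer ts j (A j) Y) X (List.filterᵇ (λ j → p j ∧ I j) js) ≡
    offerAll ts (effective I A) X (List.filterᵇ p js)
  offerAll-effective ts I A p []       X = ≡.refl
  offerAll-effective ts I A p (j ∷ js) X with p j | I j in Ij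
  ... | false | _     = offerAll-effective ts I A p js X
  ... | true  | true  rewrite Ij = offerAll-effective ts I A p js _
  ... | true  | false rewrite Ij = offerAll-effective ts I A p js X

  runFrom≡runOn : ∀ ts I A X → runFrom ts I A X ≡ runOn ts (effective I A) X
  runFrom≡runOn []       I A X = ≡.refl
  runFrom≡runOn (t ∷ ts) I A X
    rewrite offerAll-effective ts I A (λ j → does (slot j ≟ᶠ t)) (allFin n) X = runFrom≡runOn ts I A _

  offerAll-cong : ∀ ts {Y Z} X js → (∀ j → j ∈ js → Y j ≡ Z j) → offerAll ts Y X js ≡ offerAll ts Z X js
  offerAll-cong ts X []       Y≗Z = ≡.refl
  offerAll-cong ts X (j ∷ js) Y≗Z rewrite Y≗Z j (here ≡.refl) = offerAll-cong ts _ js (λ i i∈ → Y≗Z i (there i∈))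

  runOn-cong : ∀ ts {Y Z} X → (∀ j → Y j ≡ Z j) → runOn ts Y X ≡ runOn ts Z X
  runOn-cong []       X Y≗Z = ≡.refl
  runOn-cong (t ∷ ts) {Y} {Z} X Y≗Z
    rewrite offerAll-cong ts {Y} {Z} X (slotQueries t) (λ j _ → Y≗Z j) = runOn-cong ts _ Y≗Z

  empty : Allocation M
  empty _ _ = false

  final : Outcome → Allocation M
  final Z = runOn (allFin u) Z empty

  expectedRevenue≈𝔼 : expectedRevenue ≈ 𝔼 blocks (λ Z → revenue M (final Z)) (λ _ → nothing)
  expectedRevenue≈𝔼 = trans
    (trans (𝔼-arrivals≈sumOnMask _)
      (trans (sumOnMask-cong (covered blocks) _ (λ I _ → *-congˡ (sumFunctions-cong n (λ A → *-congˡ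
               (reflexive (≡.cong (revenue M) (runFrom≡runOn (allFin u) I A empty)))))))
             (sym (𝔼-arrivals≈sumOnMask _))))
    (expectation≈𝔼 (λ Y≗Z → reflexive (≡.cong (revenue M) (runOn-cong (allFin u) empty Y≗Z))))

  allocate-same : ∀ i j X → allocate i j X i j ≡ true
  allocate-same i j X = ≡.trans (≡.cong (λ row → row j) (Vectorₚ.updateAt-updates i X)) (updates (X i) j)

  allocate-otherColumn : ∀ i j X {i′ j′} → j′ ≢ j → allocate i j X i′ j′ ≡ X i′ j′
  allocate-otherColumn i j X {i′} {j′} j′≢j with i′ ≟ᶠ i
  ... | yes ≡.refl = ≡.trans (≡.cong (λ row → row j′) (Vectorₚ.updateAt-updates i′ X)) (minimal (X i′) j′≢j)
  ... | no  i′≢i   = ≡.cong (λ row → row j′) (Vectorₚ.updateAt-minimal i′ i X i′≢i)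

  allocate-otherRow : ∀ i j X {i′ j′} → i′ ≢ i → allocate i j X i′ j′ ≡ X i′ j′
  allocate-otherRow i j X {i′} {j′} i′≢i = ≡.cong (λ row → row j′) (Vectorₚ.updateAt-minimal i′ i X i′≢i)

  offer-otherColumn : ∀ ts j a X {i′ j′} → j′ ≢ j → offer ts j a X i′ j′ ≡ X i′ j′
  offer-otherColumn ts j nothing  X j′≢j = ≡.refl
  offer-otherColumn ts j (just i) X j′≢j with accepts ts i j (remaining X (customer j))
  ... | true  = allocate-otherColumn i j X j′≢j
  ... | false = ≡.refl

  offerAll-otherColumn : ∀ ts Z X js {i′ j′} → j′ ∉ js → offerAll ts Z X js i′ j′ ≡ X i′ j′
  offerAll-otherColumn ts Z X []       j′∉ = ≡.refl
  offerAll-otherColumn ts Z X (j ∷ js) j′∉ = ≡.trans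
    (offerAll-otherColumn ts Z _ js (j′∉ ∘ there))
    (offer-otherColumn ts j (Z j) X (λ { ≡.refl → j′∉ (here ≡.refl) }))

  -- The invariant that bounds payments by demand, whatever the acceptance test decides.
  Serves : Outcome → Allocation M → Set
  Serves Z X = ∀ i j → X i j ≡ true → Z j ≡ just i

  offer-serves : ∀ ts j Z X → Serves Z X → Serves Z (offer ts j (Z j) X)
  offer-serves ts j Z X serves i′ j′ with Z j in Zj
  ... | nothing = serves i′ j′
  ... | just i with accepts ts i j (remaining X (customer j))
  ...   | false = serves i′ j′
  ...   | true with i′ ≟ᶠ i | j′ ≟ᶠ j
  ...     | yes ≡.refl | yes ≡.refl = λ _ → Zj
  ...     | no i′≢i    | _          = λ eq → serves i′ j′ (≡.trans (≡.sym (allocate-otherRow i j X i′≢i)) eq)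
  ...     | yes _      | no j′≢j    = λ eq → serves i′ j′ (≡.trans (≡.sym (allocate-otherColumn i j X j′≢j)) eq)

  offerAll-serves : ∀ ts Z X js → Serves Z X → Serves Z (offerAll ts Z X js)
  offerAll-serves ts Z X []       serves = serves
  offerAll-serves ts Z X (j ∷ js) serves = offerAll-serves ts Z _ js (offer-serves ts j Z X serves)

  runOn-serves : ∀ ts Z X → Serves Z X → Serves Z (runOn ts Z X)
  runOn-serves []       Z X serves = serves
  runOn-serves (t ∷ ts) Z X serves = runOn-serves ts Z _ (offerAll-serves ts Z X (slotQueries t) serves)

  paid : Allocation M → Fin m → Carrier
  paid X i = sum (λ j → if X i j then bid i j else 0#)

  paid≤demand : ∀ {Z X} → Serves Z X → ∀ i → paid X i ≤ demand i Z
  paid≤demand {Z} {X} serves i = ∑-mono {n} term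
    where
    term : ∀ j → (if X i j then bid i j else 0#) ≤ (if offers (Z j) i then bid i j else 0#)
    term j with X i j in Xij
    ... | false = if-nonNeg (offers (Z j) i) (bid≥0 i j)
    ... | true rewrite serves i j Xij | dec-true (i ≟ᶠ i) ≡.refl = ≤-refl

  -- Capping at `b` costs `p` its excess over `b`, which is at most the excess of the larger `d`.
  -- This is what frees the budget loss from the acceptance decisions.
  capped-≥ : ∀ {p d b} → p ≤ d → p + (- d + min d b) ≤ min p b
  capped-≥ {p} {d} {b} p≤d = min-glb
    (≤-trans (+-monoʳ-≤ p (+-monoʳ-≤ (- d) (min≤x d b)))
             (≤-reflexive (solve 2 (λ p d → p :+ (:- d :+ d) := p) refl p d)))
    (≤-trans (≤-by (d - p) (x≤y⇒0≤y-x p≤d) (solve 3 (λ p d c → p :+ (:- d :+ c) :+ (d :- p) := c) refl p d _))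
             (min≤y d b))

  gain : Fin s → Allocation M → Carrier
  gain k X = sumWhen (inCustomer k) (λ j → sum (λ i → if X i j then bid i j else 0#))

  ∑paid≈∑gain : ∀ X → sum (paid X) ≈ sum (λ k → gain k X)
  ∑paid≈∑gain X = trans (∑-comm {m} {n} _) (sym (∑-customers _))

  -- The first sum carries the capacity analysis, the second the budget analysis; both may be
  -- averaged separately.
  revenue≥ : ∀ Z → sum (λ k → gain k (final Z)) + sum (λ i → - demand i Z + cappedDemand i Z) ≤ revenue M (final Z)
  revenue≥ Z = begin
    sum (λ k → gain k (final Z)) + sum (λ i → - demand i Z + cappedDemand i Z)
      ≈⟨ +-congʳ (sym (∑paid≈∑gain (final Z))) ⟩
    sum (paid (final Z)) + sum (λ i → - demand i Z + cappedDemand i Z)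
      ≈⟨ sym (∑-distrib-+ {m} _ _) ⟩
    sum (λ i → paid (final Z) i + (- demand i Z + cappedDemand i Z))
      ≤⟨ ∑-mono {m} (λ i → capped-≥ (paid≤demand {Z} {final Z} (runOn-serves (allFin u) Z empty (λ _ _ ())) i)) ⟩
    revenue M (final Z) ∎

  module _ (k : Fin s) where

    infix 4 _∼_

    _∼_ : Allocation M → Allocation M → Set
    X ∼ Y = ∀ i j → customer j ≡ k → X i j ≡ Y i j

    load-∼ : ∀ {X Y} → X ∼ Y → load M X k ≡ load M Y k
    load-∼ {X} {Y} X∼Y = ℕSum.sum-cong-≗ {n} term
      where
      term : ∀ j → (if inCustomer k j then sumℕ (λ i → ⟦ X i j ⟧) else 0) ≡
                   (if inCustomer k j then sumℕ (λ i → ⟦ Y i j ⟧) else 0)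
      term j with customer j ≟ᶠ k
      ... | yes j∈S = ℕSum.sum-cong-≗ {m} (λ i → ≡.cong ⟦_⟧ (X∼Y i j j∈S))
      ... | no  _   = ≡.refl

    gain-∼ : ∀ {X Y} → X ∼ Y → gain k X ≈ gain k Y
    gain-∼ {X} {Y} X∼Y = ∑-cong {n} term
      where
      term : ∀ j → (if inCustomer k j then sum (λ i → if X i j then bid i j else 0#) else 0#) ≈
                   (if inCustomer k j then sum (λ i → if Y i j then bid i j else 0#) else 0#)
      term j with customer j ≟ᶠ k
      ... | yes j∈S = ∑-cong {m} (λ i → reflexive (≡.cong (if_then bid i j else 0#) (X∼Y i j j∈S)))
      ... | no  _   = refl

    allocate-∼ : ∀ i j {X Y} → X ∼ Y → allocate i j X ∼ allocate i j Y
    allocate-∼ i j {X} {Y} X∼Y i′ j′ j′∈S with i′ ≟ᶠ i | j′ ≟ᶠ j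
    ... | yes ≡.refl | yes ≡.refl = ≡.trans (allocate-same i j X) (≡.sym (allocate-same i j Y))
    ... | no i′≢i    | _          = ≡.trans (allocate-otherRow i j X i′≢i)
      (≡.trans (X∼Y i′ j′ j′∈S) (≡.sym (allocate-otherRow i j Y i′≢i)))
    ... | yes _      | no j′≢j    = ≡.trans (allocate-otherColumn i j X j′≢j)
      (≡.trans (X∼Y i′ j′ j′∈S) (≡.sym (allocate-otherColumn i j Y j′≢j)))

    -- The test for a query of `k` reads the allocation only through the load of `k`, and queries of
    -- other customers write into other columns.
    offer-∼ : ∀ ts j {a b X Y} → (customer j ≡ k → a ≡ b) → X ∼ Y → offer ts j a X ∼ offer ts j b Y
    offer-∼ ts j {a} {b} {X} {Y} a≡b X∼Y with customer j ≟ᶠ k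
    ... | no j∉S = λ i′ j′ j′∈S → ≡.trans
      (offer-otherColumn ts j a X (λ { ≡.refl → j∉S j′∈S }))
      (≡.trans (X∼Y i′ j′ j′∈S) (≡.sym (offer-otherColumn ts j b Y (λ { ≡.refl → j∉S j′∈S }))))
    ... | yes j∈S with a | a≡b j∈S
    ...   | nothing | ≡.refl = X∼Y
    ...   | just i  | ≡.refl rewrite j∈S | load-∼ X∼Y with accepts ts i j (capacity k ∸ load M Y k)
    ...     | true  = allocate-∼ i j X∼Y
    ...     | false = X∼Y

    offerAll-∼ : ∀ ts {Z Z′} → (∀ j → customer j ≡ k → Z j ≡ Z′ j) → ∀ js {X Y} → X ∼ Y →
                 offerAll ts Z X js ∼ offerAll ts Z′ Y js
    offerAll-∼ ts Z∼Z′ []       X∼Y = X∼Y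
    offerAll-∼ ts {Z} {Z′} Z∼Z′ (j ∷ js) {X} {Y} X∼Y =
      offerAll-∼ ts Z∼Z′ js {offer ts j (Z j) X} {offer ts j (Z′ j) Y} (offer-∼ ts j {Z j} {Z′ j} {X} {Y} (Z∼Z′ j) X∼Y)

    runOn-∼ : ∀ ts {Z Z′} → (∀ j → customer j ≡ k → Z j ≡ Z′ j) → ∀ {X Y} → X ∼ Y →
              runOn ts Z X ∼ runOn ts Z′ Y
    runOn-∼ []       Z∼Z′ X∼Y = X∼Y
    runOn-∼ (t ∷ ts) {Z} {Z′} Z∼Z′ {X} {Y} X∼Y =
      runOn-∼ ts Z∼Z′ {offerAll ts Z X (slotQueries t)} {offerAll ts Z′ Y (slotQueries t)}
        (offerAll-∼ ts Z∼Z′ (slotQueries t) {X} {Y} X∼Y)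

    gain-local : LocalTo k (λ Z → gain k (final Z))
    gain-local {Y} {Z} Y∼Z = gain-∼ {final Y} {final Z} (runOn-∼ (allFin u) Y∼Z {empty} {empty} (λ _ _ _ → ≡.refl))

    module _ {i : Fin m} {j : Fin n} {X : Allocation M} (j∈S : customer j ≡ k) (fresh : X i j ≡ false) where

      private
        inS : inCustomer k j ≡ true
        inS = dec-true (customer j ≟ᶠ k) j∈S

      load-allocate : load M (allocate i j X) k ≡ load M X k ℕ.+ 1
      load-allocate = ℕUpdate.sum-update {n} j column otherColumn
        where
        entry : ⟦ allocate i j X i j ⟧ ≡ ⟦ X i j ⟧ ℕ.+ 1
        entry rewrite allocate-same i j X | fresh = ≡.refl
        column : (if inCustomer k j then sumℕ (λ i′ → ⟦ allocate i j X i′ j ⟧) else 0) ≡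
                 (if inCustomer k j then sumℕ (λ i′ → ⟦ X i′ j ⟧) else 0) ℕ.+ 1
        column rewrite inS = ℕUpdate.sum-update {m} i entry (λ i′ i′≢i → ≡.cong ⟦_⟧ (allocate-otherRow i j X i′≢i))
        otherColumn : ∀ j′ → j′ ≢ j →
          (if inCustomer k j′ then sumℕ (λ i′ → ⟦ allocate i j X i′ j′ ⟧) else 0) ≡
          (if inCustomer k j′ then sumℕ (λ i′ → ⟦ X i′ j′ ⟧) else 0)
        otherColumn j′ j′≢j = ≡.cong (if inCustomer k j′ then_else 0)
          (ℕSum.sum-cong-≗ {m} (λ i′ → ≡.cong ⟦_⟧ (allocate-otherColumn i j X j′≢j)))

      remaining-allocate : remaining (allocate i j X) k ≡ remaining X k ∸ 1
      remaining-allocate rewrite load-allocate = ≡.sym (ℕₚ.∸-+-assoc (capacity k) (load M X k) 1)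

      gain-allocate : gain k (allocate i j X) ≈ gain k X + bid i j
      gain-allocate = FUpdate.sum-update {n} j column otherColumn
        where
        entry : (if allocate i j X i j then bid i j else 0#) ≈ (if X i j then bid i j else 0#) + bid i j
        entry rewrite allocate-same i j X | fresh = sym (+-identityˡ _)
        column : (if inCustomer k j then sum (λ i′ → if allocate i j X i′ j then bid i′ j else 0#) else 0#) ≈
                 (if inCustomer k j then sum (λ i′ → if X i′ j then bid i′ j else 0#) else 0#) + bid i j
        column rewrite inS = FUpdate.sum-update {m} i entry (λ i′ i′≢i →
          reflexive (≡.cong (if_then bid i′ j else 0#) (allocate-otherRow i j X i′≢i)))
        otherColumn : ∀ j′ → j′ ≢ j →
          (if inCustomer k j′ then sum (λ i′ → if allocate i j X i′ j′ then bid i′ j′ else 0#) else 0#) ≈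
          (if inCustomer k j′ then sum (λ i′ → if X i′ j′ then bid i′ j′ else 0#) else 0#)
        otherColumn j′ j′≢j = if-cong (inCustomer k j′) (λ _ → ∑-cong {m} (λ i′ →
          reflexive (≡.cong (if_then bid i′ j′ else 0#) (allocate-otherColumn i j X j′≢j))))

    -- It does not decrease in expectation from slot to slot. It starts at least at the value `E` of
    -- the full capacity and ends as the gain of the run.
    potential : List (Fin u) → Allocation M → Carrier
    potential ts X = gain k X + E k ts (remaining X k)

    -- What an offer is worth compared with its rejection; without capacity every offer is rejected.
    advantage : List (Fin u) → ℕ → Fin m → Fin n → Carrier
    advantage ts zero    i j = 0#
    advantage ts (suc r) i j = max (bid i j + E k ts r) (E k ts (suc r)) - E k ts (suc r)

    -- The acceptance test selects the larger argument of the `max`. Freshness of the entry ensures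
    -- that acceptance uses one unit and earns the full bid.
    potential-offer : ∀ ts i j X → customer j ≡ k → X i j ≡ false →
      potential ts X + advantage ts (remaining X k) i j ≤ potential ts (offer ts j (just i) X)
    potential-offer ts i j X ≡.refl fresh with remaining X k in rem
    ... | zero  = ≤-reflexive (trans (+-identityʳ _) (+-congˡ (reflexive (≡.cong (E k ts) (≡.sym rem)))))
    ... | suc r with E k ts (suc r) ≤? (bid i j + E k ts r)
    ...   | yes accepted = begin
      gain k X + E k ts (suc r) + (max (bid i j + E k ts r) (E k ts (suc r)) - E k ts (suc r))
        ≤⟨ +-monoʳ-≤ _ (+-monoˡ-≤ _ (max-lub ≤-refl accepted)) ⟩
      gain k X + E k ts (suc r) + (bid i j + E k ts r - E k ts (suc r))
        ≈⟨ solve 4 (λ g e b e′ → g :+ e :+ (b :+ e′ :- e) := g :+ b :+ e′) refl _ _ _ _ ⟩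
      gain k X + bid i j + E k ts r
        ≈⟨ +-cong (sym (gain-allocate {i} {j} {X} ≡.refl fresh))
             (reflexive (≡.cong (E k ts) (≡.sym (≡.trans (remaining-allocate {i} {j} {X} ≡.refl fresh) (≡.cong (_∸ 1) rem))))) ⟩
      gain k (allocate i j X) + E k ts (remaining (allocate i j X) k) ∎
    ...   | no rejected = begin
      gain k X + E k ts (suc r) + (max (bid i j + E k ts r) (E k ts (suc r)) - E k ts (suc r))
        ≤⟨ +-monoʳ-≤ _ (+-monoˡ-≤ _ (max-lub (≰⇒≥ rejected) ≤-refl)) ⟩
      gain k X + E k ts (suc r) + (E k ts (suc r) - E k ts (suc r))
        ≈⟨ solve 2 (λ g e → g :+ e :+ (e :- e) := g :+ e) refl _ _ ⟩
      gain k X + E k ts (suc r)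
        ≡⟨ ≡.cong (λ r → gain k X + E k ts r) (≡.sym rem) ⟩
      gain k X + E k ts (remaining X k) ∎

    -- The recursion rewritten as baseline plus expected advantage, the shape required by
    -- `outcomeStep-≥`, and covering zero capacity as well.
    E-advantage : ∀ t ts r → E k (t ∷ ts) r ≈ E k ts r + blockSum k t (λ i j → x i j * advantage ts r i j)
    E-advantage t ts zero = begin-equality
      0#
        ≈⟨ trans (sym (zeroˡ _)) (*-blockSum k t 0# x) ⟩
      blockSum k t (λ i j → 0# * x i j)
        ≈⟨ blockSum-cong k t (λ i j → *-comm _ _) ⟩
      blockSum k t (λ i j → x i j * 0#)
        ≈⟨ sym (+-identityˡ _) ⟩
      0# + blockSum k t (λ i j → x i j * 0#)
        ≡⟨ ≡.cong (_+ blockSum k t (λ i j → x i j * 0#)) (≡.sym (E-zero k ts)) ⟩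
      E k ts 0 + blockSum k t (λ i j → x i j * 0#) ∎
    E-advantage t ts (suc r) = begin-equality
      blockSum k t (λ i j → x i j * max (bid i j + E k ts r) e) + (1# - mass k t) * e
        ≈⟨ +-congʳ (blockSum-cong k t (λ i j → solve 3 (λ x y e → x :* y := e :* x :+ x :* (y :- e)) refl _ _ e)) ⟩
      blockSum k t (λ i j → e * x i j + x i j * advantage ts (suc r) i j) + (1# - mass k t) * e
        ≈⟨ +-congʳ (trans (blockSum-+ k t _ _) (+-congʳ (sym (*-blockSum k t e x)))) ⟩
      e * mass k t + blockSum k t (λ i j → x i j * advantage ts (suc r) i j) + (1# - mass k t) * e
        ≈⟨ solve 3 (λ e q b → e :* q :+ b :+ (con (+ 1) :- q) :* e := e :+ b) refl e (mass k t) _ ⟩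
      e + blockSum k t (λ i j → x i j * advantage ts (suc r) i j) ∎
      where
      e = E k ts (suc r)

    offerAll-nothing : ∀ ts Z X js → (∀ j → j ∈ js → Z j ≡ nothing) → offerAll ts Z X js ≡ X
    offerAll-nothing ts Z X []       off = ≡.refl
    offerAll-nothing ts Z X (j ∷ js) off rewrite off j (here ≡.refl) =
      offerAll-nothing ts Z X js (λ i i∈ → off i (there i∈))

    offerAll-single : ∀ ts Z X {js j} → Unique js → j ∈ js → (∀ i → i ∈ js → i ≢ j → Z i ≡ nothing) →
                      offerAll ts Z X js ≡ offer ts j (Z j) X
    offerAll-single ts Z X {j ∷ js} (j∉js ∷ _) (here ≡.refl) off =
      offerAll-nothing ts Z _ js (λ i i∈ → off i (there i∈) (λ { ≡.refl → All.lookup j∉js i∈ ≡.refl }))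
    offerAll-single ts Z X {j′ ∷ js} (j′∉js ∷ unique) (there j∈js) off
      rewrite off j′ (here ≡.refl) (λ { ≡.refl → All.lookup j′∉js j∈js ≡.refl }) =
      offerAll-single ts Z X unique j∈js (λ i i∈ → off i (there i∈))

    slotQueries-unique : ∀ t → Unique (slotQueries t)
    slotQueries-unique t = filter⁺ (λ j → T? (does (slot j ≟ᶠ t))) (allFin⁺ n)

    ∈-slotQueries⁺ : ∀ {t j} → slot j ≡ t → j ∈ slotQueries t
    ∈-slotQueries⁺ {t} {j} eq = ∈-filter⁺ (λ j → T? (does (slot j ≟ᶠ t))) (∈-allFin j)
      (Equivalence.from T-≡ (dec-true (slot j ≟ᶠ t) eq))

    ∈-slotQueries⁻ : ∀ {t j} → j ∈ slotQueries t → slot j ≡ t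
    ∈-slotQueries⁻ {t} {j} j∈ with slot j ≟ᶠ t | proj₂ (∈-filter⁻ (λ j → T? (does (slot j ≟ᶠ t))) {xs = allFin n} j∈)
    ... | yes eq | _ = eq

    covered-map : ∀ ts {j} → covered (List.map (k ,_) ts) j ≡ true → slot j ∈ ts
    covered-map (t ∷ ts) {j} eq with inBlock k t j in j∈b
    ... | true  = here (≡.cong proj₂ (inB⇒≡ (k , t) j∈b))
    ... | false = there (covered-map ts eq)

    -- Only blocks of `k` are drawn and the queries of the slots ahead start blank, so each of these
    -- slots contains at most one offer, and the order within a slot is immaterial.
    𝔼-gain≥ : ∀ ts → Unique ts → ∀ Z X →
      (∀ j → slot j ∈ ts → Z j ≡ nothing) → (∀ i j → slot j ∈ ts → X i j ≡ false) →
      potential ts X ≤ 𝔼 (List.map (k ,_) ts) (λ Y → gain k (runOn ts Y X)) Z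
    𝔼-gain≥ [] _ Z X _ _ = ≤-reflexive (+-identityʳ _)
    𝔼-gain≥ (t ∷ ts) (t∉ts ∷ unique) Z X off fresh = begin
      gain k X + E k (t ∷ ts) (remaining X k)
        ≈⟨ trans (+-congˡ (E-advantage t ts (remaining X k))) (sym (+-assoc _ _ _)) ⟩
      potential ts X + blockSum k t (λ i j → x i j * advantage ts (remaining X k) i j)
        ≤⟨ outcomeStep-≥ k t {𝔼 bs (λ Y → gain k (runOn (t ∷ ts) Y X))} Z _ _ stay move ⟩
      𝔼 (List.map (k ,_) (t ∷ ts)) (λ Y → gain k (runOn (t ∷ ts) Y X)) Z ∎
      where
      bs = List.map (k ,_) ts

      slot∉ : ∀ {j} → slot j ≡ t → slot j ∉ ts
      slot∉ eq j∈ = All.lookup t∉ts j∈ (≡.sym eq)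

      after : ∀ Y → (∀ j → slot j ∈ ts → Y j ≡ nothing) →
              potential ts (offerAll ts Y X (slotQueries t)) ≤ 𝔼 bs (λ Y → gain k (runOn (t ∷ ts) Y X)) Y
      after Y Y-off = ≤-trans
        (𝔼-gain≥ ts unique Y X′ Y-off (λ i j j∈ → ≡.trans
          (offerAll-otherColumn ts Y X (slotQueries t) (λ j∈t → slot∉ (∈-slotQueries⁻ j∈t) j∈))
          (fresh i j (there j∈))))
        -- The run reads slot `t` from the final outcome `W`, the induction hypothesis from `Y`;
        -- later blocks do not touch that slot, so the two readings agree.
        (≤-reflexive (𝔼-local bs Y (λ W W∼Y → reflexive (≡.cong (λ X → gain k (runOn ts W X))
          (offerAll-cong ts X (slotQueries t) (λ j j∈t → ≡.sym (W∼Y j (uncovered j (∈-slotQueries⁻ j∈t)))))))))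
        where
        X′ = offerAll ts Y X (slotQueries t)
        uncovered : ∀ j → slot j ≡ t → covered bs j ≡ false
        uncovered j eq with covered bs j in j∈bs
        ... | false = ≡.refl
        ... | true  = contradiction (covered-map ts j∈bs) (slot∉ eq)

      stay : potential ts X ≤ 𝔼 bs (λ Y → gain k (runOn (t ∷ ts) Y X)) Z
      stay = ≤-trans
        (≤-reflexive (reflexive (≡.cong (potential ts) (≡.sym
          (offerAll-nothing ts Z X (slotQueries t) (λ j j∈ → off j (here (∈-slotQueries⁻ j∈))))))))
        (after Z (λ j j∈ → off j (there j∈)))

      move : ∀ i j → inBlock k t j ≡ true → potential ts X + advantage ts (remaining X k) i j ≤
             𝔼 bs (λ Y → gain k (runOn (t ∷ ts) Y X)) (Z [ j ≔ just i ])
      move i j j∈b = ≤-trans (potential-offer ts i j X j∈S (fresh i j (here j∈t)))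
        (≤-trans
          (≤-reflexive (reflexive (≡.cong (potential ts) (≡.sym (≡.trans
            (offerAll-single ts Z′ X (slotQueries-unique t) (∈-slotQueries⁺ j∈t)
              (λ l l∈ l≢j → ≡.trans (minimal Z l≢j) (off l (here (∈-slotQueries⁻ l∈)))))
            (≡.cong (λ a → offer ts j a X) (updates Z j)))))))
          (after Z′ (λ l l∈ → ≡.trans (minimal Z (λ { ≡.refl → slot∉ j∈t l∈ })) (off l (there l∈)))))
        where
        Z′ = Z [ j ≔ just i ]
        j∈S : customer j ≡ k
        j∈S = ≡.cong proj₁ (inB⇒≡ (k , t) j∈b)
        j∈t : slot j ≡ t
        j∈t = ≡.cong proj₂ (inB⇒≡ (k , t) j∈b)

    load-empty : load M empty k ≡ 0
    load-empty = ℕzero {n} (λ j → column (inCustomer k j))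
      where
      ℕzero : ∀ {l} {f : Fin l → ℕ} → (∀ j → f j ≡ 0) → sumℕ f ≡ 0
      ℕzero {zero}  f≡0 = ≡.refl
      ℕzero {suc l} f≡0 = ≡.cong₂ ℕ._+_ (f≡0 zero) (ℕzero (f≡0 ∘ suc))
      column : ∀ b → (if b then sumℕ {m} (λ _ → 0) else 0) ≡ 0
      column true  = ℕzero {m} (λ _ → ≡.refl)
      column false = ≡.refl

    ½*customerValue≤𝔼-gain : ½ * customerValue k ≤ 𝔼 blocks (λ Z → gain k (final Z)) (λ _ → nothing)
    ½*customerValue≤𝔼-gain = begin
      ½ * customerValue k
        ≤⟨ ½*customerValue≤E k ⟩
      E k (allFin u) (capacity k)
        ≡⟨ ≡.cong (λ l → E k (allFin u) (capacity k ∸ l)) (≡.sym load-empty) ⟩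
      E k (allFin u) (remaining empty k)
        ≤⟨ ≤-by (gain k empty) (sumWhen-nonNeg (inCustomer k) (λ j → ∑-nonNeg {m} (λ i → ≤-refl))) (+-comm _ _) ⟩
      potential (allFin u) empty
        ≤⟨ 𝔼-gain≥ (allFin u) (allFin⁺ u) (λ _ → nothing) empty (λ _ _ → ≡.refl) (λ _ _ _ → ≡.refl) ⟩
      𝔼 (List.map (k ,_) (allFin u)) (λ Z → gain k (final Z)) (λ _ → nothing)
        ≈⟨ sym (𝔼-customer (allFin⁺ s) (∈-allFin k) (allFin u) gain-local (λ _ → nothing)) ⟩
      𝔼 blocks (λ Z → gain k (final Z)) (λ _ → nothing) ∎

  ∑customerValue : sum customerValue ≈ lpObjective M x
  ∑customerValue = trans (∑-customers _) (∑-comm {n} {m} _)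

  -- Regrouping the same total by customers and by advertisers lets the 1/2 be earned per customer
  -- and the 1/e be lost per advertiser.
  [½-e⁻¹]*lp≤expectedRevenue : ∀ {e} → IsEuler e → (½ - e ⁻¹) * lpObjective M x ≤ expectedRevenue
  [½-e⁻¹]*lp≤expectedRevenue {e} e-Euler = begin
    (½ - e ⁻¹) * L
      -- In the bracket, `- L` stands for the demand and `(1# - e ⁻¹) * L` for its capped part;
      -- together they bound the negated excess.
      ≈⟨ solve 3 (λ h f l → (h :- f) :* l := h :* l :+ (:- l :+ (con (+ 1) :- f) :* l)) refl ½ (e ⁻¹) L ⟩
    ½ * L + (- L + (1# - e ⁻¹) * L)
      ≈⟨ +-cong (*-congˡ (sym ∑customerValue)) (solve 2 (λ l f → :- l :+ (con (+ 1) :- f) :* l := (:- f) :* l) refl L (e ⁻¹)) ⟩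
    ½ * sum customerValue + (- e ⁻¹) * L
      ≈⟨ +-cong (*-distribˡ-sum {s} ½ _) (*-distribˡ-sum {m} (- e ⁻¹) lpSpend) ⟩
    sum (λ k → ½ * customerValue k) + sum (λ i → (- e ⁻¹) * lpSpend i)
      ≤⟨ +-mono-≤ (∑-mono {s} ½*customerValue≤𝔼-gain) (∑-mono {m} loss) ⟩
    sum (λ k → 𝔼 blocks (λ Z → gain k (final Z)) Z₀) + sum (λ i → 𝔼 blocks (λ Z → - demand i Z + cappedDemand i Z) Z₀)
      ≈⟨ +-cong (sym (𝔼-∑ blocks {s} (λ k Z → gain k (final Z)) Z₀))
                (sym (𝔼-∑ blocks {m} (λ i Z → - demand i Z + cappedDemand i Z) Z₀)) ⟩
    𝔼 blocks (λ Z → sum (λ k → gain k (final Z))) Z₀ + 𝔼 blocks (λ Z → sum (λ i → - demand i Z + cappedDemand i Z)) Z₀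
      ≈⟨ sym (𝔼-+ blocks _ _ Z₀) ⟩
    𝔼 blocks (λ Z → sum (λ k → gain k (final Z)) + sum (λ i → - demand i Z + cappedDemand i Z)) Z₀
      ≤⟨ 𝔼-mono blocks revenue≥ Z₀ ⟩
    𝔼 blocks (λ Z → revenue M (final Z)) Z₀
      ≈⟨ sym expectedRevenue≈𝔼 ⟩
    expectedRevenue ∎
    where
    L = lpObjective M x
    Z₀ : Outcome
    Z₀ _ = nothing
    loss : ∀ i → (- e ⁻¹) * lpSpend i ≤ 𝔼 blocks (λ Z → - demand i Z + cappedDemand i Z) Z₀
    loss i = begin
      (- e ⁻¹) * lpSpend i
        ≈⟨ solve 2 (λ l f → (:- f) :* l := :- l :+ (con (+ 1) :- f) :* l) refl (lpSpend i) (e ⁻¹) ⟩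
      - lpSpend i + (1# - e ⁻¹) * lpSpend i
        ≤⟨ +-mono-≤ (𝔼-demand i) (𝔼-cappedDemand i e-Euler) ⟩
      𝔼 blocks (λ Z → - demand i Z) Z₀ + 𝔼 blocks (cappedDemand i) Z₀
        ≈⟨ sym (𝔼-+ blocks _ _ Z₀) ⟩
      𝔼 blocks (λ Z → - demand i Z + cappedDemand i Z) Z₀ ∎

-- The linear program dominates the offline optimum

module OfflineBound {c ℓ₁ ℓ₂ : Level} (F : OrderedField c ℓ₁ ℓ₂)
  (M : AdCell.Market F) (x : AdCell.FractionalAllocation F M) (x-feasible : AdCell.LPFeasible F M x) where

  open FieldProperties F
  open FunctionSums F
  open Outcomes F M x x-feasible
  open OutcomeExpectation F M x x-feasible
  open Analysis F M x x-feasible using (paid)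
  open AdCell F
  open Market M
  private
    module ℕSum = MonoidSum ℕₚ.+-0-commutativeMonoid
  open ℕSum using () renaming (sum to sumℕ)
  open ≤-Reasoning poset

  blockWeight-nonNeg : ∀ k t js → 0# ≤ blockWeight M k t js
  blockWeight-nonNeg k t []          = x≤y⇒0≤y-x (blockProb≤1 k t)
  blockWeight-nonNeg k t (j ∷ [])    = prob≥0 j
  blockWeight-nonNeg k t (_ ∷ _ ∷ _) = ≤-refl

  productOver-nonNeg : ∀ {A : Set} (as : List A) {f : A → Carrier} → (∀ a → 0# ≤ f a) → 0# ≤ productOver as f
  productOver-nonNeg []       0≤f = 0≤1
  productOver-nonNeg (a ∷ as) 0≤f = *-nonNegative (0≤f a) (productOver-nonNeg as 0≤f)

  weight : Arrivals M → Carrier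
  weight I = productOver blocks (λ b → blockLaw b I)

  weight-nonNeg : ∀ I → 0# ≤ weight I
  weight-nonNeg I = productOver-nonNeg blocks (λ (k , t) → blockWeight-nonNeg k t (selected (inBlock k t) I))

  𝔼ᴵ : (Arrivals M → Carrier) → Carrier
  𝔼ᴵ = 𝔼-arrivals M

  𝔼ᴵ-mono : ∀ {f g} → (∀ I → f I ≤ g I) → 𝔼ᴵ f ≤ 𝔼ᴵ g
  𝔼ᴵ-mono {f} {g} f≤g = begin
    𝔼ᴵ f                                                             ≈⟨ 𝔼-arrivals≈sumOnMask f ⟩
    sumOnMask (covered blocks) (λ _ → false) (λ I → weight I * f I)  ≤⟨ sumOnMask-mono (covered blocks) _ (λ I → *-monoʳ-≤ (weight-nonNeg I) (f≤g I)) ⟩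
    sumOnMask (covered blocks) (λ _ → false) (λ I → weight I * g I)  ≈⟨ sym (𝔼-arrivals≈sumOnMask g) ⟩
    𝔼ᴵ g                                                             ∎

  𝔼ᴵ-cong : ∀ {f g} → (∀ I → f I ≈ g I) → 𝔼ᴵ f ≈ 𝔼ᴵ g
  𝔼ᴵ-cong f≈g = ≤-antisym (𝔼ᴵ-mono (λ I → ≤-reflexive (f≈g I))) (𝔼ᴵ-mono (λ I → ≥-reflexive (f≈g I)))

  𝔼ᴵ-+ : ∀ f g → 𝔼ᴵ (λ I → f I + g I) ≈ 𝔼ᴵ f + 𝔼ᴵ g
  𝔼ᴵ-+ f g = begin-equality
    𝔼ᴵ (λ I → f I + g I)
      ≈⟨ 𝔼-arrivals≈sumOnMask _ ⟩
    sumOnMask (covered blocks) (λ _ → false) (λ I → weight I * (f I + g I))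
      ≈⟨ sumOnMask-cong (covered blocks) _ (λ I _ → distribˡ _ _ _) ⟩
    sumOnMask (covered blocks) (λ _ → false) (λ I → weight I * f I + weight I * g I)
      ≈⟨ sumOnMask-+ (covered blocks) _ _ _ ⟩
    sumOnMask (covered blocks) (λ _ → false) (λ I → weight I * f I) +
    sumOnMask (covered blocks) (λ _ → false) (λ I → weight I * g I)
      ≈⟨ sym (+-cong (𝔼-arrivals≈sumOnMask f) (𝔼-arrivals≈sumOnMask g)) ⟩
    𝔼ᴵ f + 𝔼ᴵ g ∎

  *-𝔼ᴵ : ∀ y f → y * 𝔼ᴵ f ≈ 𝔼ᴵ (λ I → y * f I)
  *-𝔼ᴵ y f = begin-equality
    y * 𝔼ᴵ f
      ≈⟨ *-congˡ (𝔼-arrivals≈sumOnMask f) ⟩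
    y * sumOnMask (covered blocks) (λ _ → false) (λ I → weight I * f I)
      ≈⟨ *-sumOnMask (covered blocks) _ y _ ⟩
    sumOnMask (covered blocks) (λ _ → false) (λ I → y * (weight I * f I))
      ≈⟨ sumOnMask-cong (covered blocks) _ (λ I _ → solve 3 (λ y w f → y :* (w :* f) := w :* (y :* f)) refl y _ _) ⟩
    sumOnMask (covered blocks) (λ _ → false) (λ I → weight I * (y * f I))
      ≈⟨ sym (𝔼-arrivals≈sumOnMask _) ⟩
    𝔼ᴵ (λ I → y * f I) ∎

  𝔼ᴵ-0 : 𝔼ᴵ (λ _ → 0#) ≈ 0#
  𝔼ᴵ-0 = trans (𝔼ᴵ-cong (λ _ → sym (zeroˡ 0#))) (trans (sym (*-𝔼ᴵ 0# _)) (zeroˡ _))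

  𝔼ᴵ-∑ : ∀ {l} (f : Fin l → Arrivals M → Carrier) → 𝔼ᴵ (λ I → sum (λ i → f i I)) ≈ sum (λ i → 𝔼ᴵ (f i))
  𝔼ᴵ-∑ {zero}  f = 𝔼ᴵ-0
  𝔼ᴵ-∑ {suc l} f = trans (𝔼ᴵ-+ (f zero) _) (+-congˡ (𝔼ᴵ-∑ (f ∘ suc)))

  𝔼ᴵ-if : ∀ b f → 𝔼ᴵ (λ I → if b then f I else 0#) ≈ (if b then 𝔼ᴵ f else 0#)
  𝔼ᴵ-if true  f = refl
  𝔼ᴵ-if false f = 𝔼ᴵ-0

  𝔼ᴵ-const : ∀ y → 𝔼ᴵ (λ _ → y) ≈ y
  𝔼ᴵ-const y = trans (𝔼-arrivals≈arrivalExp (λ _ → refl)) (go blocks (λ _ → false))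
    where
    go : ∀ bs I → arrivalExp bs (λ _ → y) I ≈ y
    go []             I = refl
    go (b@(k , t) ∷ bs) I = begin-equality
      (1# - P) * arrivalExp bs (λ _ → y) I + sumWhen (inB b) (λ j → prob j * arrivalExp bs (λ _ → y) (I [ j ≔ true ]))
        ≈⟨ +-cong (*-congˡ (go bs I)) (sumWhen-cong (inB b) (λ j _ →
             trans (*-congˡ (go bs (I [ j ≔ true ]))) (*-comm _ _))) ⟩
      (1# - P) * y + sumWhen (inB b) (λ j → y * prob j)
        ≈⟨ +-congˡ (sym (*-sumWhen (inB b) y prob)) ⟩
      (1# - P) * y + y * P
        ≈⟨ solve 2 (λ p y → (con (+ 1) :- p) :* y :+ y :* p := y) refl P y ⟩
      y ∎
      where
      P = sumWhen (inB b) prob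

  module _ (j : Fin n) where

    arrives : Arrivals M → Carrier
    arrives I = if I j then 1# else 0#

    isQuery : Fin n → Carrier
    isQuery l = if does (j ≟ᶠ l) then 1# else 0#

    arrives-≔ : ∀ I l → I l ≡ false → arrives (I [ l ≔ true ]) ≈ arrives I + isQuery l
    arrives-≔ I l Il with j ≟ᶠ l
    ... | yes ≡.refl rewrite updates I j {true} | Il = sym (+-identityˡ 1#)
    ... | no  j≢l    rewrite minimal I {v = true} j≢l = sym (+-identityʳ _)

    -- Each block adds its own arrivals to the indicator of `j`. Writing the contribution as a sum
    -- over all queries of the block lets `sumOver-blocks` combine the blocks.
    arrivalExp-arrives : ∀ bs → Unique bs → ∀ I → OffCovered false bs I →
      arrivalExp bs arrives I ≈ arrives I + sumOver bs (λ b → sumWhen (inB b) (λ l → prob l * isQuery l))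
    arrivalExp-arrives [] _ I off = sym (+-identityʳ _)
    arrivalExp-arrives (b@(k , t) ∷ bs) (b∉bs ∷ unique) I off = begin-equality
      (1# - P) * arrivalExp bs arrives I + sumWhen (inB b) (λ l → prob l * arrivalExp bs arrives (I [ l ≔ true ]))
        ≈⟨ +-cong (*-congˡ (arrivalExp-arrives bs unique I (OffCovered-tail {b = b} {bs} off)))
             (sumWhen-cong (inB b) (λ l l∈b → trans
               (*-congˡ (trans (arrivalExp-arrives bs unique (I [ l ≔ true ]) (OffCovered-≔ b∉bs off l l∈b))
                               (+-congʳ (arrives-≔ I l (off l (covered-head b bs l∈b))))))
               (solve 4 (λ p a q r → p :* (a :+ q :+ r) := (a :+ r) :* p :+ p :* q) refl _ _ _ R))) ⟩
      (1# - P) * (arrives I + R) + sumWhen (inB b) (λ l → (arrives I + R) * prob l + prob l * isQuery l)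
        ≈⟨ +-congˡ (trans (sumWhen-+ (inB b) _ _) (+-congʳ (sym (*-sumWhen (inB b) _ prob)))) ⟩
      (1# - P) * (arrives I + R) + ((arrives I + R) * P + sumWhen (inB b) (λ l → prob l * isQuery l))
        ≈⟨ solve 4 (λ p a r q → (con (+ 1) :- p) :* (a :+ r) :+ ((a :+ r) :* p :+ q) := a :+ (q :+ r)) refl P (arrives I) R _ ⟩
      arrives I + (sumWhen (inB b) (λ l → prob l * isQuery l) + R) ∎
      where
      P = sumWhen (inB b) prob
      R = sumOver bs (λ b → sumWhen (inB b) (λ l → prob l * isQuery l))

    𝔼ᴵ-arrives : 𝔼ᴵ arrives ≈ prob j
    𝔼ᴵ-arrives = begin-equality
      𝔼ᴵ arrives
        ≈⟨ 𝔼-arrivals≈arrivalExp (λ I≗J → reflexive (≡.cong (if_then 1# else 0#) (I≗J j))) ⟩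
      arrivalExp blocks arrives (λ _ → false)
        ≈⟨ arrivalExp-arrives blocks blocks-unique (λ _ → false) (λ _ _ → ≡.refl) ⟩
      0# + sumOver blocks (λ b → sumWhen (inB b) (λ l → prob l * isQuery l))
        ≈⟨ trans (+-identityˡ _) (sumOver-blocks _) ⟩
      sum (λ l → prob l * isQuery l)
        ≈⟨ ∑-single {n} j (λ l l≢j → trans (*-congˡ (reflexive (≡.cong (if_then 1# else 0#)
             (dec-false (j ≟ᶠ l) (l≢j ∘ ≡.sym))))) (zeroʳ _)) ⟩
      prob j * isQuery j
        ≈⟨ trans (*-congˡ (reflexive (≡.cong (if_then 1# else 0#) (dec-true (j ≟ᶠ j) ≡.refl)))) (*-identityʳ _) ⟩
      prob j ∎

  fromℕ-∑ : ∀ {l} (f : Fin l → ℕ) → fromℕ (sumℕ f) ≈ sum (λ i → fromℕ (f i))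
  fromℕ-∑ {zero}  f = refl
  fromℕ-∑ {suc l} f = trans (fromℕ-+ (f zero) _) (+-congˡ (fromℕ-∑ (f ∘ suc)))

  fromℕ-⟦⟧ : ∀ b → fromℕ ⟦ b ⟧ ≈ (if b then 1# else 0#)
  fromℕ-⟦⟧ true  = +-identityʳ 1#
  fromℕ-⟦⟧ false = refl

  fromℕ-if : ∀ b l → fromℕ (if b then l else 0) ≈ (if b then fromℕ l else 0#)
  fromℕ-if true  l = refl
  fromℕ-if false l = refl

  module _ (off : Arrivals M → Allocation M) (off-feasible : ∀ I → Feasible M I (off I)) where

    -- Scaling the ads of advertiser i down by this factor turns paid into min (paid) (budget).
    scale : Arrivals M → Fin m → Carrier
    scale I i = min (paid (off I) i) (budget i) ÷ paid (off I) i

    scaled : Arrivals M → FractionalAllocation M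
    scaled I i j = if off I i j then scale I i else 0#

    average : FractionalAllocation M
    average i j = 𝔼ᴵ (λ I → scaled I i j)

    paid-nonNeg : ∀ I i → 0# ≤ paid (off I) i
    paid-nonNeg I i = ∑-nonNeg {n} (λ j → if-nonNeg (off I i j) (bid≥0 i j))

    capped-nonNeg : ∀ I i → 0# ≤ min (paid (off I) i) (budget i)
    capped-nonNeg I i = min-glb (paid-nonNeg I i) (budget≥0 i)

    scaled-nonNeg : ∀ I i j → 0# ≤ scaled I i j
    scaled-nonNeg I i j = if-nonNeg (off I i j) (*-nonNegative (capped-nonNeg I i) (⁻¹-nonNeg (paid-nonNeg I i)))

    -- The scaling factor is at most 1, so the query and customer constraints of the offline
    -- allocation survive the scaling.
    scaled≤ : ∀ I i j → scaled I i j ≤ fromℕ ⟦ off I i j ⟧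
    scaled≤ I i j = ≤-trans
      (if-mono (off I i j) (λ _ → y÷x≤1 (capped-nonNeg I i) (min≤x _ _)))
      (≥-reflexive (fromℕ-⟦⟧ (off I i j)))

    ∑scaled≤ : ∀ I j → sum (λ i → scaled I i j) ≤ fromℕ (sumℕ (λ i → ⟦ off I i j ⟧))
    ∑scaled≤ I j = ≤-trans (∑-mono {m} (λ i → scaled≤ I i j)) (≥-reflexive (fromℕ-∑ {m} _))

    -- An advertiser that pays nothing gets the default factor 0, which is consistent because its
    -- capped payment is 0 too.
    scaled-spend : ∀ I i → sum (λ j → scaled I i j * bid i j) ≈ min (paid (off I) i) (budget i)
    scaled-spend I i = begin-equality
      sum (λ j → scaled I i j * bid i j)
        ≈⟨ ∑-cong {n} (λ j → if-* (off I i j)) ⟩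
      sum (λ j → (if off I i j then bid i j else 0#) * scale I i)
        ≈⟨ sym (*-distribʳ-sum {n} (scale I i) _) ⟩
      paid (off I) i * scale I i
        ≈⟨ x*[y÷x]≈y (capped-nonNeg I i) (min≤x _ _) ⟩
      min (paid (off I) i) (budget i) ∎
      where
      if-* : ∀ b {y z} → (if b then y else 0#) * z ≈ (if b then z else 0#) * y
      if-* true  = *-comm _ _
      if-* false = trans (zeroˡ _) (sym (zeroˡ _))

    average-spend : ∀ i → sum (λ j → average i j * bid i j) ≈ 𝔼ᴵ (λ I → min (paid (off I) i) (budget i))
    average-spend i = begin-equality
      sum (λ j → average i j * bid i j)
        ≈⟨ ∑-cong {n} (λ j → trans (*-comm _ _) (trans (*-𝔼ᴵ (bid i j) _) (𝔼ᴵ-cong (λ I → *-comm _ _)))) ⟩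
      sum (λ j → 𝔼ᴵ (λ I → scaled I i j * bid i j))
        ≈⟨ sym (𝔼ᴵ-∑ {n} (λ j I → scaled I i j * bid i j)) ⟩
      𝔼ᴵ (λ I → sum (λ j → scaled I i j * bid i j))
        ≈⟨ 𝔼ᴵ-cong (λ I → scaled-spend I i) ⟩
      𝔼ᴵ (λ I → min (paid (off I) i) (budget i)) ∎

    average-feasible : LPFeasible M average
    average-feasible = record
      { perQuery = λ j → begin
          sum (λ i → average i j)
            ≈⟨ sym (𝔼ᴵ-∑ {m} (λ i I → scaled I i j)) ⟩
          𝔼ᴵ (λ I → sum (λ i → scaled I i j))
            ≤⟨ 𝔼ᴵ-mono (λ I → ≤-trans (∑scaled≤ I j) (≤-trans
                 (fromℕ-mono (Feasible.perQuery (off-feasible I) j)) (≤-reflexive (fromℕ-⟦⟧ (I j))))) ⟩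
          𝔼ᴵ (arrives j)
            ≈⟨ 𝔼ᴵ-arrives j ⟩
          prob j ∎
      ; perCustomer = λ k → begin
          sumWhen (inCustomer k) (λ j → sum (λ i → average i j))
            ≈⟨ sumWhen-cong (inCustomer k) (λ j _ → sym (𝔼ᴵ-∑ {m} (λ i I → scaled I i j))) ⟩
          sumWhen (inCustomer k) (λ j → 𝔼ᴵ (λ I → sum (λ i → scaled I i j)))
            ≈⟨ ∑-cong {n} (λ j → sym (𝔼ᴵ-if (inCustomer k j) (λ I → sum (λ i → scaled I i j)))) ⟩
          sum (λ j → 𝔼ᴵ (λ I → if inCustomer k j then sum (λ i → scaled I i j) else 0#))
            ≈⟨ sym (𝔼ᴵ-∑ {n} (λ j I → if inCustomer k j then sum (λ i → scaled I i j) else 0#)) ⟩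
          𝔼ᴵ (λ I → sumWhen (inCustomer k) (λ j → sum (λ i → scaled I i j)))
            ≤⟨ 𝔼ᴵ-mono (λ I → ≤-trans
                 (sumWhen-mono (inCustomer k) (λ j _ → ∑scaled≤ I j))
                 (≤-trans (≥-reflexive (trans (fromℕ-∑ {n} _) (∑-cong {n} (λ j → fromℕ-if (inCustomer k j) _))))
                          (fromℕ-mono (Feasible.perCustomer (off-feasible I) k)))) ⟩
          𝔼ᴵ (λ _ → fromℕ (capacity k))
            ≈⟨ 𝔼ᴵ-const _ ⟩
          fromℕ (capacity k) ∎
      ; perAdvertiser = λ i → begin
          sum (λ j → average i j * bid i j)           ≈⟨ average-spend i ⟩
          𝔼ᴵ (λ I → min (paid (off I) i) (budget i))  ≤⟨ 𝔼ᴵ-mono (λ I → min≤y _ _) ⟩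
          𝔼ᴵ (λ _ → budget i)                         ≈⟨ 𝔼ᴵ-const _ ⟩
          budget i                                    ∎
      ; lower = λ i j → ≤-trans (≥-reflexive 𝔼ᴵ-0) (𝔼ᴵ-mono (λ I → scaled-nonNeg I i j))
      ; upper = λ i j → ≤-trans (𝔼ᴵ-mono (λ I → ≤-trans (scaled≤ I i j) (⟦⟧≤1 (off I i j)))) (≤-reflexive (𝔼ᴵ-const 1#))
      }
      where
      ⟦⟧≤1 : ∀ b → fromℕ ⟦ b ⟧ ≤ 1#
      ⟦⟧≤1 true  = ≤-reflexive (+-identityʳ 1#)
      ⟦⟧≤1 false = 0≤1

    average-objective : lpObjective M average ≈ expectedOffline M off
    average-objective = trans (∑-cong {m} average-spend)
      (sym (𝔼ᴵ-∑ {m} (λ i I → min (paid (off I) i) (budget i))))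

theorem4 : ∀ {c ℓ₁ ℓ₂} (F : OrderedField c ℓ₁ ℓ₂) →
    let open OrderedField F
        open AdCell F
    in
    (e : Carrier) → IsEuler e →
    (M : Market) →
    (OPT : Carrier) → IsLPValue M OPT →
    (x* : FractionalAllocation M) → LPOptimal M x* →
    ((½ - e ⁻¹) * OPT ≤ AlgorithmC.expectedRevenue M x*)
    × (∀ (off : Arrivals M → Allocation M) →
       (∀ I → OfflineOptimal M I (off I)) →
       (½ - e ⁻¹) * expectedOffline M off ≤ AlgorithmC.expectedRevenue M x*)
theorem4 F e e-Euler M OPT (y , y-optimal , OPT≈y) x x-optimal = fromLP OPT≤x , λ off off-optimal →
  fromLP (≤-trans (≥-reflexive (average-objective off (λ I → OfflineOptimal.feasible (off-optimal I))))
                  (LPOptimal.optimal x-optimal _ (average-feasible off (λ I → OfflineOptimal.feasible (off-optimal I)))))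
  where
  open FieldProperties F
  open Exponential F
  open AdCell F
  open Analysis F M x (LPOptimal.feasible x-optimal)
  open OfflineBound F M x (LPOptimal.feasible x-optimal)

  -- The solution `y` that witnesses `OPT` may differ from the one used by the algorithm; optimality
  -- of `x` compares them.
  OPT≤x : OPT ≤ lpObjective M x
  OPT≤x = ≤-trans (≤-reflexive OPT≈y) (LPOptimal.optimal x-optimal y (LPOptimal.feasible y-optimal))

  -- Both claims compare a quantity with the LP objective; multiplying by `½ - e ⁻¹` preserves the
  -- comparison because `e` is at least 2.
  fromLP : ∀ {v} → v ≤ lpObjective M x → (½ - e ⁻¹) * v ≤ AlgorithmC.expectedRevenue M x
  fromLP v≤ = ≤-trans (*-monoʳ-≤ (x≤y⇒0≤y-x (e⁻¹≤½ e-Euler)) v≤) ([½-e⁻¹]*lp≤expectedRevenue e-Euler)
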